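{- Let $\overline{p}(n)$ be the number of overpartitions of $n$, so that $\sum_{n\ge0}\overline{p}(n)q^n=\prod_{n\ge1}\frac{1-q^{2n}}{(1-q^n)^2}$, with $\overline{p}(x)=0$ unless $x$ is a nonnegative integer. Let $\ell$ be any odd prime. Then for every nonnegative integer $n$, $$\ell^3\,\overline{p}(\ell^2n)+\left(\frac{ -n}{\ell}\right)\ell\,\overline{p}(n)+\overline{p}\!\left(\frac{n}{\ell^2}\right)\equiv(\ell^3+1)\,\overline{p}(n)\pmod{2^{12}}.$$
   Context: An overpartition of $n$ is a partition of $n$ in which the first occurrence of a part may be overlined. $\left(\frac{\cdot}{\ell}\right)$ is the Legendre symbol. -}

module Defs where

open import Data.Nat using (ℕ; zero; suc; _+_; _*_; _∸_; _≤ᵇ_; _≡ᵇ_; _%_; _/_)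
open import Data.Bool using (Bool; true; false; if_then_else_)
open import Data.List using (upTo)
open import Data.Bool.ListAction using (any)
open import Data.Integer using (ℤ; +_; -_)
open import Data.Integer.DivMod using (_%ℕ_)

-- Sum over multiplicities m ≥ 1 of a part of size d (d ≥ 1):
-- multSum f d fuel n = Σ_{m ≥ 1, m·d ≤ n} f (n ∸ m·d)   (for fuel ≥ n / d)
multSum : (ℕ → ℕ) → ℕ → ℕ → ℕ → ℕ
multSum f d zero       n = 0
multSum f d (suc fuel) n =
  if d ≤ᵇ n then f (n ∸ d) + multSum f d fuel (n ∸ d) else 0

-- opBounded k n = number of overpartitions of n all of whose parts are ≤ k.
-- A part size j ≤ k either does not occur, or occurs with multiplicity m ≥ 1,
-- in which case its first occurrence may or may not be overlined (factor 2).
opBounded : ℕ → ℕ → ℕ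
opBounded zero    n = if n ≡ᵇ 0 then 1 else 0
opBounded (suc k) n = opBounded k n + 2 * multSum (opBounded k) (suc k) n n

-- p̄(n): the number of overpartitions of n (all parts are ≤ n).
pbar : ℕ → ℕ
pbar n = opBounded n n

-- p̄(n / d) with the convention p̄(x) = 0 unless x is a nonnegative integer
-- (d is a positive integer; the value at d = 0 is irrelevant).
pbarFrac : ℕ → ℕ → ℕ
pbarFrac n zero    = 0
pbarFrac n (suc k) = if (n % suc k) ≡ᵇ 0 then pbar (n / suc k) else 0

legendre : ℤ → ℕ → ℤ
legendre a zero    = + 0
legendre a (suc m) with a %ℕ suc m
... | zero  = + 0
... | suc r =
  if any (λ x → ((x * x) % suc m) ≡ᵇ suc r) (upTo (suc m)) then + 1 else - (+ 1)

{-# OPTIONS --safe #-}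

-- By Gauss, Σ p̄(n)(−q)ⁿ = 1/θ with θ = Σ q^{x²}. Since θ = 1 + 2(…), θ^{2^12} ≡ 1 (mod 2^13), so
-- (−1)ⁿ p̄(n) is congruent to the number r_k(n) of representations of n by k = 2^12 − 1 squares, and it
-- suffices to prove the Hecke relation of weight k/2 for r_k modulo 2^12.
--
-- A vector w with |w|² = ℓ²n and w ≢ 0 (mod ℓ) spans an isotropic line of 𝔽_ℓ^k, and w/ℓ lies in the
-- ℓ-neighbour of ℤ^k along that line. If all neighbours were isometric to ℤ^k, counting their vectors of
-- norm n would give the Hecke relation exactly. The defect of a line with i nonzero coordinates occurs
-- 2^{i−1} times, by sign changes of coordinates, so it only has to vanish modulo 2^{13−i}. For i ≥ 12 this
-- follows from v ↦ −v. For i ≤ 11 the neighbour is X^⊥/ℤX for a primitive null vector X of the Lorentzian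
-- lattice ℤ^{12,1} (plus a trivial summand), and the reflections in (1;1,1,1,0,…) and (3;1^11,0)
-- reduce X to (1;1,0,…) or (3;1^9,0,0,0). Hence the neighbour is ℤ^k or E₈ ⊕ ℤ^{k−8}; the latter has the
-- same theta series as ℤ^k modulo 16, and for i ≤ 8 it is excluded by parity.

module Submission where

open import Defs
open import Data.Nat using (ℕ; zero; suc; _^_)
open import Data.Nat.Primality using (Prime; euclidsLemma; ¬prime[1])
open import Data.Integer using (ℤ; +_; -_; _+_; _-_; _*_; 0ℤ; 1ℤ; -1ℤ; ∣_∣; _≤_; _<_; -[1+_]; +≤+; -≤+; +<+; -<+) renaming (_^_ to _^ᶻ_)
open import Data.Integer.Divisibility using (_∣_)
open import Relation.Nullary using (¬_; Dec; yes; no; contradiction)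
import Data.Nat as N
import Data.Nat as ℕ
import Data.Nat.Divisibility as ND
import Data.Nat.Divisibility as ℕ∣
import Data.Nat.DivMod as ℕD
import Data.Nat.Properties as ℕₚ
import Data.Nat.Tactic.RingSolver as ℕR
import Data.Integer.Properties as ℤₚ
open import Data.Integer.DivMod using (_%ℕ_; _/ℕ_; a≡a%ℕn+[a/ℕn]*n; n%ℕd<d)
open import Data.Integer.Divisibility.Signed using (divides; ∣-trans; ∣-refl; ∣m∣n⇒∣m+n; ∣m⇒∣-m; ∣m∣n⇒∣m-n; ∣n⇒∣m*n; ∣m⇒∣m*n; ∣⇒∣ᵤ; ∣ᵤ⇒∣) renaming (_∣_ to _∣ₛ_; _∣?_ to _∣ₛ?_)
open import Data.Integer.Tactic.RingSolver using (solve-∀)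
open import Data.Nat.Coprimality using (prime⇒coprime; coprime-Bézout)
open import Data.Nat.GCD using (module Bézout)
open import Data.Bool using (true; false)
open import Data.Bool.ListAction using (any)
open import Data.Bool.Properties using (T-≡)
open import Data.Empty using (⊥; ⊥-elim)
open import Data.Unit using (⊤; tt)
open import Data.Product using (∃; _×_; _,_; proj₁; proj₂)
open import Data.Sum using (_⊎_; inj₁; inj₂; [_,_])
open import Data.Vec as Vec using (Vec; []; _∷_)
open import Data.List using (List; []; _∷_; _++_; map; concatMap; filter; applyUpTo; upTo)
open import Data.List.Properties using (map-∘; map-id-local; applyUpTo-∷ʳ)
open import Data.List.Membership.Propositional using (_∈_; find; lose)
open import Data.List.Membership.Propositional.Properties using (∈-map⁺; ∈-map⁻; ∈-filter⁺; ∈-filter⁻; ∈-applyUpTo⁺; ∈-applyUpTo⁻; ∈-++⁺ˡ; ∈-++⁺ʳ; ∈-++⁻; ∈-upTo⁺)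
open import Data.List.Membership.Propositional.Properties.WithK using (unique∧set⇒bag)
open import Data.List.Relation.Binary.BagAndSetEquality using (∼bag⇒↭)
open import Data.List.Relation.Binary.Permutation.Propositional as Perm using (_↭_)
open import Data.List.Relation.Unary.Any using (here; there)
open import Data.List.Relation.Unary.Any.Properties using (any⁺; any⁻)
open import Data.List.Relation.Unary.All as All using ([]; _∷_)
open import Data.List.Relation.Unary.AllPairs using ([]; _∷_)
open import Data.List.Relation.Unary.Unique.Propositional using (Unique)
import Data.List.Relation.Unary.Unique.Propositional.Properties as Uniqueₚ
open import Relation.Nullary.Decidable using (_×-dec_; ¬?)
open import Relation.Binary.PropositionalEquality hiding ([_])
open import Function using (_∘_; id; mk⇔)
open import Function.Bundles using (Equivalence)

-- Finite sums and counting

-- Write `k = 2j + 1`. The number of isotropic lines of 𝔽_ℓ^k not orthogonal to a given `y ≢ 0` of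
-- norm `m` is `(ℓ^{2j} − (εℓ)^j η(m)) / ℓ`, with `η` the quadratic character and `ε = (−1/ℓ)`.
-- Counting pairs of a line and a vector in two ways gives the Hecke relation, with the sum of all
-- defects as error term. The choice of `k` produces the coefficients of the theorem: as
-- `ℓ^{j+1} = ℓ^{2^11} ≡ 1`, multiplication by `ℓ²` turns `ℓ^{2j}` into 1, the leading `ℓ` into `ℓ³`
-- and, `j` being odd, `(εℓ)^j η(n)` into `ℓ (−n/ℓ)`. The thresholds for `i` reflect the
-- classification of unimodular lattices: a line with `i` nonzero coordinates involves a neighbour
-- of rank `i`, up to rank 11 only ℤ^i and E₈ ⊕ ℤ^{i-8} exist, and D₁₂⁺ appears in rank 12, where
-- the weight `2^11` and evenness already suffice. Instead of the classification, the proof uses the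
-- two reflections that Vinberg's algorithm adds to the signed permutations of ℤ^{12,1}.

private variable
  A B : Set

∑ : List A → (A → ℤ) → ℤ
∑ []       f = 0ℤ
∑ (x ∷ xs) f = f x + ∑ xs f

∑-cong∈ : ∀ (xs : List A) {f g : A → ℤ} → (∀ {x} → x ∈ xs → f x ≡ g x) → ∑ xs f ≡ ∑ xs g
∑-cong∈ []       e = refl
∑-cong∈ (x ∷ xs) e = cong₂ _+_ (e (here refl)) (∑-cong∈ xs (e ∘ there))

∑-cong : ∀ (xs : List A) {f g : A → ℤ} → (∀ x → f x ≡ g x) → ∑ xs f ≡ ∑ xs g
∑-cong xs e = ∑-cong∈ xs (λ {x} _ → e x)

∑-0 : (xs : List A) → ∑ xs (λ _ → 0ℤ) ≡ 0ℤ
∑-0 []       = refl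
∑-0 (x ∷ xs) = trans (ℤₚ.+-identityˡ _) (∑-0 xs)

∑-+ : ∀ (xs : List A) (f g : A → ℤ) → ∑ xs (λ x → f x + g x) ≡ ∑ xs f + ∑ xs g
∑-+ []       f g = refl
∑-+ (x ∷ xs) f g = trans (cong (_+_ (f x + g x)) (∑-+ xs f g)) (interchange (f x) (g x) (∑ xs f) (∑ xs g))
  where
  interchange : ∀ a b c d → (a + b) + (c + d) ≡ (a + c) + (b + d)
  interchange = solve-∀

∑-*ˡ : ∀ (xs : List A) c (f : A → ℤ) → ∑ xs (λ x → c * f x) ≡ c * ∑ xs f
∑-*ˡ []       c f = sym (ℤₚ.*-zeroʳ c)
∑-*ˡ (x ∷ xs) c f = trans (cong (_+_ (c * f x)) (∑-*ˡ xs c f)) (sym (ℤₚ.*-distribˡ-+ c (f x) (∑ xs f)))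

∑-*ʳ : ∀ (xs : List A) c (f : A → ℤ) → ∑ xs (λ x → f x * c) ≡ ∑ xs f * c
∑-*ʳ xs c f = trans (∑-cong xs (λ x → ℤₚ.*-comm (f x) c)) (trans (∑-*ˡ xs c f) (ℤₚ.*-comm c _))

∑-const : ∀ (xs : List A) c → ∑ xs (λ _ → c) ≡ ∑ xs (λ _ → 1ℤ) * c
∑-const xs c = trans (∑-cong xs (λ _ → sym (ℤₚ.*-identityˡ c))) (∑-*ʳ xs c (λ _ → 1ℤ))

∑-- : ∀ (xs : List A) (f g : A → ℤ) → ∑ xs (λ x → f x - g x) ≡ ∑ xs f - ∑ xs g
∑-- xs f g = trans (∑-+ xs f (λ x → - g x)) (cong (_+_ (∑ xs f))
  (trans (∑-cong xs (λ x → sym (ℤₚ.-1*i≡-i (g x)))) (trans (∑-*ˡ xs -1ℤ g) (ℤₚ.-1*i≡-i _))))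

∑-swap : ∀ (xs : List A) (ys : List B) (f : A → B → ℤ) →
         ∑ xs (λ x → ∑ ys (f x)) ≡ ∑ ys (λ y → ∑ xs (λ x → f x y))
∑-swap []       ys f = sym (∑-0 ys)
∑-swap (x ∷ xs) ys f = trans (cong (_+_ (∑ ys (f x))) (∑-swap xs ys f)) (sym (∑-+ ys (f x) _))

∑-++ : ∀ (xs ys : List A) f → ∑ (xs ++ ys) f ≡ ∑ xs f + ∑ ys f
∑-++ []       ys f = sym (ℤₚ.+-identityˡ _)
∑-++ (x ∷ xs) ys f = trans (cong (_+_ (f x)) (∑-++ xs ys f)) (sym (ℤₚ.+-assoc (f x) _ _))

∑-map : ∀ (g : A → B) (xs : List A) f → ∑ (map g xs) f ≡ ∑ xs (f ∘ g)
∑-map g []       f = refl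
∑-map g (x ∷ xs) f = cong (_+_ (f (g x))) (∑-map g xs f)

∑-concatMap : ∀ (g : A → List B) (xs : List A) f → ∑ (concatMap g xs) f ≡ ∑ xs (λ x → ∑ (g x) f)
∑-concatMap g []       f = refl
∑-concatMap g (x ∷ xs) f = trans (∑-++ (g x) (concatMap g xs) f) (cong (_+_ (∑ (g x) f)) (∑-concatMap g xs f))

∑-↭ : ∀ {xs ys : List A} f → xs ↭ ys → ∑ xs f ≡ ∑ ys f
∑-↭ f Perm.refl         = refl
∑-↭ f (Perm.prep x p)   = cong (_+_ (f x)) (∑-↭ f p)
∑-↭ f (Perm.swap x y p) = trans (cong (λ t → f x + (f y + t)) (∑-↭ f p)) (rot (f x) (f y) _)
  where
  rot : ∀ a b c → a + (b + c) ≡ b + (a + c)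
  rot = solve-∀
∑-↭ f (Perm.trans p q)  = trans (∑-↭ f p) (∑-↭ f q)

∑-∣ : ∀ d (xs : List A) f → (∀ x → d ∣ₛ f x) → d ∣ₛ ∑ xs f
∑-∣ d []       f h = divides 0ℤ refl
∑-∣ d (x ∷ xs) f h = ∣m∣n⇒∣m+n (h x) (∑-∣ d xs f h)

⟦_⟧ : {P : Set} → Dec P → ℤ
⟦ yes _ ⟧ = 1ℤ
⟦ no _ ⟧  = 0ℤ

⟦⟧-cong : ∀ {P Q : Set} (p : Dec P) (q : Dec Q) → (P → Q) → (Q → P) → ⟦ p ⟧ ≡ ⟦ q ⟧
⟦⟧-cong (yes _) (yes _) f g = refl
⟦⟧-cong (no _)  (no _)  f g = refl
⟦⟧-cong (yes p) (no ¬q) f g = contradiction (f p) ¬q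
⟦⟧-cong (no ¬p) (yes q) f g = contradiction (g q) ¬p

⟦⟧-yes : ∀ {P : Set} (p : Dec P) → P → ⟦ p ⟧ ≡ 1ℤ
⟦⟧-yes (yes _) _ = refl
⟦⟧-yes (no ¬p) p = contradiction p ¬p

⟦⟧-no : ∀ {P : Set} (p : Dec P) → ¬ P → ⟦ p ⟧ ≡ 0ℤ
⟦⟧-no (yes p) ¬p = contradiction p ¬p
⟦⟧-no (no _)  _  = refl

∑-filter : ∀ {P : A → Set} (P? : ∀ a → Dec (P a)) (xs : List A) f →
           ∑ (filter P? xs) f ≡ ∑ xs (λ a → ⟦ P? a ⟧ * f a)
∑-filter P? []       f = refl
∑-filter P? (x ∷ xs) f with P? x
... | yes _ = cong₂ _+_ (sym (ℤₚ.*-identityˡ (f x))) (∑-filter P? xs f)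
... | no _  = trans (∑-filter P? xs f) (sym (ℤₚ.+-identityˡ _))

record Finite {A : Set} (P : A → Set) : Set where
  constructor finite
  field
    elems    : List A
    unique   : Unique elems
    sound    : ∀ {a} → a ∈ elems → P a
    complete : ∀ {a} → P a → a ∈ elems
open Finite public

card : ∀ {P : A → Set} → Finite P → ℤ
card F = ∑ (elems F) (λ _ → 1ℤ)

-- The maps are total but constrained only on `P` and `Q`; an inverse may thus use divisions such as
-- `half` or `divL`, which are meaningful only on the vectors that satisfy the predicate.
record Bij {A B : Set} (P : A → Set) (Q : B → Set) : Set where
  field
    to      : A → B
    from    : B → A
    to-ok   : ∀ {a} → P a → Q (to a)
    from-ok : ∀ {b} → Q b → P (from b)
    from∘to : ∀ {a} → P a → from (to a) ≡ a
    to∘from : ∀ {b} → Q b → to (from b) ≡ b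
open Bij public

Bij-sym : ∀ {P : A → Set} {Q : B → Set} → Bij P Q → Bij Q P
Bij-sym β = record { to = from β ; from = to β ; to-ok = from-ok β ; from-ok = to-ok β
                   ; from∘to = to∘from β ; to∘from = from∘to β }

Bij-trans : ∀ {C : Set} {P : A → Set} {Q : B → Set} {R : C → Set} → Bij P Q → Bij Q R → Bij P R
Bij-trans β γ = record
  { to = to γ ∘ to β ; from = from β ∘ from γ
  ; to-ok = λ p → to-ok γ (to-ok β p) ; from-ok = λ r → from-ok β (from-ok γ r)
  ; from∘to = λ p → trans (cong (from β) (from∘to γ (to-ok β p))) (from∘to β p)
  ; to∘from = λ r → trans (cong (to γ) (to∘from β (from-ok γ r))) (to∘from γ r) }

finite-transport : ∀ {P : A → Set} {Q : B → Set} → Bij P Q → Finite P → Finite Q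
finite-transport {Q = Q} β F = finite (map (to β) (elems F))
  (Uniqueₚ.map⁻ {f = from β} (subst Unique (sym back) (unique F)))
  (λ m → let (a , a∈ , e) = ∈-map⁻ (to β) m in subst Q (sym e) (to-ok β (sound F a∈)))
  (λ q → subst (_∈ map (to β) (elems F)) (to∘from β q) (∈-map⁺ (to β) (complete F (from-ok β q))))
  where
  back : map (from β) (map (to β) (elems F)) ≡ elems F
  back = trans (sym (map-∘ (elems F))) (map-id-local (All.tabulate (λ a∈ → from∘to β (sound F a∈))))

Finite-↭ : ∀ {P : A → Set} (F G : Finite P) → elems F ↭ elems G
Finite-↭ F G = ∼bag⇒↭ (unique∧set⇒bag (unique F) (unique G)
  (mk⇔ (complete G ∘ sound F) (complete F ∘ sound G)))

∑-bij : ∀ {P : A → Set} {Q : B → Set} (F : Finite P) (G : Finite Q) (β : Bij P Q)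
        (φ : A → ℤ) (ψ : B → ℤ) → (∀ {a} → P a → φ a ≡ ψ (to β a)) →
        ∑ (elems F) φ ≡ ∑ (elems G) ψ
∑-bij F G β φ ψ e = trans (∑-cong∈ (elems F) (e ∘ sound F))
  (trans (sym (∑-map (to β) (elems F) ψ)) (∑-↭ ψ (Finite-↭ (finite-transport β F) G)))

card-bij : ∀ {P : A → Set} {Q : B → Set} (F : Finite P) (G : Finite Q) → Bij P Q → card F ≡ card G
card-bij F G β = ∑-bij F G β _ _ (λ _ → refl)

finite-filter : ∀ {P Q : A → Set} → (∀ a → Dec (Q a)) → Finite P → Finite (λ a → P a × Q a)
finite-filter Q? F = finite (filter Q? (elems F)) (Uniqueₚ.filter⁺ Q? (unique F))
  (λ m → let (a∈ , q) = ∈-filter⁻ Q? m in sound F a∈ , q)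
  (λ (p , q) → ∈-filter⁺ Q? (complete F p) q)

card-filter : ∀ {P Q : A → Set} (Q? : ∀ a → Dec (Q a)) (F : Finite P) →
              card (finite-filter Q? F) ≡ ∑ (elems F) (λ a → ⟦ Q? a ⟧)
card-filter Q? F = trans (∑-filter Q? (elems F) _) (∑-cong (elems F) (λ a → ℤₚ.*-identityʳ _))

finite-⊎ : ∀ {P : A → Set} {Q : B → Set} → Finite P → Finite Q → Finite {A ⊎ B} [ P , Q ]
finite-⊎ {A} {B} {P} {Q} F G = finite (map inj₁ (elems F) ++ map inj₂ (elems G))
  (Uniqueₚ.++⁺ (Uniqueₚ.map⁺ (λ { refl → refl }) (unique F)) (Uniqueₚ.map⁺ (λ { refl → refl }) (unique G)) disj)
  snd cmp
  where
  disj : ∀ {c} → c ∈ map inj₁ (elems F) × c ∈ map inj₂ (elems G) → ⊥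
  disj (m , m') with ∈-map⁻ inj₁ m | ∈-map⁻ inj₂ m'
  ... | _ , _ , refl | _ , _ , ()
  snd : ∀ {c} → c ∈ map inj₁ (elems F) ++ map inj₂ (elems G) → [ P , Q ] c
  snd m with ∈-++⁻ (map inj₁ (elems F)) m
  ... | inj₁ m₁ with ∈-map⁻ inj₁ m₁
  ...   | a , a∈ , refl = sound F a∈
  snd m | inj₂ m₂ with ∈-map⁻ inj₂ m₂
  ...   | b , b∈ , refl = sound G b∈
  cmp : ∀ {c} → [ P , Q ] c → c ∈ map inj₁ (elems F) ++ map inj₂ (elems G)
  cmp {inj₁ a} p = ∈-++⁺ˡ (∈-map⁺ inj₁ (complete F p))
  cmp {inj₂ b} q = ∈-++⁺ʳ _ (∈-map⁺ inj₂ (complete G q))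

card-⊎ : ∀ {P : A → Set} {Q : B → Set} (F : Finite P) (G : Finite Q) →
         card (finite-⊎ F G) ≡ card F + card G
card-⊎ F G = trans (∑-++ (map inj₁ (elems F)) _ _) (cong₂ _+_ (∑-map inj₁ (elems F) _) (∑-map inj₂ (elems G) _))

finite-Σ : ∀ {P : A → Set} {Q : A → B → Set} → Finite P → (∀ a → Finite (Q a)) →
           Finite {A × B} (λ c → P (proj₁ c) × Q (proj₁ c) (proj₂ c))
finite-Σ {A} {B} {P} {Q} F G = finite (pairs (elems F)) (uniq (unique F)) (λ m → let (m₁ , m₂) = snd (elems F) m in sound F m₁ , sound (G _) m₂)
  (λ (p , q) → cmp (complete F p) (complete (G _) q))
  where
  block : A → List (A × B)
  block a = map (a ,_) (elems (G a))
  pairs : List A → List (A × B)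
  pairs = concatMap block
  snd : ∀ xs {c} → c ∈ pairs xs → proj₁ c ∈ xs × proj₂ c ∈ elems (G (proj₁ c))
  snd (x ∷ xs) m with ∈-++⁻ (block x) m
  ... | inj₁ m₁ with ∈-map⁻ (x ,_) m₁
  ...   | b , b∈ , refl = here refl , b∈
  snd (x ∷ xs) m | inj₂ m₂ = let (u , v) = snd xs m₂ in there u , v
  cmp : ∀ {xs a b} → a ∈ xs → b ∈ elems (G a) → (a , b) ∈ pairs xs
  cmp (here refl) b∈ = ∈-++⁺ˡ (∈-map⁺ _ b∈)
  cmp {x ∷ _} (there a∈) b∈ = ∈-++⁺ʳ (block x) (cmp a∈ b∈)
  uniq : ∀ {xs} → Unique xs → Unique (pairs xs)
  uniq {[]} [] = []
  uniq {x ∷ xs} (x∉ ∷ u) = Uniqueₚ.++⁺ (Uniqueₚ.map⁺ (λ { refl → refl }) (unique (G x))) (uniq u) disj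
    where
    disj : ∀ {c} → c ∈ block x × c ∈ pairs xs → ⊥
    disj (m , m') with ∈-map⁻ (x ,_) m
    ... | b , _ , refl = All.lookup x∉ (proj₁ (snd xs m')) refl

∑-Σ : ∀ {P : A → Set} {Q : A → B → Set} (F : Finite P) (G : ∀ a → Finite (Q a)) f →
      ∑ (elems (finite-Σ F G)) f ≡ ∑ (elems F) (λ a → ∑ (elems (G a)) (λ b → f (a , b)))
∑-Σ F G f = trans (∑-concatMap _ (elems F) f) (∑-cong (elems F) (λ a → ∑-map (a ,_) (elems (G a)) f))

-- `τ` exchanges the part where `Q` holds with the part where it fails. Iterated, this gives the
-- divisibility by 16 for E₈; applied to `v ↦ −v`, it gives the evenness of the defects.
card-half : ∀ {P Q : A → Set} (Q? : ∀ a → Dec (Q a)) (F : Finite P) (τ : A → A) →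
            (∀ {a} → P a → P (τ a)) → (∀ {a} → P a → τ (τ a) ≡ a) →
            (∀ {a} → P a → Q a → ¬ Q (τ a)) → (∀ {a} → P a → ¬ Q a → Q (τ a)) →
            card F ≡ + 2 * card (finite-filter Q? F)
card-half {A} {P} {Q} Q? F τ τP ττ q→ ¬q→ =
  trans (card-bij F (finite-⊎ F₁ F₁) β) (trans (card-⊎ F₁ F₁) (dbl (card F₁)))
  where
  F₁ = finite-filter Q? F
  dbl : ∀ a → a + a ≡ + 2 * a
  dbl = solve-∀
  fw : A → A ⊎ A
  fw a with Q? a
  ... | yes _ = inj₁ a
  ... | no _  = inj₂ (τ a)
  bw : A ⊎ A → A
  bw (inj₁ a) = a
  bw (inj₂ a) = τ a
  fw-ok : ∀ {a} → P a → [ (λ a → P a × Q a) , (λ a → P a × Q a) ] (fw a)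
  fw-ok {a} p with Q? a
  ... | yes q = p , q
  ... | no ¬q = τP p , ¬q→ p ¬q
  bw-ok : ∀ {c} → [ (λ a → P a × Q a) , (λ a → P a × Q a) ] c → P (bw c)
  bw-ok {inj₁ a} (p , _) = p
  bw-ok {inj₂ a} (p , _) = τP p
  bf : ∀ {a} → P a → bw (fw a) ≡ a
  bf {a} p with Q? a
  ... | yes q = refl
  ... | no ¬q = ττ p
  fb : ∀ {c} → [ (λ a → P a × Q a) , (λ a → P a × Q a) ] c → fw (bw c) ≡ c
  fb {inj₁ a} (p , q) with Q? a
  ... | yes _ = refl
  ... | no ¬q = contradiction q ¬q
  fb {inj₂ a} (p , q) with Q? (τ a)
  ... | yes q' = contradiction q' (q→ p q)
  ... | no _ = cong inj₂ (ττ p)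
  β : Bij P [ (λ a → P a × Q a) , (λ a → P a × Q a) ]
  β = record { to = fw ; from = bw ; to-ok = fw-ok ; from-ok = λ {c} → bw-ok {c} ; from∘to = bf ; to∘from = λ {c} → fb {c} }

-- Integer vectors and numbers of representations

∣i∣≤i*i : ∀ i → + ∣ i ∣ ≤ i * i
∣i∣≤i*i (+ zero)  = ℤₚ.≤-refl
∣i∣≤i*i (+ suc n) = +≤+ (ℕₚ.m≤m+n (suc n) _)
∣i∣≤i*i -[1+ n ]  = +≤+ (ℕₚ.m≤m+n (suc n) _)

0≤i*i : ∀ i → 0ℤ ≤ i * i
0≤i*i i = ℤₚ.≤-trans (+≤+ ℕ.z≤n) (∣i∣≤i*i i)

-- Serves twice: as the search range for a coordinate of a vector of given norm, and with `N = h` as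
-- the balanced residue system modulo `ℓ = 2h + 1`.
symInterval : ℕ → List ℤ
symInterval N = 0ℤ ∷ (applyUpTo (λ i → + suc i) N ++ applyUpTo -[1+_] N)

finite-symInterval : ∀ N → Finite (λ x → ∣ x ∣ ℕ.≤ N)
finite-symInterval N = finite (symInterval N) uniq snd cmp
  where
  P₊ = λ i → + suc i
  0∉₊ : ∀ {x} → x ∈ applyUpTo P₊ N → 0ℤ ≢ x
  0∉₊ m e with ∈-applyUpTo⁻ P₊ m
  0∉₊ m () | i , i<N , refl
  0∉₋ : ∀ {x} → x ∈ applyUpTo -[1+_] N → 0ℤ ≢ x
  0∉₋ m e with ∈-applyUpTo⁻ -[1+_] m
  0∉₋ m () | i , i<N , refl
  disj : ∀ {x} → x ∈ applyUpTo P₊ N × x ∈ applyUpTo -[1+_] N → ⊥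
  disj (m , m') with ∈-applyUpTo⁻ P₊ m | ∈-applyUpTo⁻ -[1+_] m'
  ... | _ , _ , refl | _ , _ , ()
  uniq : Unique (symInterval N)
  uniq = All.tabulate (λ m → [ 0∉₊ , 0∉₋ ] (∈-++⁻ (applyUpTo P₊ N) m))
       ∷ Uniqueₚ.++⁺ (Uniqueₚ.applyUpTo⁺₁ P₊ N (λ { i<i _ refl → ℕₚ.<-irrefl refl i<i }))
           (Uniqueₚ.applyUpTo⁺₁ -[1+_] N (λ { i<i _ refl → ℕₚ.<-irrefl refl i<i })) disj
  snd : ∀ {x} → x ∈ symInterval N → ∣ x ∣ ℕ.≤ N
  snd (here refl) = ℕ.z≤n
  snd (there m) with ∈-++⁻ (applyUpTo P₊ N) m
  ... | inj₁ m₁ with ∈-applyUpTo⁻ P₊ m₁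
  ...   | i , i<N , refl = i<N
  snd (there m) | inj₂ m₂ with ∈-applyUpTo⁻ -[1+_] m₂
  ...   | i , i<N , refl = i<N
  cmp : ∀ {x} → ∣ x ∣ ℕ.≤ N → x ∈ symInterval N
  cmp {+ zero} _ = here refl
  cmp {+ suc i} p = there (∈-++⁺ˡ (∈-applyUpTo⁺ P₊ p))
  cmp { -[1+ i ]} p = there (∈-++⁺ʳ _ (∈-applyUpTo⁺ -[1+_] p))

∑-applyUpTo-suc : ∀ (g : ℕ → ℤ) N (f : ℤ → ℤ) → ∑ (applyUpTo g N) f ≡ ∑ (applyUpTo id N) (f ∘ g)
∑-applyUpTo-suc g N f = go g id N (λ _ → refl)
  where
  go : ∀ (g' : ℕ → ℤ) (h : ℕ → ℕ) N → (∀ i → f (g' i) ≡ f (g (h i))) → ∑ (applyUpTo g' N) f ≡ ∑ (applyUpTo h N) (f ∘ g)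
  go g' h zero e = refl
  go g' h (suc N) e = cong₂ _+_ (e 0) (go (g' ∘ suc) (h ∘ suc) N (e ∘ suc))

∑-symInterval : ∀ N f → ∑ (symInterval N) f ≡ f 0ℤ + ∑ (applyUpTo id N) (λ i → f (+ suc i) + f -[1+ i ])
∑-symInterval N f = cong (_+_ (f 0ℤ)) (trans (∑-++ (applyUpTo _ N) _ f)
  (trans (cong₂ _+_ (∑-applyUpTo-suc _ N f) (∑-applyUpTo-suc -[1+_] N f)) (sym (∑-+ (applyUpTo id N) _ _))))

V : ℕ → Set
V = Vec ℤ

infixl 6 _⊕_
infixr 7 _·_
infix  7 _∙_

_⊕_ : ∀ {n} → V n → V n → V n
[] ⊕ [] = []
(a ∷ x) ⊕ (b ∷ y) = (a + b) ∷ (x ⊕ y)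

_·_ : ∀ {n} → ℤ → V n → V n
t · [] = []
t · (a ∷ x) = (t * a) ∷ (t · x)

_∙_ : ∀ {n} → V n → V n → ℤ
[] ∙ [] = 0ℤ
(a ∷ x) ∙ (b ∷ y) = a * b + x ∙ y

𝟘 : ∀ {n} → V n
𝟘 = Vec.replicate _ 0ℤ

𝟙 : ∀ {n} → V n
𝟙 = Vec.replicate _ 1ℤ

∙-comm : ∀ {n} (x y : V n) → x ∙ y ≡ y ∙ x
∙-comm [] [] = refl
∙-comm (a ∷ x) (b ∷ y) = cong₂ _+_ (ℤₚ.*-comm a b) (∙-comm x y)

∙-⊕ʳ : ∀ {n} (x y z : V n) → x ∙ (y ⊕ z) ≡ x ∙ y + x ∙ z
∙-⊕ʳ [] [] [] = refl
∙-⊕ʳ (a ∷ x) (b ∷ y) (c ∷ z) = trans (cong (_+_ (a * (b + c))) (∙-⊕ʳ x y z)) (lem a b c (x ∙ y) (x ∙ z))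
  where
  lem : ∀ a b c p q → a * (b + c) + (p + q) ≡ (a * b + p) + (a * c + q)
  lem = solve-∀

∙-·ʳ : ∀ {n} t (x y : V n) → x ∙ (t · y) ≡ t * (x ∙ y)
∙-·ʳ t [] [] = sym (ℤₚ.*-zeroʳ t)
∙-·ʳ t (a ∷ x) (b ∷ y) = trans (cong (_+_ (a * (t * b))) (∙-·ʳ t x y)) (lem t a b (x ∙ y))
  where
  lem : ∀ t a b p → a * (t * b) + t * p ≡ t * (a * b + p)
  lem = solve-∀

∙-⊕ˡ : ∀ {n} (x y z : V n) → (y ⊕ z) ∙ x ≡ y ∙ x + z ∙ x
∙-⊕ˡ x y z = trans (∙-comm (y ⊕ z) x) (trans (∙-⊕ʳ x y z) (cong₂ _+_ (∙-comm x y) (∙-comm x z)))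

∙-·ˡ : ∀ {n} t (x y : V n) → (t · y) ∙ x ≡ t * (y ∙ x)
∙-·ˡ t x y = trans (∙-comm (t · y) x) (trans (∙-·ʳ t x y) (cong (t *_) (∙-comm x y)))

∙-𝟘ʳ : ∀ {n} (x : V n) → x ∙ 𝟘 ≡ 0ℤ
∙-𝟘ʳ [] = refl
∙-𝟘ʳ (a ∷ x) = cong₂ _+_ (ℤₚ.*-zeroʳ a) (∙-𝟘ʳ x)

∙-𝟘ˡ : ∀ {n} (x : V n) → 𝟘 ∙ x ≡ 0ℤ
∙-𝟘ˡ x = trans (∙-comm 𝟘 x) (∙-𝟘ʳ x)

0≤∙ : ∀ {n} (x : V n) → 0ℤ ≤ x ∙ x
0≤∙ [] = ℤₚ.≤-refl
0≤∙ (a ∷ x) = ℤₚ.+-mono-≤ (0≤i*i a) (0≤∙ x)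

⊕-assoc-· : ∀ {n} (x y : V n) s t → (x ⊕ s · y) ⊕ t · y ≡ x ⊕ (s + t) · y
⊕-assoc-· [] [] s t = refl
⊕-assoc-· (a ∷ x) (b ∷ y) s t = cong₂ _∷_ (lem a b s t) (⊕-assoc-· x y s t)
  where
  lem : ∀ a b s t → (a + s * b) + t * b ≡ a + (s + t) * b
  lem = solve-∀

⊕-0· : ∀ {n} (x y : V n) → x ⊕ 0ℤ · y ≡ x
⊕-0· [] [] = refl
⊕-0· (a ∷ x) (b ∷ y) = cong₂ _∷_ (ℤₚ.+-identityʳ a) (⊕-0· x y)

·-𝟘 : ∀ {n} t → t · 𝟘 {n} ≡ 𝟘
·-𝟘 {zero} t = refl
·-𝟘 {suc n} t = cong₂ _∷_ (ℤₚ.*-zeroʳ t) (·-𝟘 t)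

Norm : ∀ {k} → ℤ → V k → Set
Norm m v = v ∙ v ≡ m

finite-norm : ∀ k m → Finite {V k} (Norm m)

consBij : ∀ {k} m → Bij {ℤ × V k} (λ c → ∣ proj₁ c ∣ ℕ.≤ ∣ m ∣ × Norm (m - proj₁ c * proj₁ c) (proj₂ c)) (Norm {suc k} m)
consBij m = record
  { to = λ (a , v) → a ∷ v
  ; from = λ { (a ∷ v) → a , v }
  ; to-ok = λ { {a , v} (_ , e) → trans (cong (_+_ (a * a)) e) (i+[j-i] (a * a) m) }
  ; from-ok = λ { {a ∷ v} e → bound a (v ∙ v) (0≤∙ v) e , trans (sym ([i+j]-i (a * a) (v ∙ v))) (cong (_- a * a) e) }
  ; from∘to = λ _ → refl
  ; to∘from = λ { {a ∷ v} _ → refl } }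
  where
  i+[j-i] : ∀ i j → i + (j - i) ≡ j
  i+[j-i] = solve-∀
  [i+j]-i : ∀ i j → (i + j) - i ≡ j
  [i+j]-i = solve-∀
  bound : ∀ a b → 0ℤ ≤ b → a * a + b ≡ m → ∣ a ∣ ℕ.≤ ∣ m ∣
  bound a b 0≤b refl = ℤₚ.drop‿+≤+ (ℤₚ.≤-trans a≤ (ℤₚ.≤-reflexive (sym (ℤₚ.0≤i⇒+∣i∣≡i (ℤₚ.≤-trans (+≤+ ℕ.z≤n) a≤)))))
    where
    a≤ : + ∣ a ∣ ≤ a * a + b
    a≤ = ℤₚ.≤-trans (∣i∣≤i*i a) (ℤₚ.≤-trans (ℤₚ.≤-reflexive (sym (ℤₚ.+-identityʳ _))) (ℤₚ.+-monoʳ-≤ (a * a) 0≤b))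

nilFinite : ∀ m → Finite {V 0} (Norm m)
nilFinite m with m ℤₚ.≟ 0ℤ
... | yes refl = finite ([] ∷ []) ([] ∷ []) (λ { (here refl) → refl }) (λ { {[]} _ → here refl })
... | no m≢0 = finite [] [] (λ ()) (λ { {[]} e → contradiction (sym e) m≢0 })

finite-norm zero m = nilFinite m
finite-norm (suc k) m = finite-transport (consBij m)
  (finite-Σ (finite-symInterval ∣ m ∣) (λ a → finite-norm k (m - a * a)))

r : ℕ → ℤ → ℤ
r k m = card (finite-norm k m)

-- On sequences supported on `m ≥ 0` this is multiplication by `θ = Σ q^{x²}`: terms with `x² > m`
-- vanish there, so the cutoff `|x| ≤ |m|` loses nothing.
Θ : (ℤ → ℤ) → ℤ → ℤ
Θ f m = ∑ (symInterval ∣ m ∣) (λ x → f (m - x * x))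

r-suc : ∀ k m → r (suc k) m ≡ Θ (r k) m
r-suc k m = trans (sym (card-bij pairs (finite-norm (suc k) m) (consBij m))) (∑-Σ (finite-symInterval ∣ m ∣) (λ a → finite-norm k (m - a * a)) _)
  where pairs = finite-Σ (finite-symInterval ∣ m ∣) (λ a → finite-norm k (m - a * a))

-- Overpartitions: p̄(n) ≡ (−1)ⁿ r_k(n)

∑-last : ∀ n (f : ℕ → ℤ) → ∑ (applyUpTo id (suc n)) f ≡ ∑ (applyUpTo id n) f + f n
∑-last n f = trans (cong (λ l → ∑ l f) (sym (applyUpTo-∷ʳ id n)))
  (trans (∑-++ (applyUpTo id n) (n ∷ []) f) (cong (_+_ (∑ (applyUpTo id n) f)) (ℤₚ.+-identityʳ (f n))))

≤⇒≤ᵇ-true : ∀ {m n} → m ℕ.≤ n → (m ℕ.≤ᵇ n) ≡ true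
≤⇒≤ᵇ-true p = Equivalence.to T-≡ (ℕₚ.≤⇒≤ᵇ p)

>⇒≤ᵇ-false : ∀ {m n} → n ℕ.< m → (m ℕ.≤ᵇ n) ≡ false
>⇒≤ᵇ-false {m} {n} p with m ℕ.≤ᵇ n in eq
... | false = refl
... | true  = contradiction (ℕₚ.≤ᵇ⇒≤ m n (Equivalence.from T-≡ eq)) (ℕₚ.<⇒≱ p)

multSum-fuel : ∀ f k fuel fuel' n → n ℕ.≤ fuel → n ℕ.≤ fuel' →
               multSum f (suc k) fuel n ≡ multSum f (suc k) fuel' n
multSum-fuel f k zero zero n p q = refl
multSum-fuel f k zero (suc fuel') zero p q = refl
multSum-fuel f k (suc fuel) zero zero p q = refl
multSum-fuel f k (suc fuel) (suc fuel') n p q with suc k ℕ.≤ᵇ n in eq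
... | false = refl
... | true  = cong (ℕ._+_ (f (n ℕ.∸ suc k))) (multSum-fuel f k fuel fuel' (n ℕ.∸ suc k) (le p) (le q))
  where
  1+k≤n = ℕₚ.≤ᵇ⇒≤ (suc k) n (Equivalence.from T-≡ eq)
  le : ∀ {fu} → n ℕ.≤ suc fu → n ℕ.∸ suc k ℕ.≤ fu
  le p = ℕₚ.≤-trans (ℕₚ.∸-monoʳ-≤ n (ℕ.s≤s {0} {k} ℕ.z≤n)) (ℕₚ.∸-monoˡ-≤ 1 p)

multSum-step : ∀ f k n → suc k ℕ.≤ n →
  multSum f (suc k) n n ≡ f (n ℕ.∸ suc k) ℕ.+ multSum f (suc k) (n ℕ.∸ suc k) (n ℕ.∸ suc k)
multSum-step f k (suc n) p rewrite ≤⇒≤ᵇ-true p =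
  cong (ℕ._+_ (f (n ℕ.∸ k))) (multSum-fuel f k n (n ℕ.∸ k) (n ℕ.∸ k) (ℕₚ.m∸n≤m n k) ℕₚ.≤-refl)

multSum-small : ∀ f k n → n ℕ.< suc k → multSum f (suc k) n n ≡ 0
multSum-small f k zero p = refl
multSum-small f k (suc n) p rewrite >⇒≤ᵇ-false p = refl

-- Extension by 0 to negative arguments makes an identity of power series a recurrence valid at
-- every integer, where multiplication by `q^d` is the shift `m ↦ m − d`.
ext : (ℕ → ℕ) → ℤ → ℤ
ext f (+ n)    = + f n
ext f -[1+ _ ] = 0ℤ

ext-neg : ∀ f {m} → m < 0ℤ → ext f m ≡ 0ℤ
ext-neg f { -[1+ _ ]} _ = refl
ext-neg f {+ n} (+<+ ())

ov : ℕ → ℤ → ℤ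
ov k = ext (opBounded k)

-- The product `B_k = Π_{j≤k} (1 + q^j)/(1 − q^j)` satisfies `(1 − q^{k+1}) B_{k+1} = (1 + q^{k+1})
-- B_k`.
ov-rec : ∀ k m → ov (suc k) m ≡ ov (suc k) (m - + suc k) + ov k m + ov k (m - + suc k)
ov-rec k -[1+ n ] = refl
ov-rec k (+ n) with suc k ℕ.≤? n
... | no 1+k≰n = lem (multSum-small (opBounded k) k n (ℕₚ.≰⇒> 1+k≰n)) (ext-neg (opBounded (suc k)) neg) (ext-neg (opBounded k) neg)
  where
  neg : + n - + suc k < 0ℤ
  neg = subst (+ n - + suc k <_) (ℤₚ.+-inverseʳ (+ suc k)) (ℤₚ.+-monoˡ-< (- + suc k) (+<+ (ℕₚ.≰⇒> 1+k≰n)))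
  lem : ∀ {M u v} → M ≡ 0 → u ≡ 0ℤ → v ≡ 0ℤ → + (opBounded k n ℕ.+ 2 ℕ.* M) ≡ u + + opBounded k n + v
  lem refl refl refl = trans (cong +_ (ℕₚ.+-identityʳ _)) (sym (trans (ℤₚ.+-identityʳ _) (ℤₚ.+-identityˡ _)))
... | yes 1+k≤n rewrite multSum-step (opBounded k) k n 1+k≤n | trans (ℤₚ.m-n≡m⊖n n (suc k)) (ℤₚ.⊖-≥ 1+k≤n) =
  lem (opBounded k n) (opBounded k (n ℕ.∸ suc k)) (multSum (opBounded k) (suc k) (n ℕ.∸ suc k) (n ℕ.∸ suc k))
  where
  alg : ∀ x y z → x + + 2 * (y + z) ≡ (y + + 2 * z) + x + y
  alg = solve-∀
  lem : ∀ x y z → + (x ℕ.+ 2 ℕ.* (y ℕ.+ z)) ≡ + (y ℕ.+ 2 ℕ.* z) + + x + + y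
  lem x y z = trans (cong (_+_ (+ x)) (ℤₚ.pos-* 2 (y ℕ.+ z)))
    (trans (alg (+ x) (+ y) (+ z)) (cong (λ t → + y + t + + x + + y) (sym (ℤₚ.pos-* 2 z))))

sg : ℕ → ℤ
sg zero    = 1ℤ
sg (suc n) = - sg n

-- As a series, `B_{j+1} + B_j = 2 B_j / (1 − q^{j+1})`. Its product with `q^{j+1}` is
-- `B_{j+1} − B_j`, so multiplication by `1 − q^{j+1}` leaves `2 B_j`.
ovPair : ℕ → ℤ → ℤ
ovPair j m = ov (suc j) m + ov j m

ovPair-shift : ∀ j m → ovPair j (m - + suc j) ≡ ov (suc j) m - ov j m
ovPair-shift j m = trans (lem (ov (suc j) (m - + suc j)) (ov j m) (ov j (m - + suc j))) (cong (_- ov j m) (sym (ov-rec j m)))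
  where
  lem : ∀ u v w → u + w ≡ (u + v + w) - v
  lem = solve-∀

ovPair-diff : ∀ j m → ovPair j m - ovPair j (m - + suc j) ≡ + 2 * ov j m
ovPair-diff j m = trans (cong (λ t → ovPair j m - t) (ovPair-shift j m)) (lem (ov (suc j) m) (ov j m))
  where
  lem : ∀ u v → (u + v) - (u - v) ≡ + 2 * v
  lem = solve-∀

-- Multiplication of `f` by the partial theta sum `Σ_{|x|≤n} (−1)^x q^{x²}`.
squareSum : ℕ → (ℤ → ℤ) → ℤ → ℤ
squareSum n f m = f m + ∑ (applyUpTo id n) (λ i → + 2 * (sg (suc i) * f (m - + suc i * + suc i)))

-- The error term of the finite form of Gauss's identity, `Σ_{1≤j≤J} (−1)^j q^{j(N+1)} · 2
-- B_{j−1}/(1 − q^j)`. All its terms have degree above `N`.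
tailSum : ℕ → ℕ → ℤ → ℤ
tailSum N J m = ∑ (applyUpTo id J) (λ j → sg (suc j) * ovPair j (m - + suc j * + suc N))

squareSum-suc : ∀ n f m → squareSum (suc n) f m ≡ squareSum n f m + + 2 * (sg (suc n) * f (m - + suc n * + suc n))
squareSum-suc n f m = trans (cong (_+_ (f m)) (∑-last n _)) (sym (ℤₚ.+-assoc (f m) _ _))

squareSum-comb : ∀ N n (f g : ℤ → ℤ) → (∀ m → f m ≡ f (m - N) + g m + g (m - N)) →
          ∀ m → squareSum n f m ≡ squareSum n f (m - N) + squareSum n g m + squareSum n g (m - N)
squareSum-comb N zero f g e m = trans (ℤₚ.+-identityʳ (f m)) (trans (e m)
  (sym (cong₂ _+_ (cong₂ _+_ (ℤₚ.+-identityʳ (f (m - N))) (ℤₚ.+-identityʳ (g m))) (ℤₚ.+-identityʳ (g (m - N))))))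
squareSum-comb N (suc n) f g e m = begin
  squareSum (suc n) f m ≡⟨ squareSum-suc n f m ⟩
  squareSum n f m + + 2 * (s * f (m - q)) ≡⟨ cong₂ (λ u v → u + + 2 * (s * v)) (squareSum-comb N n f g e m) (e (m - q)) ⟩
  (squareSum n f (m - N) + squareSum n g m + squareSum n g (m - N)) + + 2 * (s * (f (m - q - N) + g (m - q) + g (m - q - N)))
    ≡⟨ cong (λ t → (squareSum n f (m - N) + squareSum n g m + squareSum n g (m - N)) + + 2 * (s * (f t + g (m - q) + g t))) (comm m q N) ⟩
  (squareSum n f (m - N) + squareSum n g m + squareSum n g (m - N)) + + 2 * (s * (f (m - N - q) + g (m - q) + g (m - N - q)))
    ≡⟨ alg (squareSum n f (m - N)) (squareSum n g m) (squareSum n g (m - N)) s (f (m - N - q)) (g (m - q)) (g (m - N - q)) ⟩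
  (squareSum n f (m - N) + + 2 * (s * f (m - N - q))) + (squareSum n g m + + 2 * (s * g (m - q))) + (squareSum n g (m - N) + + 2 * (s * g (m - N - q)))
    ≡⟨ sym (cong₂ _+_ (cong₂ _+_ (squareSum-suc n f (m - N)) (squareSum-suc n g m)) (squareSum-suc n g (m - N))) ⟩
  squareSum (suc n) f (m - N) + squareSum (suc n) g m + squareSum (suc n) g (m - N) ∎
  where
  open ≡-Reasoning
  s = sg (suc n)
  q = + suc n * + suc n
  comm : ∀ m q N → m - q - N ≡ m - N - q
  comm = solve-∀
  alg : ∀ a ov c s x y z → (a + ov + c) + + 2 * (s * (x + y + z)) ≡ (a + + 2 * (s * x)) + (ov + + 2 * (s * y)) + (c + + 2 * (s * z))
  alg = solve-∀

-- With c_j = B_{j-1} q^{jN}, the j-th summand is −2 (−1)^j (c_j + c_{j+1}), so the sum telescopes.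
tailSum-telescope : ∀ n J m → let N = + suc n in
  tailSum (suc n) J m - tailSum (suc n) J (m - N) - tailSum n J m - tailSum n J (m - N)
  ≡ + 2 * ov 0 (m - N) - + 2 * (sg J * ov J (m - + suc J * N))
tailSum-telescope n zero m = trans (lem (ov 0 (m - + suc n))) (cong (λ t → + 2 * ov 0 (m - + suc n) - + 2 * (1ℤ * ov 0 (m - t))) (sym (ℤₚ.*-identityˡ (+ suc n))))
  where
  lem : ∀ u → 0ℤ - 0ℤ - 0ℤ - 0ℤ ≡ + 2 * u - + 2 * (1ℤ * u)
  lem = solve-∀
tailSum-telescope n (suc J) m = begin
  tailSum (suc n) (suc J) m - tailSum (suc n) (suc J) (m - N) - tailSum n (suc J) m - tailSum n (suc J) (m - N)
    ≡⟨ cong₂ _-_ (cong₂ _-_ (cong₂ _-_ (∑-last J _) (∑-last J _)) (∑-last J _)) (∑-last J _) ⟩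
  (tailSum (suc n) J m + s * ovPair J (m - j * + suc (suc n))) - (tailSum (suc n) J (m - N) + s * ovPair J (m - N - j * + suc (suc n)))
    - (tailSum n J m + s * ovPair J (m - j * N)) - (tailSum n J (m - N) + s * ovPair J (m - N - j * N))
    ≡⟨ alg (tailSum (suc n) J m) (tailSum (suc n) J (m - N)) (tailSum n J m) (tailSum n J (m - N)) s _ _ _ _ ⟩
  (tailSum (suc n) J m - tailSum (suc n) J (m - N) - tailSum n J m - tailSum n J (m - N)) +
    s * (ovPair J (m - j * + suc (suc n)) - ovPair J (m - N - j * + suc (suc n)) - ovPair J (m - j * N) - ovPair J (m - N - j * N))
    ≡⟨ cong₂ (λ u v → u + s * v) (tailSum-telescope n J m) summand ⟩
  (+ 2 * ov 0 (m - N) - + 2 * (sg J * ov J (m - j * N))) + s * (- (+ 2 * ov J (m - j * N)) - + 2 * ov (suc J) (m - + suc (suc J) * N))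
    ≡⟨ alg₂ (ov 0 (m - N)) (sg J) (ov J (m - j * N)) (ov (suc J) (m - + suc (suc J) * N)) ⟩
  + 2 * ov 0 (m - N) - + 2 * (s * ov (suc J) (m - + suc (suc J) * N)) ∎
  where
  open ≡-Reasoning
  N = + suc n
  s = sg (suc J)
  j = + suc J
  alg : ∀ p q u v s a ov c d → (p + s * a) - (q + s * ov) - (u + s * c) - (v + s * d) ≡ (p - q - u - v) + s * (a - ov - c - d)
  alg = solve-∀
  alg₂ : ∀ z s x y → (+ 2 * z - + 2 * (s * x)) + (- s) * (- (+ 2 * x) - + 2 * y) ≡ + 2 * z - + 2 * (- s * y)
  alg₂ = solve-∀
  arg₁ : ∀ m j N → m - j * (1ℤ + N) ≡ m - j * N - j
  arg₁ = solve-∀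
  arg₂ : ∀ m j N → m - N - j * (1ℤ + N) ≡ m - (1ℤ + j) * N - j
  arg₂ = solve-∀
  arg₃ : ∀ m j N → m - N - j * N ≡ m - (1ℤ + j) * N
  arg₃ = solve-∀
  alg₃ : ∀ x y u v → (x - y) - (u - v) - (x + y) - (u + v) ≡ - (+ 2 * y) - + 2 * u
  alg₃ = solve-∀
  summand : ovPair J (m - j * + suc (suc n)) - ovPair J (m - N - j * + suc (suc n)) - ovPair J (m - j * N) - ovPair J (m - N - j * N)
          ≡ - (+ 2 * ov J (m - j * N)) - + 2 * ov (suc J) (m - + suc (suc J) * N)
  summand = trans (cong₂ _-_ (cong₂ _-_ (cong₂ _-_
      (trans (cong (ovPair J) (arg₁ m j N)) (ovPair-shift J (m - j * N)))
      (trans (cong (ovPair J) (arg₂ m j N)) (ovPair-shift J (m - (1ℤ + j) * N))))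
      refl) (cong (ovPair J) (arg₃ m j N)))
    (alg₃ (ov (suc J) (m - j * N)) (ov J (m - j * N)) (ov (suc J) (m - (1ℤ + j) * N)) (ov J (m - (1ℤ + j) * N)))

-- `(1 − q^{n+1}) f = 0` forces `f = 0` for a series with no negative powers. This is how
-- denominators are cleared without dividing power series.
shift-invariant⇒0 : ∀ n (f : ℤ → ℤ) → (∀ {m} → m < 0ℤ → f m ≡ 0ℤ) → (∀ m → f m ≡ f (m - + suc n)) → ∀ m → f m ≡ 0ℤ
shift-invariant⇒0 n f neg inv m = go ∣ m ∣ m (ℤ≤ m)
  where
  ℤ≤ : ∀ m → m ≤ + ∣ m ∣
  ℤ≤ (+ _) = ℤₚ.≤-refl
  ℤ≤ -[1+ _ ] = -≤+
  go : ∀ c m → m ≤ + c → f m ≡ 0ℤ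
  go c -[1+ _ ] _ = neg -<+
  go zero (+ zero) _ = trans (inv 0ℤ) (neg -<+)
  go zero (+ suc _) (+≤+ ())
  go (suc c) (+ k) (+≤+ p) = trans (inv (+ k)) (go c (+ k - + suc n) (ℤₚ.≤-trans (ℤₚ.≤-reflexive (lem (+ k) (+ n)))
      (ℤₚ.≤-trans (ℤₚ.i-j≤i (+ k - 1ℤ) (+ n)) (ℤₚ.≤-trans (ℤₚ.+-monoˡ-≤ -1ℤ (+≤+ p)) (ℤₚ.≤-reflexive (ℤₚ.+-comm (+ suc c) -1ℤ))))))
    where
    lem : ∀ k n → k - (1ℤ + n) ≡ k - 1ℤ - n
    lem = solve-∀

squareSum-neg : ∀ n f → (∀ {m} → m < 0ℤ → f m ≡ 0ℤ) → ∀ {m} → m < 0ℤ → squareSum n f m ≡ 0ℤ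
squareSum-neg n f h {m} m<0 = cong₂ _+_ (h m<0) (trans (∑-cong (applyUpTo id n) (λ i →
    trans (cong (λ t → + 2 * (sg (suc i) * t)) (h (ℤₚ.≤-<-trans (ℤₚ.i-j≤i m (+ suc i * + suc i)) m<0)))
      (trans (cong (+ 2 *_) (ℤₚ.*-zeroʳ (sg (suc i)))) refl))) (∑-0 (applyUpTo id n)))

tailSum-neg : ∀ N J {m} → m < + suc N → tailSum N J m ≡ 0ℤ
tailSum-neg N J {m} m< = trans (∑-cong (applyUpTo id J) (λ j →
    trans (cong (sg (suc j) *_) (cong₂ _+_ (ext-neg (opBounded (suc j)) (neg j)) (ext-neg (opBounded j) (neg j)))) (ℤₚ.*-zeroʳ (sg (suc j)))))
  (∑-0 (applyUpTo id J))
  where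
  neg : ∀ j → m - + suc j * + suc N < 0ℤ
  neg j = ℤₚ.<-≤-trans (ℤₚ.+-monoˡ-< (- (+ suc j * + suc N)) m<)
    (ℤₚ.i≤j⇒i-j≤0 (subst (+ suc N ≤_) (ℤₚ.pos-* (suc j) (suc N)) (+≤+ (ℕₚ.m≤m+n (suc N) _))))

-- `B_n Σ_{|x|≤n} (−1)^x q^{x²} = 1 + tail`. In the induction step the difference `X` of the two
-- sides is shown to be killed by `1 − q^{n+1}`. At `m = n` the tail vanishes, which gives Gauss's
-- identity.
gauss-finite : ∀ n m → squareSum n (ov n) m ≡ ov 0 m + tailSum n n m
gauss-finite zero m = refl
gauss-finite (suc n) m = ℤₚ.i-j≡0⇒i≡j _ _ (shift-invariant⇒0 n X X-neg X-inv m)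
  where
  N = + suc n
  X : ℤ → ℤ
  X m = squareSum (suc n) (ov (suc n)) m - (ov 0 m + tailSum (suc n) (suc n) m)
  X-neg : ∀ {m} → m < 0ℤ → X m ≡ 0ℤ
  X-neg {m} m<0 = cong₂ _-_ (squareSum-neg (suc n) (ov (suc n)) (ext-neg _) m<0)
    (cong₂ _+_ (ext-neg (opBounded 0) m<0) (tailSum-neg (suc n) (suc n) (ℤₚ.<-trans m<0 (+<+ (ℕ.s≤s ℕ.z≤n)))))
  alg : ∀ a d d' F F' E E' x y → a + (d + F + + 2 * (y * x)) + (d' + F' + + 2 * (y * E')) - (d + E)
      ≡ a - (d' + E) + (+ 2 * d' + F + F' + + 2 * (y * x) + + 2 * (y * E'))
  alg = solve-∀
  X-inv : ∀ m → X m ≡ X (m - N)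
  X-inv m = begin
    squareSum (suc n) (ov (suc n)) m - (ov 0 m + tailSum (suc n) (suc n) m)
      ≡⟨ cong₂ _-_ (squareSum-comb N (suc n) (ov (suc n)) (ov n) (ov-rec n) m) refl ⟩
    a + squareSum (suc n) (ov n) m + squareSum (suc n) (ov n) (m - N) - (ov 0 m + tailSum (suc n) (suc n) m)
      ≡⟨ cong₂ (λ u v → a + u + v - (ov 0 m + tailSum (suc n) (suc n) m))
           (trans (squareSum-suc n (ov n) m) (cong (_+ + 2 * (s * ov n (m - N * N))) (gauss-finite n m)))
           (trans (squareSum-suc n (ov n) (m - N)) (cong (_+ + 2 * (s * ov n (m - N - N * N))) (gauss-finite n (m - N)))) ⟩
    a + (ov 0 m + tailSum n n m + + 2 * (s * ov n (m - N * N))) + (ov 0 (m - N) + tailSum n n (m - N) + + 2 * (s * ov n (m - N - N * N))) - (ov 0 m + tailSum (suc n) (suc n) m)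
      ≡⟨ alg a (ov 0 m) (ov 0 (m - N)) (tailSum n n m) (tailSum n n (m - N)) (tailSum (suc n) (suc n) m) _ _ s ⟩
    a - (ov 0 (m - N) + tailSum (suc n) (suc n) m) + (+ 2 * ov 0 (m - N) + tailSum n n m + tailSum n n (m - N) + + 2 * (s * ov n (m - N * N)) + + 2 * (s * ov n (m - N - N * N)))
      ≡⟨ cong (λ t → a - (ov 0 (m - N) + tailSum (suc n) (suc n) m) + t) (sym key) ⟩
    a - (ov 0 (m - N) + tailSum (suc n) (suc n) m) + (tailSum (suc n) (suc n) m - tailSum (suc n) (suc n) (m - N))
      ≡⟨ fin a (ov 0 (m - N)) (tailSum (suc n) (suc n) m) (tailSum (suc n) (suc n) (m - N)) ⟩
    X (m - N) ∎
    where
    open ≡-Reasoning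
    a = squareSum (suc n) (ov (suc n)) (m - N)
    s = sg (suc n)
    fin : ∀ a d u v → a - (d + u) + (u - v) ≡ a - (d + v)
    fin = solve-∀
    m' = m - N * (1ℤ + N)
    arg₁ : ∀ m N → m - N - N * (1ℤ + N) ≡ m - N * (1ℤ + N) - N
    arg₁ = solve-∀
    arg₂ : ∀ m N → m - N - N * N ≡ m - N * (1ℤ + N)
    arg₂ = solve-∀
    alg₁ : ∀ u v f g s x y → (u + s * x) - (v + s * y) ≡ (u - v - f - g) + f + g + s * (x - y)
    alg₁ = solve-∀
    alg₂ : ∀ d s x f g z → (+ 2 * d - + 2 * (s * x)) + f + g + (- s) * (+ 2 * z) ≡ + 2 * d + f + g + + 2 * (- s * x) + + 2 * (- s * z)
    alg₂ = solve-∀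
    -- The telescoping covers the first `n` summands; `ovPair-diff` turns the last one, `j = n + 1`,
    -- into the boundary term of degree `N + N²`.
    key : tailSum (suc n) (suc n) m - tailSum (suc n) (suc n) (m - N)
        ≡ + 2 * ov 0 (m - N) + tailSum n n m + tailSum n n (m - N) + + 2 * (s * ov n (m - N * N)) + + 2 * (s * ov n (m - N - N * N))
    key = begin
      tailSum (suc n) (suc n) m - tailSum (suc n) (suc n) (m - N)
        ≡⟨ cong₂ _-_ (∑-last n _) (∑-last n _) ⟩
      (tailSum (suc n) n m + s * ovPair n m') - (tailSum (suc n) n (m - N) + s * ovPair n (m - N - N * (1ℤ + N)))
        ≡⟨ alg₁ (tailSum (suc n) n m) (tailSum (suc n) n (m - N)) (tailSum n n m) (tailSum n n (m - N)) s (ovPair n m') (ovPair n (m - N - N * (1ℤ + N))) ⟩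
      (tailSum (suc n) n m - tailSum (suc n) n (m - N) - tailSum n n m - tailSum n n (m - N)) + tailSum n n m + tailSum n n (m - N) + s * (ovPair n m' - ovPair n (m - N - N * (1ℤ + N)))
        ≡⟨ cong₂ (λ u v → u + tailSum n n m + tailSum n n (m - N) + s * v) (tailSum-telescope n n m)
             (trans (cong (λ t → ovPair n m' - ovPair n t) (arg₁ m N)) (ovPair-diff n m')) ⟩
      (+ 2 * ov 0 (m - N) - + 2 * (sg n * ov n (m - N * N))) + tailSum n n m + tailSum n n (m - N) + s * (+ 2 * ov n m')
        ≡⟨ alg₂ (ov 0 (m - N)) (sg n) (ov n (m - N * N)) (tailSum n n m) (tailSum n n (m - N)) (ov n m') ⟩
      + 2 * ov 0 (m - N) + tailSum n n m + tailSum n n (m - N) + + 2 * (s * ov n (m - N * N)) + + 2 * (s * ov n m')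
        ≡⟨ cong (λ t → + 2 * ov 0 (m - N) + tailSum n n m + tailSum n n (m - N) + + 2 * (s * ov n (m - N * N)) + + 2 * (s * ov n t)) (sym (arg₂ m N)) ⟩
      + 2 * ov 0 (m - N) + tailSum n n m + tailSum n n (m - N) + + 2 * (s * ov n (m - N * N)) + + 2 * (s * ov n (m - N - N * N)) ∎

sg-+ : ∀ a c → sg (a ℕ.+ c) ≡ sg a * sg c
sg-+ zero c = sym (ℤₚ.*-identityˡ (sg c))
sg-+ (suc a) c = trans (cong -_ (sg-+ a c)) (ℤₚ.neg-distribˡ-* (sg a) (sg c))

sg*sg : ∀ a → sg a * sg a ≡ 1ℤ
sg*sg zero = refl
sg*sg (suc a) = trans (lem (sg a)) (sg*sg a)
  where
  lem : ∀ x → - x * - x ≡ x * x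
  lem = solve-∀

sg-square : ∀ a → sg (a ℕ.* a) ≡ sg a
sg-square zero = refl
sg-square (suc a) = begin
  - sg (a ℕ.+ a ℕ.* suc a)          ≡⟨ cong (λ t → - sg (a ℕ.+ t)) (ℕₚ.*-suc a a) ⟩
  - sg (a ℕ.+ (a ℕ.+ a ℕ.* a))      ≡⟨ cong -_ (trans (sg-+ a _) (cong (sg a *_) (sg-+ a _))) ⟩
  - (sg a * (sg a * sg (a ℕ.* a)))  ≡⟨ cong (λ t → - (sg a * (sg a * t))) (sg-square a) ⟩
  - (sg a * (sg a * sg a))          ≡⟨ cong (λ t → - (sg a * t)) (sg*sg a) ⟩
  - (sg a * 1ℤ)                     ≡⟨ cong -_ (ℤₚ.*-identityʳ (sg a)) ⟩
  - sg a ∎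
  where open ≡-Reasoning

opBounded-stable : ∀ d n → opBounded (d ℕ.+ n) n ≡ pbar n
opBounded-stable zero n = refl
opBounded-stable (suc d) n rewrite multSum-small (opBounded (d ℕ.+ n)) (d ℕ.+ n) n (ℕ.s≤s (ℕₚ.m≤n+m n d)) =
  trans (ℕₚ.+-identityʳ _) (opBounded-stable d n)

signedPbar : ℤ → ℤ
signedPbar m = sg ∣ m ∣ * ext pbar m

-- The signs match because `n − x² ≡ n + x` (mod 2); the bound `n` on the parts is harmless since
-- `n − x² ≤ n`.
signedPbar-sub : ∀ n x → signedPbar (+ n - + x * + x) ≡ sg n * (sg x * ov n (+ n - + x * + x))
signedPbar-sub n x with + n - + x * + x in eq
... | -[1+ k ] = trans (ℤₚ.*-zeroʳ (sg (suc k))) (sym (trans (cong (sg n *_) (ℤₚ.*-zeroʳ (sg x))) (ℤₚ.*-zeroʳ (sg n))))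
... | + k = trans (cong₂ (λ u v → u * + v) sign-eq (sym (trans (cong (λ t → opBounded t k) n≡) (opBounded-stable (x ℕ.* x) k))))
              (ℤₚ.*-assoc (sg n) (sg x) _)
  where
  n≡ : n ≡ x ℕ.* x ℕ.+ k
  n≡ = ℤₚ.+-injective (trans (back (+ n) (+ x * + x)) (trans (cong (_+_ (+ x * + x)) eq) (cong (_+ + k) (sym (ℤₚ.pos-* x x)))))
    where
    back : ∀ n q → n ≡ q + (n - q)
    back = solve-∀
  sign-eq : sg k ≡ sg n * sg x
  sign-eq = sym (begin
    sg n * sg x                     ≡⟨ cong (λ t → sg t * sg x) n≡ ⟩
    sg (x ℕ.* x ℕ.+ k) * sg x       ≡⟨ cong (_* sg x) (trans (sg-+ (x ℕ.* x) k) (cong (_* sg k) (sg-square x))) ⟩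
    sg x * sg k * sg x              ≡⟨ lem (sg x) (sg k) ⟩
    sg x * sg x * sg k              ≡⟨ cong (_* sg k) (sg*sg x) ⟩
    1ℤ * sg k                       ≡⟨ ℤₚ.*-identityˡ (sg k) ⟩
    sg k ∎)
    where
    open ≡-Reasoning
    lem : ∀ x k → x * k * x ≡ x * x * k
    lem = solve-∀

Θ-split : ∀ f m → Θ f m ≡ f m + ∑ (applyUpTo id ∣ m ∣) (λ i → + 2 * f (m - + suc i * + suc i))
Θ-split f m = trans (∑-symInterval ∣ m ∣ (λ x → f (m - x * x))) (cong₂ _+_ (cong f (ℤₚ.+-identityʳ m))
  (∑-cong (applyUpTo id ∣ m ∣) (λ i → dbl (f (m - + suc i * + suc i)))))
  where
  dbl : ∀ a → a + a ≡ + 2 * a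
  dbl = solve-∀

-- Gauss: Σ p̄(n) qⁿ · Σ (−1)ˣ q^{x²} = 1, with q replaced by −q.
gauss : ∀ m → Θ signedPbar m ≡ ov 0 m
gauss -[1+ k ] = trans (∑-cong (symInterval (suc k)) (λ x → signedPbar-neg (ℤₚ.≤-<-trans (le x) (-<+ {k} {0})))) (∑-0 (symInterval (suc k)))
  where
  signedPbar-neg : ∀ {m} → m < 0ℤ → signedPbar m ≡ 0ℤ
  signedPbar-neg {m} m<0 = trans (cong (sg ∣ m ∣ *_) (ext-neg pbar m<0)) (ℤₚ.*-zeroʳ (sg ∣ m ∣))
  le : ∀ x → -[1+ k ] - x * x ≤ -[1+ k ]
  le x = ℤₚ.≤-trans (ℤₚ.+-monoʳ-≤ -[1+ k ] (ℤₚ.neg-mono-≤ (0≤i*i x))) (ℤₚ.≤-reflexive (ℤₚ.+-identityʳ _))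
gauss (+ n) = begin
  Θ signedPbar (+ n) ≡⟨ Θ-split signedPbar (+ n) ⟩
  signedPbar (+ n) + ∑ (applyUpTo id n) (λ i → + 2 * signedPbar (+ n - + suc i * + suc i))
    ≡⟨ cong₂ _+_ (trans (cong signedPbar (sym (ℤₚ.+-identityʳ (+ n)))) (trans (signedPbar-sub n 0) (cong (sg n *_) (trans (ℤₚ.*-identityˡ _) (cong (ov n) (ℤₚ.+-identityʳ (+ n)))))))
         (∑-cong (applyUpTo id n) (λ i → trans (cong (+ 2 *_) (signedPbar-sub n (suc i))) (lem (sg n) (sg (suc i)) _))) ⟩
  sg n * ov n (+ n) + ∑ (applyUpTo id n) (λ i → sg n * (+ 2 * (sg (suc i) * ov n (+ n - + suc i * + suc i))))
    ≡⟨ cong (_+_ (sg n * ov n (+ n))) (∑-*ˡ (applyUpTo id n) (sg n) _) ⟩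
  sg n * ov n (+ n) + sg n * ∑ (applyUpTo id n) (λ i → + 2 * (sg (suc i) * ov n (+ n - + suc i * + suc i)))
    ≡⟨ sym (ℤₚ.*-distribˡ-+ (sg n) (ov n (+ n)) _) ⟩
  sg n * squareSum n (ov n) (+ n) ≡⟨ cong (sg n *_) (trans (gauss-finite n (+ n)) (cong (_+_ (ov 0 (+ n))) (tailSum-neg n n (+<+ (ℕₚ.n<1+n n))))) ⟩
  sg n * (ov 0 (+ n) + 0ℤ) ≡⟨ δ n ⟩
  ov 0 (+ n) ∎
  where
  open ≡-Reasoning
  lem : ∀ s t u → + 2 * (s * (t * u)) ≡ s * (+ 2 * (t * u))
  lem = solve-∀
  δ : ∀ n → sg n * (ov 0 (+ n) + 0ℤ) ≡ ov 0 (+ n)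
  δ zero = refl
  δ (suc n) = ℤₚ.*-zeroʳ (sg (suc n))

Θ^ : ℕ → (ℤ → ℤ) → ℤ → ℤ
Θ^ zero    f = f
Θ^ (suc k) f = Θ (Θ^ k f)

Θ-cong : ∀ {f g : ℤ → ℤ} → (∀ m → f m ≡ g m) → ∀ m → Θ f m ≡ Θ g m
Θ-cong e m = ∑-cong (symInterval ∣ m ∣) (λ x → e (m - x * x))

Θ^-cong : ∀ k {f g : ℤ → ℤ} → (∀ m → f m ≡ g m) → ∀ m → Θ^ k f m ≡ Θ^ k g m
Θ^-cong zero e = e
Θ^-cong (suc k) e = Θ-cong (Θ^-cong k e)

Θ^-+ : ∀ a c f m → Θ^ (a ℕ.+ c) f m ≡ Θ^ a (Θ^ c f) m
Θ^-+ zero c f m = refl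
Θ^-+ (suc a) c f = Θ-cong (Θ^-+ a c f)

Θ^-Θ : ∀ k f m → Θ^ k (Θ f) m ≡ Θ^ (suc k) f m
Θ^-Θ zero f m = refl
Θ^-Θ (suc k) f = Θ-cong (Θ^-Θ k f)

Θ^-lin : ∀ k c f g m → Θ^ k (λ x → f x + c * g x) m ≡ Θ^ k f m + c * Θ^ k g m
Θ^-lin zero c f g m = refl
Θ^-lin (suc k) c f g m = trans (Θ-cong (Θ^-lin k c f g) m)
  (trans (∑-+ (symInterval ∣ m ∣) (λ x → Θ^ k f (m - x * x)) (λ x → c * Θ^ k g (m - x * x)))
    (cong (_+_ (Θ^ (suc k) f m)) (∑-*ˡ (symInterval ∣ m ∣) c (λ x → Θ^ k g (m - x * x)))))

r≡Θ^ : ∀ k m → r k m ≡ Θ^ k (ov 0) m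
r≡Θ^ zero m with m ℤₚ.≟ 0ℤ
... | yes refl = refl
r≡Θ^ zero (+ zero) | no ¬p = contradiction refl ¬p
r≡Θ^ zero (+ suc n) | no ¬p = refl
r≡Θ^ zero -[1+ n ] | no ¬p = refl
r≡Θ^ (suc k) m = trans (r-suc k m) (Θ-cong (r≡Θ^ k) m)

2^_ : ℕ → ℤ
2^ zero  = 1ℤ
2^ suc j = + 2 * 2^ j

-- Θ = 1 + 2S, so Θ^{2^j} = 1 + 2^{j+1}(…).
Θ^-2^ : ∀ j f → ∃ λ g → ∀ m → Θ^ (2 ℕ.^ j) f m ≡ f m + 2^ suc j * g m
Θ^-2^ zero f = (λ m → ∑ (applyUpTo id ∣ m ∣) (λ i → f (m - + suc i * + suc i))) ,
  λ m → trans (Θ-split f m) (cong (_+_ (f m)) (∑-*ˡ (applyUpTo id ∣ m ∣) (+ 2) _))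
Θ^-2^ (suc j) f = (λ m → g m + 2^ j * g' m) , eq
  where
  g = proj₁ (Θ^-2^ j f)
  g' = proj₁ (Θ^-2^ j g)
  q = 2 ℕ.^ j
  alg : ∀ f g h c → (f + + 2 * c * g) + + 2 * c * (g + + 2 * c * h) ≡ f + + 2 * (+ 2 * c) * (g + c * h)
  alg = solve-∀
  eq : ∀ m → Θ^ (2 ℕ.^ suc j) f m ≡ f m + 2^ suc (suc j) * (g m + 2^ j * g' m)
  eq m = begin
    Θ^ (q ℕ.+ (q ℕ.+ 0)) f m       ≡⟨ cong (λ t → Θ^ (q ℕ.+ t) f m) (ℕₚ.+-identityʳ q) ⟩
    Θ^ (q ℕ.+ q) f m               ≡⟨ Θ^-+ q q f m ⟩
    Θ^ q (Θ^ q f) m                ≡⟨ Θ^-cong q (proj₂ (Θ^-2^ j f)) m ⟩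
    Θ^ q (λ x → f x + 2^ suc j * g x) m ≡⟨ Θ^-lin q (2^ suc j) f g m ⟩
    Θ^ q f m + 2^ suc j * Θ^ q g m ≡⟨ cong₂ (λ u v → u + 2^ suc j * v) (proj₂ (Θ^-2^ j f) m) (proj₂ (Θ^-2^ j g) m) ⟩
    (f m + 2^ suc j * g m) + 2^ suc j * (g m + 2^ suc j * g' m) ≡⟨ alg (f m) (g m) (g' m) (2^ j) ⟩
    f m + 2^ suc (suc j) * (g m + 2^ j * g' m) ∎
    where open ≡-Reasoning

-- `r k` is `Θ^k` of the unit sequence, and the unit sequence is `Θ signedPbar`; hence `r k` is
-- `Θ^{k+1}` of `signedPbar`, and `k + 1 = 2^j` makes this power trivial modulo `2^{j+1}`.
r≡signedPbar : ∀ k j → suc k ≡ 2 ℕ.^ j → ∀ m → 2^ suc j ∣ₛ r k m - signedPbar m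
r≡signedPbar k j e m = divides (proj₁ (Θ^-2^ j signedPbar) m) (trans (cong (_- signedPbar m) eq) (lem (signedPbar m) (2^ suc j) _))
  where
  lem : ∀ p c g → (p + c * g) - p ≡ g * c
  lem = solve-∀
  eq : r k m ≡ signedPbar m + 2^ suc j * proj₁ (Θ^-2^ j signedPbar) m
  eq = trans (r≡Θ^ k m) (trans (sym (Θ^-cong k gauss m)) (trans (Θ^-Θ k signedPbar m)
    (trans (cong (λ t → Θ^ t signedPbar m) e) (proj₂ (Θ^-2^ j signedPbar) m))))

-- The lattice ℤ^{n,1} and its isometries

∙-++ : ∀ {m n} (x y : V m) (z w : V n) → (x Vec.++ z) ∙ (y Vec.++ w) ≡ x ∙ y + z ∙ w
∙-++ [] [] z w = sym (ℤₚ.+-identityˡ _)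
∙-++ (a ∷ x) (b ∷ y) z w = trans (cong (_+_ (a * b)) (∙-++ x y z w)) (sym (ℤₚ.+-assoc (a * b) _ _))

-- Signed permutations as words in generators: inverses, invariance of the inner product and
-- invariance of the support all follow by recursion on the word.
data SP : ℕ → Set where
  idp  : ∀ {n} → SP n
  prep : ∀ {n} → SP n → SP (suc n)
  swp  : ∀ {n} → SP (suc (suc n))
  negate : ∀ {n} → SP (suc n)
  _⨾_  : ∀ {n} → SP n → SP n → SP n

act : ∀ {n} → SP n → V n → V n
act idp      x           = x
act (prep p) (a ∷ x)     = a ∷ act p x
act swp      (a ∷ b ∷ x) = b ∷ a ∷ x
act negate      (a ∷ x)     = - a ∷ x
act (p ⨾ q)  x           = act q (act p x)

inv : ∀ {n} → SP n → SP n
inv idp      = idp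
inv (prep p) = prep (inv p)
inv swp      = swp
inv negate   = negate
inv (p ⨾ q)  = inv q ⨾ inv p

inv-act : ∀ {n} (p : SP n) x → act (inv p) (act p x) ≡ x
inv-act idp      x           = refl
inv-act (prep p) (a ∷ x)     = cong (a ∷_) (inv-act p x)
inv-act swp      (a ∷ b ∷ x) = refl
inv-act negate      (a ∷ x)     = cong (_∷ x) (ℤₚ.neg-involutive a)
inv-act (p ⨾ q)  x           = trans (cong (act (inv p)) (inv-act q (act p x))) (inv-act p x)

act-inv : ∀ {n} (p : SP n) x → act p (act (inv p) x) ≡ x
act-inv idp      x           = refl
act-inv (prep p) (a ∷ x)     = cong (a ∷_) (act-inv p x)
act-inv swp      (a ∷ b ∷ x) = refl
act-inv negate      (a ∷ x)     = cong (_∷ x) (ℤₚ.neg-involutive a)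
act-inv (p ⨾ q)  x           = trans (cong (act q) (act-inv p (act (inv q) x))) (act-inv q x)

act-∙ : ∀ {n} (p : SP n) x y → act p x ∙ act p y ≡ x ∙ y
act-∙ idp      x           y           = refl
act-∙ (prep p) (a ∷ x)     (b ∷ y)     = cong (_+_ (a * b)) (act-∙ p x y)
act-∙ swp      (a ∷ b ∷ x) (c ∷ d ∷ y) = rot (b * d) (a * c) (x ∙ y)
  where
  rot : ∀ p q s → p + (q + s) ≡ q + (p + s)
  rot = solve-∀
act-∙ negate      (a ∷ x)     (b ∷ y)     = cong (_+ x ∙ y) (lem a b)
  where
  lem : ∀ a b → - a * - b ≡ a * b
  lem = solve-∀
act-∙ (p ⨾ q)  x           y           = trans (act-∙ q (act p x) (act p y)) (act-∙ p x y)

-- The first coordinate is the time-like one.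
⟪_,_⟫ : ∀ {n} → V (suc n) → V (suc n) → ℤ
⟪ a ∷ x , b ∷ y ⟫ = x ∙ y - a * b

⟪⟫-comm : ∀ {n} (X Y : V (suc n)) → ⟪ X , Y ⟫ ≡ ⟪ Y , X ⟫
⟪⟫-comm (a ∷ x) (b ∷ y) = cong₂ _-_ (∙-comm x y) (ℤₚ.*-comm a b)

⟪⟫-linˡ : ∀ {n} t (Y Z W : V (suc n)) → ⟪ Y ⊕ t · Z , W ⟫ ≡ ⟪ Y , W ⟫ + t * ⟪ Z , W ⟫
⟪⟫-linˡ t (b ∷ y) (c ∷ z) (d ∷ w) = trans
  (cong (_- (b + t * c) * d) (trans (∙-⊕ˡ w y (t · z)) (cong (_+_ (y ∙ w)) (∙-·ˡ t w z))))
  (lem t b c d (y ∙ w) (z ∙ w))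
  where
  lem : ∀ t b c d p q → (p + t * q) - (b + t * c) * d ≡ (p - b * d) + t * (q - c * d)
  lem = solve-∀

⟪⟫-linʳ : ∀ {n} t (Y Z W : V (suc n)) → ⟪ W , Y ⊕ t · Z ⟫ ≡ ⟪ W , Y ⟫ + t * ⟪ W , Z ⟫
⟪⟫-linʳ t Y Z W = trans (⟪⟫-comm W (Y ⊕ t · Z)) (trans (⟪⟫-linˡ t Y Z W)
  (cong₂ (λ u v → u + t * v) (⟪⟫-comm Y W) (⟪⟫-comm Z W)))

-- Nullity, primitivity, parity and the cosets in `Cos` are all expressed through inner products, so
-- a bijection preserving these transports them.
record Isom (n : ℕ) : Set where
  field
    fw    : V (suc n) → V (suc n)
    bw    : V (suc n) → V (suc n)
    bw∘fw : ∀ Y → bw (fw Y) ≡ Y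
    fw∘bw : ∀ Y → fw (bw Y) ≡ Y
    pres  : ∀ Y Z → ⟪ fw Y , fw Z ⟫ ≡ ⟪ Y , Z ⟫
open Isom public

_⊚_ : ∀ {n} → Isom n → Isom n → Isom n
g ⊚ h = record
  { fw = fw h ∘ fw g ; bw = bw g ∘ bw h
  ; bw∘fw = λ Y → trans (cong (bw g) (bw∘fw h (fw g Y))) (bw∘fw g Y)
  ; fw∘bw = λ Y → trans (cong (fw h) (fw∘bw g (bw h Y))) (fw∘bw h Y)
  ; pres = λ Y Z → trans (pres h (fw g Y) (fw g Z)) (pres g Y Z) }

permI : ∀ {n} → SP n → Isom n
permI p = record
  { fw = act (prep p) ; bw = act (prep (inv p))
  ; bw∘fw = λ Y → inv-act (prep p) Y ; fw∘bw = λ Y → act-inv (prep p) Y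
  ; pres = λ { (a ∷ x) (b ∷ y) → cong (_- a * b) (act-∙ p x y) } }

-- Norm 2 makes `Y ↦ Y − (2⟪Y,ρ⟫/⟪ρ,ρ⟫) ρ` integral.
reflect : ∀ {n} (ρ : V (suc n)) → ⟪ ρ , ρ ⟫ ≡ + 2 → Isom n
reflect {n} ρ e = record { fw = g ; bw = g ; bw∘fw = gg ; fw∘bw = gg ; pres = pr }
  where
  g : V (suc n) → V (suc n)
  g Y = Y ⊕ (- ⟪ Y , ρ ⟫) · ρ
  gρ : ∀ Y → ⟪ g Y , ρ ⟫ ≡ - ⟪ Y , ρ ⟫
  gρ Y = trans (⟪⟫-linˡ _ Y ρ ρ) (trans (cong (λ t → ⟪ Y , ρ ⟫ + (- ⟪ Y , ρ ⟫) * t) e) (lem ⟪ Y , ρ ⟫))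
    where
    lem : ∀ t → t + (- t) * + 2 ≡ - t
    lem = solve-∀
  gg : ∀ Y → g (g Y) ≡ Y
  gg Y = trans (⊕-assoc-· Y ρ _ _) (trans (cong (λ t → Y ⊕ t · ρ)
    (trans (cong (λ t → - ⟪ Y , ρ ⟫ - t) (gρ Y)) (ℤₚ.+-inverseʳ (- ⟪ Y , ρ ⟫)))) (⊕-0· Y ρ))
  pr : ∀ Y Z → ⟪ g Y , g Z ⟫ ≡ ⟪ Y , Z ⟫
  pr Y Z = trans (⟪⟫-linˡ _ Y ρ (g Z)) (trans (cong₂ (λ u v → u + (- ⟪ Y , ρ ⟫) * v)
      (⟪⟫-linʳ _ Z ρ Y) (trans (⟪⟫-comm ρ (g Z)) (gρ Z))) (lem ⟪ Y , Z ⟫ ⟪ Z , ρ ⟫ ⟪ Y , ρ ⟫))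
    where
    lem : ∀ a z y → a + (- z) * y + (- y) * (- z) ≡ a
    lem = solve-∀

-- `Unimodular` is primitivity: in a unimodular lattice a vector is primitive exactly when some
-- inner product with it equals 1.
Null Unimodular : ∀ {n} → V (suc n) → Set
Null X = ⟪ X , X ⟫ ≡ 0ℤ
Unimodular X = ∃ λ Y → ⟪ X , Y ⟫ ≡ 1ℤ

null-fw : ∀ {n} (g : Isom n) {X} → Null X → Null (fw g X)
null-fw g {X} e = trans (pres g X X) e

unimodular-fw : ∀ {n} (g : Isom n) {X} → Unimodular X → Unimodular (fw g X)
unimodular-fw g {X} (Y , e) = fw g Y , trans (pres g X Y) e

ι : ∀ {n} → Vec ℕ n → V n
ι = Vec.map (λ n → + n)

Below : ∀ {n} → ℕ → Vec ℕ n → Set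
Below c []      = ⊤
Below c (a ∷ v) = a ℕ.≤ c × Below c v

Sorted : ∀ {n} → Vec ℕ n → Set
Sorted []      = ⊤
Sorted (a ∷ v) = Below a v × Sorted v

Below-mono : ∀ {n c d} (v : Vec ℕ n) → c ℕ.≤ d → Below c v → Below d v
Below-mono []      _ _       = tt
Below-mono (a ∷ v) q (p , h) = ℕₚ.≤-trans p q , Below-mono v q h

-- The last clause keeps the bound by a larger head intact, which is what makes the recursive result
-- sorted again.
insert : ∀ {n} a (v : Vec ℕ n) → Sorted v →
  ∃ λ (p : SP (suc n)) → ∃ λ (u : Vec ℕ (suc n)) → act p (ι (a ∷ v)) ≡ ι u × Sorted u × (∀ c → a ℕ.≤ c → Below c v → Below c u)
insert a [] _ = idp , a ∷ [] , refl , (tt , tt) , λ c p _ → p , tt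
insert a (b ∷ v) (bv , sv) with b ℕ.≤? a
... | yes b≤a = idp , a ∷ b ∷ v , refl , ((b≤a , Below-mono v b≤a bv) , (bv , sv)) , λ c p q → p , q
... | no b≰a with insert a v sv
...   | p , u , e , su , bel = (swp ⨾ prep p) , b ∷ u , cong (+ b ∷_) e ,
        (bel b (ℕₚ.<⇒≤ (ℕₚ.≰⇒> b≰a)) bv , su) , λ { c q (b≤c , vc) → b≤c , bel c q vc }

sortAbs : ∀ {n} (v : V n) → ∃ λ (p : SP n) → ∃ λ (u : Vec ℕ n) → act p v ≡ ι u × Sorted u
sortAbs [] = idp , [] , refl , tt
sortAbs (a ∷ v) with sortAbs v
... | p , u , e , su with insert ∣ a ∣ u su
...   | q , w , e' , sw , _ = ((prep p ⨾ proj₁ (signed a u)) ⨾ q) , w ,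
        trans (cong (act q) (trans (cong (λ t → act (proj₁ (signed a u)) (a ∷ t)) e) (proj₂ (signed a u)))) e' , sw
  where
  signed : ∀ {n} (a : ℤ) (u : Vec ℕ n) → ∃ λ (s : SP (suc n)) → act s (a ∷ ι u) ≡ ι (∣ a ∣ ∷ u)
  signed (+ n) u = idp , refl
  signed -[1+ n ] u = negate , refl

sum sq : ∀ {n} → Vec ℕ n → ℕ
sum []      = 0
sum (a ∷ v) = a ℕ.+ sum v
sq []      = 0
sq (a ∷ v) = a ℕ.* a ℕ.+ sq v

ι∙ι : ∀ {n} (v : Vec ℕ n) → ι v ∙ ι v ≡ + sq v
ι∙ι [] = refl
ι∙ι (a ∷ v) = cong₂ _+_ (sym (ℤₚ.pos-* a a)) (ι∙ι v)

ι∙𝟙 : ∀ {n} (v : Vec ℕ n) → ι v ∙ 𝟙 ≡ + sum v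
ι∙𝟙 [] = refl
ι∙𝟙 (a ∷ v) = cong₂ _+_ (ℤₚ.*-identityʳ (+ a)) (ι∙𝟙 v)

𝟙∙𝟙 : ∀ n → 𝟙 {n} ∙ 𝟙 ≡ + n
𝟙∙𝟙 zero = refl
𝟙∙𝟙 (suc n) = cong (_+_ 1ℤ) (𝟙∙𝟙 n)

sq-++ : ∀ {m n} (u : Vec ℕ m) (w : Vec ℕ n) → sq (u Vec.++ w) ≡ sq u ℕ.+ sq w
sq-++ [] w = refl
sq-++ (a ∷ u) w = trans (cong (ℕ._+_ (a ℕ.* a)) (sq-++ u w)) (sym (ℕₚ.+-assoc (a ℕ.* a) (sq u) (sq w)))

2ab≤a²+b² : ∀ a b → 2 ℕ.* (a ℕ.* b) ℕ.≤ a ℕ.* a ℕ.+ b ℕ.* b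
2ab≤a²+b² a b with ℕₚ.≤-total a b
... | inj₁ a≤b with ℕₚ.m≤n⇒∃[o]m+o≡n a≤b
...   | d , refl = subst (2 ℕ.* (a ℕ.* (a ℕ.+ d)) ℕ.≤_) (lem a d) (ℕₚ.m≤m+n _ (d ℕ.* d))
  where
  lem : ∀ a d → 2 ℕ.* (a ℕ.* (a ℕ.+ d)) ℕ.+ d ℕ.* d ≡ a ℕ.* a ℕ.+ (a ℕ.+ d) ℕ.* (a ℕ.+ d)
  lem = ℕR.solve-∀
2ab≤a²+b² a b | inj₂ b≤a with ℕₚ.m≤n⇒∃[o]m+o≡n b≤a
...   | d , refl = subst (2 ℕ.* ((b ℕ.+ d) ℕ.* b) ℕ.≤_) (lem b d) (ℕₚ.m≤m+n _ (d ℕ.* d))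
  where
  lem : ∀ b d → 2 ℕ.* ((b ℕ.+ d) ℕ.* b) ℕ.+ d ℕ.* d ≡ (b ℕ.+ d) ℕ.* (b ℕ.+ d) ℕ.+ b ℕ.* b
  lem = ℕR.solve-∀

cauchy : ∀ {n} (v : Vec ℕ n) → sum v ℕ.* sum v ℕ.≤ n ℕ.* sq v
cauchy [] = ℕ.z≤n
cauchy {suc n} (a ∷ v) = begin
  (a ℕ.+ sum v) ℕ.* (a ℕ.+ sum v)                              ≡⟨ lem₁ a (sum v) ⟩
  a ℕ.* a ℕ.+ (2 ℕ.* (a ℕ.* sum v) ℕ.+ sum v ℕ.* sum v)        ≤⟨ ℕₚ.+-monoʳ-≤ (a ℕ.* a) (ℕₚ.+-mono-≤ (cross v) (cauchy v)) ⟩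
  a ℕ.* a ℕ.+ (n ℕ.* (a ℕ.* a) ℕ.+ sq v ℕ.+ n ℕ.* sq v)         ≡⟨ lem₂ (a ℕ.* a) n (sq v) ⟩
  suc n ℕ.* (a ℕ.* a ℕ.+ sq v) ∎
  where
  open ℕₚ.≤-Reasoning
  lem₁ : ∀ a s → (a ℕ.+ s) ℕ.* (a ℕ.+ s) ≡ a ℕ.* a ℕ.+ (2 ℕ.* (a ℕ.* s) ℕ.+ s ℕ.* s)
  lem₁ = ℕR.solve-∀
  lem₂ : ∀ b n q → b ℕ.+ (n ℕ.* b ℕ.+ q ℕ.+ n ℕ.* q) ≡ suc n ℕ.* (b ℕ.+ q)
  lem₂ = ℕR.solve-∀
  lem₃ : ∀ a x s → 2 ℕ.* (a ℕ.* (x ℕ.+ s)) ≡ 2 ℕ.* (a ℕ.* x) ℕ.+ 2 ℕ.* (a ℕ.* s)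
  lem₃ = ℕR.solve-∀
  lem₄ : ∀ b x n q → b ℕ.+ x ℕ.+ (n ℕ.* b ℕ.+ q) ≡ suc n ℕ.* b ℕ.+ (x ℕ.+ q)
  lem₄ = ℕR.solve-∀
  cross : ∀ {n} (v : Vec ℕ n) → 2 ℕ.* (a ℕ.* sum v) ℕ.≤ n ℕ.* (a ℕ.* a) ℕ.+ sq v
  cross [] = ℕₚ.≤-reflexive (cong (2 ℕ.*_) (ℕₚ.*-zeroʳ a))
  cross {suc n} (x ∷ v) = begin
    2 ℕ.* (a ℕ.* (x ℕ.+ sum v))                        ≡⟨ lem₃ a x (sum v) ⟩
    2 ℕ.* (a ℕ.* x) ℕ.+ 2 ℕ.* (a ℕ.* sum v)            ≤⟨ ℕₚ.+-mono-≤ (2ab≤a²+b² a x) (cross v) ⟩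
    a ℕ.* a ℕ.+ x ℕ.* x ℕ.+ (n ℕ.* (a ℕ.* a) ℕ.+ sq v) ≡⟨ lem₄ (a ℕ.* a) (x ℕ.* x) n (sq v) ⟩
    suc n ℕ.* (a ℕ.* a) ℕ.+ (x ℕ.* x ℕ.+ sq v) ∎

null⇒sq : ∀ {n} S (v : Vec ℕ n) → Null (+ S ∷ ι v) → sq v ≡ S ℕ.* S
null⇒sq S v e = ℤₚ.+-injective (trans (sym (ι∙ι v)) (trans (ℤₚ.i-j≡0⇒i≡j _ _ e) (sym (ℤₚ.pos-* S S))))

-- The reflection in (ρ; 1^k, 0, …), which has norm k − ρ² = 2, lowers the time coordinate.
descend : ∀ {k l} ρ .{{_ : ℕ.NonZero ρ}} → k ≡ ρ ℕ.* ρ ℕ.+ 2 → ∀ S (u : Vec ℕ k) (w : Vec ℕ l) → Null (+ S ∷ ι (u Vec.++ w)) →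
  ρ ℕ.* S ℕ.< sum u → 0 ℕ.< S → ∃ λ (g : Isom (k ℕ.+ l)) → ∃ λ S' → ∃ λ v → fw g (+ S ∷ ι (u Vec.++ w)) ≡ + S' ∷ v × 0 ℕ.< S' × S' ℕ.< S
descend {k} {l} ρ k≡ S u w null lt 0<S = reflect root root-norm , S' , rest , cong (_∷ rest) head≡ , 0<S' , S'<S
  where
  root : V (suc (k ℕ.+ l))
  root = + ρ ∷ (𝟙 {k} Vec.++ 𝟘 {l})
  rest : V (k ℕ.+ l)
  rest = ι (u Vec.++ w) ⊕ (- ⟪ + S ∷ ι (u Vec.++ w) , root ⟫) · (𝟙 {k} Vec.++ 𝟘 {l})
  root-norm : ⟪ root , root ⟫ ≡ + 2
  root-norm = trans (cong (_- + ρ * + ρ) (trans (∙-++ (𝟙 {k}) 𝟙 (𝟘 {l}) 𝟘) (cong₂ _+_ (trans (𝟙∙𝟙 k) (cong +_ k≡)) (∙-𝟘ʳ (𝟘 {l})))))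
    (trans (cong (λ t → t + + 2 + 0ℤ - + ρ * + ρ) (ℤₚ.pos-* ρ ρ)) (lem (+ ρ * + ρ)))
    where
    lem : ∀ a → a + + 2 + 0ℤ - a ≡ + 2
    lem = solve-∀
  ι-++ : ∀ {k} (u : Vec ℕ k) → ι (u Vec.++ w) ≡ ι u Vec.++ ι w
  ι-++ [] = refl
  ι-++ (a ∷ u) = cong (+ a ∷_) (ι-++ u)
  t≡ : ⟪ + S ∷ ι (u Vec.++ w) , root ⟫ ≡ + sum u - + S * + ρ
  t≡ = cong (_- + S * + ρ) (trans (cong (_∙ (𝟙 {k} Vec.++ 𝟘 {l})) (ι-++ u)) (trans (∙-++ (ι u) 𝟙 (ι w) 𝟘)
    (trans (cong₂ _+_ (ι∙𝟙 u) (∙-𝟘ʳ (ι w))) (ℤₚ.+-identityʳ (+ sum u)))))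
  R = ρ ℕ.* sum u
  -- Cauchy-Schwarz on the `k = ρ² + 2` chosen coordinates gives `(sum u)² ≤ k S²`, and
  -- `ρ²(ρ² + 2) = (ρ² + 1)² − 1`. Hence the time coordinate stays positive.
  bound : R ℕ.< (ρ ℕ.* ρ ℕ.+ 1) ℕ.* S
  bound = ℕₚ.≰⇒> λ le → ℕₚ.<-irrefl refl (begin-strict
      ρ ℕ.* ρ ℕ.* (k ℕ.* (S ℕ.* S))                           <⟨ ℕₚ.m<m+n _ {S ℕ.* S} (ℕₚ.*-mono-< 0<S 0<S) ⟩
      ρ ℕ.* ρ ℕ.* (k ℕ.* (S ℕ.* S)) ℕ.+ S ℕ.* S              ≡⟨ trans (cong (λ k → ρ ℕ.* ρ ℕ.* (k ℕ.* (S ℕ.* S)) ℕ.+ S ℕ.* S) k≡) (lem ρ S) ⟩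
      ((ρ ℕ.* ρ ℕ.+ 1) ℕ.* S) ℕ.* ((ρ ℕ.* ρ ℕ.+ 1) ℕ.* S)     ≤⟨ ℕₚ.*-mono-≤ le le ⟩
      R ℕ.* R                                                ≡⟨ lem₂ ρ (sum u) ⟩
      ρ ℕ.* ρ ℕ.* (sum u ℕ.* sum u)                          ≤⟨ ℕₚ.*-monoʳ-≤ (ρ ℕ.* ρ) (ℕₚ.≤-trans (cauchy u) (ℕₚ.*-monoʳ-≤ k sq≤)) ⟩
      ρ ℕ.* ρ ℕ.* (k ℕ.* (S ℕ.* S)) ∎)
    where
    open ℕₚ.≤-Reasoning
    lem : ∀ ρ S → ρ ℕ.* ρ ℕ.* ((ρ ℕ.* ρ ℕ.+ 2) ℕ.* (S ℕ.* S)) ℕ.+ S ℕ.* S ≡ ((ρ ℕ.* ρ ℕ.+ 1) ℕ.* S) ℕ.* ((ρ ℕ.* ρ ℕ.+ 1) ℕ.* S)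
    lem = ℕR.solve-∀
    lem₂ : ∀ ρ s → ρ ℕ.* s ℕ.* (ρ ℕ.* s) ≡ ρ ℕ.* ρ ℕ.* (s ℕ.* s)
    lem₂ = ℕR.solve-∀
    sq≤ : sq u ℕ.≤ S ℕ.* S
    sq≤ = subst (sq u ℕ.≤_) (trans (sym (sq-++ u w)) (null⇒sq S (u Vec.++ w) null)) (ℕₚ.m≤m+n (sq u) (sq w))
  -- The reflected time coordinate is `S − (sum u − ρS)ρ`, smaller than `S` because `ρS < sum u`.
  S' = (ρ ℕ.* ρ ℕ.+ 1) ℕ.* S ℕ.∸ R
  0<S' : 0 ℕ.< S'
  0<S' = ℕₚ.m<n⇒0<n∸m bound
  S'<S : S' ℕ.< S
  S'<S = ℕₚ.m<n+o⇒m∸n<o _ R {{ℕ.>-nonZero 0<S}} (begin-strict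
      (ρ ℕ.* ρ ℕ.+ 1) ℕ.* S     ≡⟨ lem ρ S ⟩
      ρ ℕ.* (ρ ℕ.* S) ℕ.+ S     <⟨ ℕₚ.+-monoˡ-< S (ℕₚ.*-monoʳ-< ρ lt) ⟩
      ρ ℕ.* sum u ℕ.+ S ∎)
    where
    open ℕₚ.≤-Reasoning
    lem : ∀ ρ S → (ρ ℕ.* ρ ℕ.+ 1) ℕ.* S ≡ ρ ℕ.* (ρ ℕ.* S) ℕ.+ S
    lem = ℕR.solve-∀
  head≡ : + S + (- ⟪ + S ∷ ι (u Vec.++ w) , root ⟫) * + ρ ≡ + S'
  head≡ = begin
    + S + (- ⟪ + S ∷ ι (u Vec.++ w) , root ⟫) * + ρ ≡⟨ cong (λ t → + S + (- t) * + ρ) t≡ ⟩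
    + S + (- (+ sum u - + S * + ρ)) * + ρ           ≡⟨ lem (+ S) (+ sum u) (+ ρ) ⟩
    (+ ρ * + ρ + 1ℤ) * + S - + ρ * + sum u          ≡⟨ cong₂ _-_ (trans (cong (λ t → (t + 1ℤ) * + S) (sym (ℤₚ.pos-* ρ ρ))) (sym (ℤₚ.pos-* (ρ ℕ.* ρ ℕ.+ 1) S))) (sym (ℤₚ.pos-* ρ (sum u))) ⟩
    + ((ρ ℕ.* ρ ℕ.+ 1) ℕ.* S) - + R                 ≡⟨ trans (ℤₚ.m-n≡m⊖n _ R) (ℤₚ.⊖-≥ (ℕₚ.<⇒≤ bound)) ⟩
    + S' ∎
    where
    open ≡-Reasoning
    lem : ∀ S s ρ → S + (- (s - S * ρ)) * ρ ≡ (ρ * ρ + 1ℤ) * S - ρ * s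
    lem = solve-∀

-- Reduction of primitive null vectors

Above : ∀ {n} → ℕ → Vec ℕ n → Set
Above y []      = ⊤
Above y (a ∷ v) = y ℕ.≤ a × Above y v

Two : ∀ {n} → ℕ → ℕ → Vec ℕ n → Set
Two c y []      = ⊤
Two c y (a ∷ v) = (a ≡ c ⊎ a ≡ y) × Two c y v

-- K = Σ (c − x)(x − y)
chord : ∀ {n} c y (v : Vec ℕ n) → Below c v → Above y v →
  ∃ λ K → (sq v ℕ.+ n ℕ.* (c ℕ.* y) ℕ.+ K ≡ (c ℕ.+ y) ℕ.* sum v) × (K ≡ 0 → Two c y v)
chord c y [] _ _ = 0 , sym (ℕₚ.*-zeroʳ (c ℕ.+ y)) , λ _ → tt
chord {suc n} c y (x ∷ v) (x≤c , bv) (y≤x , av) with ℕₚ.m≤n⇒∃[o]m+o≡n y≤x | ℕₚ.m≤n⇒∃[o]m+o≡n x≤c | chord c y v bv av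
... | d , refl | e , refl | K , eq , two = e ℕ.* d ℕ.+ K , eq' , two'
  where
  lem : ∀ y d e n q K T → q ℕ.+ n ℕ.* ((y ℕ.+ d ℕ.+ e) ℕ.* y) ℕ.+ K ≡ T →
        (y ℕ.+ d) ℕ.* (y ℕ.+ d) ℕ.+ q ℕ.+ suc n ℕ.* ((y ℕ.+ d ℕ.+ e) ℕ.* y) ℕ.+ (e ℕ.* d ℕ.+ K) ≡ (y ℕ.+ d ℕ.+ e ℕ.+ y) ℕ.* (y ℕ.+ d) ℕ.+ T
  lem y d e n q K T refl = lem' y d e n q K
    where
    lem' : ∀ y d e n q K →
        (y ℕ.+ d) ℕ.* (y ℕ.+ d) ℕ.+ q ℕ.+ suc n ℕ.* ((y ℕ.+ d ℕ.+ e) ℕ.* y) ℕ.+ (e ℕ.* d ℕ.+ K) ≡ (y ℕ.+ d ℕ.+ e ℕ.+ y) ℕ.* (y ℕ.+ d) ℕ.+ (q ℕ.+ n ℕ.* ((y ℕ.+ d ℕ.+ e) ℕ.* y) ℕ.+ K)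
    lem' = ℕR.solve-∀
  eq' = trans (lem y d e n (sq v) K _ eq) (sym (ℕₚ.*-distribˡ-+ (y ℕ.+ d ℕ.+ e ℕ.+ y) (y ℕ.+ d) (sum v)))
  two' : e ℕ.* d ℕ.+ K ≡ 0 → Two (y ℕ.+ d ℕ.+ e) y (y ℕ.+ d ∷ v)
  two' z with ℕₚ.m*n≡0⇒m≡0∨n≡0 e (ℕₚ.m+n≡0⇒m≡0 (e ℕ.* d) z)
  ... | inj₁ refl = inj₁ (sym (ℕₚ.+-identityʳ (y ℕ.+ d))) , two (ℕₚ.m+n≡0⇒n≡0 (e ℕ.* d) z)
  ... | inj₂ refl = inj₂ (ℕₚ.+-identityʳ y) , two (ℕₚ.m+n≡0⇒n≡0 (e ℕ.* d) z)

-- What remains of `stuck-identity` once its three equations have been used to eliminate `Q`, `K`,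
-- `T` and `ν`.
stuck-poly : ∀ y C p q μ →
    2 ℕ.* (C ℕ.* (p ℕ.+ q)) ℕ.+ 2 ℕ.* (p ℕ.* q) ℕ.+ 2 ℕ.* (C ℕ.* y) ℕ.+ y ℕ.* y ℕ.+ μ ℕ.* (3 ℕ.* C ℕ.+ 2 ℕ.* p ℕ.+ 2 ℕ.* q) ℕ.+ μ ℕ.* μ
    ℕ.+ ((y ℕ.+ C ℕ.+ p) ℕ.* (y ℕ.+ C ℕ.+ p) ℕ.+ (y ℕ.+ C ℕ.+ q) ℕ.* (y ℕ.+ C ℕ.+ q) ℕ.+ (y ℕ.+ C) ℕ.* (y ℕ.+ C)) ℕ.+ y ℕ.* y ℕ.+ (y ℕ.+ C ℕ.+ y) ℕ.* (2 ℕ.* (y ℕ.+ C ℕ.+ p ℕ.+ (y ℕ.+ C ℕ.+ q) ℕ.+ (y ℕ.+ C)) ℕ.+ 3 ℕ.* μ) ≡ (y ℕ.+ C ℕ.+ p ℕ.+ (y ℕ.+ C ℕ.+ q) ℕ.+ (y ℕ.+ C) ℕ.+ μ) ℕ.* (y ℕ.+ C ℕ.+ p ℕ.+ (y ℕ.+ C ℕ.+ q) ℕ.+ (y ℕ.+ C) ℕ.+ μ) ℕ.+ 8 ℕ.* ((y ℕ.+ C) ℕ.* y)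
stuck-poly = ℕR.solve-∀

-- For a sorted null vector which neither reflection shortens, with C = c − y, p = x₁ − c, q = x₂ − c and
-- slacks μ, ν of the two inequalities, a sum of nonnegative terms vanishes.
stuck-identity : ∀ y C p q μ ν T Q K → let c = y ℕ.+ C ; x₁ = c ℕ.+ p ; x₂ = c ℕ.+ q ; Σ₃ = x₁ ℕ.+ x₂ ℕ.+ c ; S = Σ₃ ℕ.+ μ in
  Q ℕ.+ 8 ℕ.* (c ℕ.* y) ℕ.+ K ≡ (c ℕ.+ y) ℕ.* T → Σ₃ ℕ.+ T ℕ.+ ν ≡ 3 ℕ.* S →
  x₁ ℕ.* x₁ ℕ.+ x₂ ℕ.* x₂ ℕ.+ c ℕ.* c ℕ.+ Q ℕ.+ y ℕ.* y ≡ S ℕ.* S →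
  2 ℕ.* (C ℕ.* (p ℕ.+ q)) ℕ.+ 2 ℕ.* (p ℕ.* q) ℕ.+ 2 ℕ.* (C ℕ.* y) ℕ.+ y ℕ.* y ℕ.+ μ ℕ.* (3 ℕ.* C ℕ.+ 2 ℕ.* p ℕ.+ 2 ℕ.* q) ℕ.+ μ ℕ.* μ ℕ.+ (c ℕ.+ y) ℕ.* ν ℕ.+ K ≡ 0
stuck-identity y C p q μ ν T Q K e₁ e₂ e₃ = ℕₚ.+-cancelʳ-≡ (S ℕ.* S ℕ.+ 8 ℕ.* (c ℕ.* y)) _ 0 (begin
    Z ℕ.+ (c ℕ.+ y) ℕ.* ν ℕ.+ K ℕ.+ (S ℕ.* S ℕ.+ 8 ℕ.* (c ℕ.* y))
      ≡⟨ cong (λ t → Z ℕ.+ (c ℕ.+ y) ℕ.* ν ℕ.+ K ℕ.+ (t ℕ.+ 8 ℕ.* (c ℕ.* y))) (sym e₃) ⟩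
    Z ℕ.+ (c ℕ.+ y) ℕ.* ν ℕ.+ K ℕ.+ (n₁ ℕ.+ Q ℕ.+ y ℕ.* y ℕ.+ 8 ℕ.* (c ℕ.* y))
      ≡⟨ arrange Z (c ℕ.+ y) ν K n₁ Q (y ℕ.* y) (8 ℕ.* (c ℕ.* y)) ⟩
    Z ℕ.+ (c ℕ.+ y) ℕ.* ν ℕ.+ n₁ ℕ.+ y ℕ.* y ℕ.+ (Q ℕ.+ 8 ℕ.* (c ℕ.* y) ℕ.+ K)
      ≡⟨ cong (ℕ._+_ (Z ℕ.+ (c ℕ.+ y) ℕ.* ν ℕ.+ n₁ ℕ.+ y ℕ.* y)) e₁ ⟩
    Z ℕ.+ (c ℕ.+ y) ℕ.* ν ℕ.+ n₁ ℕ.+ y ℕ.* y ℕ.+ (c ℕ.+ y) ℕ.* T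
      ≡⟨ arrange₂ Z (c ℕ.+ y) ν n₁ (y ℕ.* y) T ⟩
    Z ℕ.+ n₁ ℕ.+ y ℕ.* y ℕ.+ (c ℕ.+ y) ℕ.* (T ℕ.+ ν)
      ≡⟨ cong (λ t → Z ℕ.+ n₁ ℕ.+ y ℕ.* y ℕ.+ (c ℕ.+ y) ℕ.* t) T+ν ⟩
    Z ℕ.+ n₁ ℕ.+ y ℕ.* y ℕ.+ (c ℕ.+ y) ℕ.* (2 ℕ.* Σ₃ ℕ.+ 3 ℕ.* μ)
      ≡⟨ stuck-poly y C p q μ ⟩
    S ℕ.* S ℕ.+ 8 ℕ.* (c ℕ.* y) ∎)
  where
  open ≡-Reasoning
  c = y ℕ.+ C
  x₁ = c ℕ.+ p
  x₂ = c ℕ.+ q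
  Σ₃ = x₁ ℕ.+ x₂ ℕ.+ c
  S = Σ₃ ℕ.+ μ
  n₁ = x₁ ℕ.* x₁ ℕ.+ x₂ ℕ.* x₂ ℕ.+ c ℕ.* c
  Z = 2 ℕ.* (C ℕ.* (p ℕ.+ q)) ℕ.+ 2 ℕ.* (p ℕ.* q) ℕ.+ 2 ℕ.* (C ℕ.* y) ℕ.+ y ℕ.* y ℕ.+ μ ℕ.* (3 ℕ.* C ℕ.+ 2 ℕ.* p ℕ.+ 2 ℕ.* q) ℕ.+ μ ℕ.* μ
  arrange : ∀ Z s ν K n Q yy e → Z ℕ.+ s ℕ.* ν ℕ.+ K ℕ.+ (n ℕ.+ Q ℕ.+ yy ℕ.+ e) ≡ Z ℕ.+ s ℕ.* ν ℕ.+ n ℕ.+ yy ℕ.+ (Q ℕ.+ e ℕ.+ K)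
  arrange = ℕR.solve-∀
  arrange₂ : ∀ Z s ν n yy T → Z ℕ.+ s ℕ.* ν ℕ.+ n ℕ.+ yy ℕ.+ s ℕ.* T ≡ Z ℕ.+ n ℕ.+ yy ℕ.+ s ℕ.* (T ℕ.+ ν)
  arrange₂ = ℕR.solve-∀
  3S : ∀ Σ₃ μ → 3 ℕ.* (Σ₃ ℕ.+ μ) ≡ Σ₃ ℕ.+ (2 ℕ.* Σ₃ ℕ.+ 3 ℕ.* μ)
  3S = ℕR.solve-∀
  T+ν : T ℕ.+ ν ≡ 2 ℕ.* Σ₃ ℕ.+ 3 ℕ.* μ
  T+ν = ℕₚ.+-cancelˡ-≡ Σ₃ _ _ (trans (sym (ℕₚ.+-assoc Σ₃ T ν)) (trans e₂ (3S Σ₃ μ)))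

zeros⇒replicate : ∀ {n} (v : Vec ℕ n) → Below 0 v → v ≡ Vec.replicate n 0
zeros⇒replicate [] _ = refl
zeros⇒replicate (zero ∷ v) (ℕ.z≤n , h) = cong (0 ∷_) (zeros⇒replicate v h)

sum0⇒Below : ∀ {n} (v : Vec ℕ n) → sum v ≡ 0 → Below 0 v
sum0⇒Below [] _ = tt
sum0⇒Below (a ∷ v) e = ℕₚ.≤-reflexive (ℕₚ.m+n≡0⇒m≡0 a e) , sum0⇒Below v (ℕₚ.m+n≡0⇒n≡0 a e)

Below0⇒sum0 : ∀ {n} (v : Vec ℕ n) → Below 0 v → sum v ≡ 0
Below0⇒sum0 [] _ = refl
Below0⇒sum0 (zero ∷ v) (_ , h) = Below0⇒sum0 v h

block : ∀ t j (v : Vec ℕ (t ℕ.+ j)) c → 0 ℕ.< c → Sorted v → Two c 0 v → sum v ≡ t ℕ.* c →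
        v ≡ Vec.replicate t c Vec.++ Vec.replicate j 0
block zero j v c _ _ _ e = zeros⇒replicate v (sum0⇒Below v e)
block (suc t) j (a ∷ v) c 0<c (_ , sv) (inj₁ refl , tv) e = cong (a ∷_) (block t j v a 0<c sv tv (ℕₚ.+-cancelˡ-≡ a _ _ e))
block (suc t) j (a ∷ v) c 0<c (bv , sv) (inj₂ refl , tv) e =
  contradiction (ℕₚ.m+n≡0⇒m≡0 c (trans (sym e) (Below0⇒sum0 v bv))) (ℕₚ.>⇒≢ 0<c)

-- The multiples of `(1; 1, 0, …)` and of `(3; 1⁹, 0, 0, 0)`; primitivity later forces the
-- multiplier to be 1.
Terminal : Vec ℕ 8 → ℕ → ℕ → ℕ → ℕ → ℕ → Set
Terminal mid S x₁ x₂ c y =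
  (x₁ ≡ S × x₂ ≡ 0 × c ≡ 0 × mid ≡ Vec.replicate 8 0 × y ≡ 0) ⊎
  (x₁ ≡ c × x₂ ≡ c × S ≡ 3 ℕ.* c × mid ≡ Vec.replicate 6 c Vec.++ Vec.replicate 2 0 × y ≡ 0)

sum≡0⇒all≡0 : ∀ a b c d e f g h → a ℕ.+ b ℕ.+ c ℕ.+ d ℕ.+ e ℕ.+ f ℕ.+ g ℕ.+ h ≡ 0 →
  a ≡ 0 × b ≡ 0 × d ≡ 0 × f ≡ 0 × g ≡ 0 × h ≡ 0
sum≡0⇒all≡0 zero zero zero zero zero zero zero zero _ = refl , refl , refl , refl , refl , refl

a*a≡0⇒a≡0 : ∀ a → a ℕ.* a ≡ 0 → a ≡ 0
a*a≡0⇒a≡0 a e = [ id , id ] (ℕₚ.m*n≡0⇒m≡0∨n≡0 a e)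

-- The substitutions are hypotheses with a variable on the right, so that matching on `refl`
-- rewrites everything into the variables of `stuck-identity`.
stuck-zeros : ∀ y C p q μ ν T Q K c x₁ x₂ S → y ℕ.+ C ≡ c → c ℕ.+ p ≡ x₁ → c ℕ.+ q ≡ x₂ → x₁ ℕ.+ x₂ ℕ.+ c ℕ.+ μ ≡ S →
  Q ℕ.+ 8 ℕ.* (c ℕ.* y) ℕ.+ K ≡ (c ℕ.+ y) ℕ.* T → x₁ ℕ.+ x₂ ℕ.+ c ℕ.+ T ℕ.+ ν ≡ 3 ℕ.* S →
  x₁ ℕ.* x₁ ℕ.+ x₂ ℕ.* x₂ ℕ.+ c ℕ.* c ℕ.+ Q ℕ.+ y ℕ.* y ≡ S ℕ.* S →
  C ℕ.* (p ℕ.+ q) ≡ 0 × p ℕ.* q ≡ 0 × y ≡ 0 × μ ≡ 0 × (c ℕ.+ y) ℕ.* ν ≡ 0 × K ≡ 0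
stuck-zeros y C p q μ ν T Q K c x₁ x₂ S refl refl refl refl e₁ e₂ e₃
  with sum≡0⇒all≡0 _ _ _ _ _ _ _ _ (stuck-identity y C p q μ ν T Q K e₁ e₂ e₃)
... | z₁ , z₂ , z₃ , z₄ , z₅ , z₆ = ℕₚ.m+n≡0⇒m≡0 _ z₁ , ℕₚ.m+n≡0⇒m≡0 _ z₂ , a*a≡0⇒a≡0 y z₃ , a*a≡0⇒a≡0 μ z₄ , z₅ , z₆

-- If `C = 0`, then `c = y = 0`, and `pq = 0` leaves one nonzero entry. If `C > 0`, then
-- `p = q = 0`, so the three largest entries equal `c`, `S = 3c`, and `ν = 0` makes the middle
-- entries, each `c` or 0, sum to `6c`.
stuck-finish : ∀ S x₁ x₂ c y (mid : Vec ℕ 8) C p q μ ν → Sorted mid → Below c mid → q ℕ.≤ p →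
  y ℕ.+ C ≡ c → c ℕ.+ p ≡ x₁ → c ℕ.+ q ≡ x₂ → x₁ ℕ.+ x₂ ℕ.+ c ℕ.+ μ ≡ S → x₁ ℕ.+ x₂ ℕ.+ c ℕ.+ sum mid ℕ.+ ν ≡ 3 ℕ.* S →
  C ℕ.* (p ℕ.+ q) ≡ 0 → p ℕ.* q ≡ 0 → y ≡ 0 → μ ≡ 0 → (c ℕ.+ y) ℕ.* ν ≡ 0 → Two c y mid → Terminal mid S x₁ x₂ c y
stuck-finish S x₁ x₂ c y mid zero p q μ ν sm bm q≤p refl refl refl e₃ e₄ _ pq≡0 refl refl _ two with ℕₚ.m*n≡0⇒m≡0∨n≡0 p pq≡0
... | inj₁ refl with q | q≤p
...   | zero | _ = inj₁ (e₃ , refl , refl , zeros⇒replicate mid bm , refl)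
stuck-finish S x₁ x₂ c y mid zero p q μ ν sm bm q≤p refl refl refl e₃ e₄ _ pq≡0 refl refl _ two | inj₂ refl =
  inj₁ (trans (lem p) e₃ , refl , refl , zeros⇒replicate mid bm , refl)
  where
  lem : ∀ p → p ≡ p ℕ.+ 0 ℕ.+ 0 ℕ.+ 0
  lem = ℕR.solve-∀
stuck-finish S x₁ x₂ c y mid (suc C') p q μ ν sm bm q≤p e₀ e₁ e₂ e₃ e₄ Cpq pq≡0 y≡0 μ≡0 sν two =
  inj₂ (x₁≡ , x₂≡ , S≡ , block 6 2 mid c 0<c sm (subst (λ t → Two c t mid) y≡0 two) sum≡ , y≡0)
  where
  p+q≡0 : p ℕ.+ q ≡ 0
  p+q≡0 = ℕₚ.m+n≡0⇒m≡0 (p ℕ.+ q) Cpq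
  x₁≡ : x₁ ≡ c
  x₁≡ = trans (sym e₁) (trans (cong (ℕ._+_ c) (ℕₚ.m+n≡0⇒m≡0 p p+q≡0)) (ℕₚ.+-identityʳ c))
  x₂≡ : x₂ ≡ c
  x₂≡ = trans (sym e₂) (trans (cong (ℕ._+_ c) (ℕₚ.m+n≡0⇒n≡0 p p+q≡0)) (ℕₚ.+-identityʳ c))
  0<c : 0 ℕ.< c
  0<c = subst (0 ℕ.<_) (trans (cong (ℕ._+ suc C') (sym y≡0)) e₀) (ℕ.s≤s ℕ.z≤n)
  ν≡0 : ν ≡ 0
  ν≡0 with ℕₚ.m*n≡0⇒m≡0∨n≡0 (c ℕ.+ y) sν
  ... | inj₁ e = contradiction (ℕₚ.m+n≡0⇒m≡0 c e) (ℕₚ.>⇒≢ 0<c)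
  ... | inj₂ e = e
  3c : ∀ c → c ℕ.+ c ℕ.+ c ℕ.+ 0 ≡ 3 ℕ.* c
  3c = ℕR.solve-∀
  S≡ : S ≡ 3 ℕ.* c
  S≡ = trans (sym e₃) (trans (cong₂ ℕ._+_ (cong₂ (λ u v → u ℕ.+ v ℕ.+ c) x₁≡ x₂≡) μ≡0) (3c c))
  lem : ∀ T c → c ℕ.+ c ℕ.+ c ℕ.+ T ℕ.+ 0 ≡ 3 ℕ.* (3 ℕ.* c) → T ≡ 6 ℕ.* c
  lem T c e = ℕₚ.+-cancelˡ-≡ (c ℕ.+ c ℕ.+ c) _ _ (trans (sym (ℕₚ.+-identityʳ _)) (trans e (9c c)))
    where
    9c : ∀ c → 3 ℕ.* (3 ℕ.* c) ≡ c ℕ.+ c ℕ.+ c ℕ.+ 6 ℕ.* c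
    9c = ℕR.solve-∀
  sum≡ : sum mid ≡ 6 ℕ.* c
  sum≡ = lem (sum mid) c (trans (sym (cong₂ (λ u v → u ℕ.+ sum mid ℕ.+ v) (cong₂ (λ a b → a ℕ.+ b ℕ.+ c) x₁≡ x₂≡) ν≡0)) (trans e₄ (cong (3 ℕ.*_) S≡)))

-- The middle entries lie between `y` and `c`, so convexity bounds each square by its chord; the two
-- inequalities bound the sums. Since the squares add up to exactly `S²`, equality holds everywhere,
-- and only two shapes attain it.
stuck : ∀ S x₁ x₂ c (mid : Vec ℕ 8) y → x₂ ℕ.≤ x₁ → c ℕ.≤ x₂ → Below c mid → Sorted mid → Above y mid → y ℕ.≤ c →
  x₁ ℕ.+ x₂ ℕ.+ c ℕ.≤ S → x₁ ℕ.+ x₂ ℕ.+ c ℕ.+ sum mid ℕ.≤ 3 ℕ.* S →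
  x₁ ℕ.* x₁ ℕ.+ x₂ ℕ.* x₂ ℕ.+ c ℕ.* c ℕ.+ sq mid ℕ.+ y ℕ.* y ≡ S ℕ.* S → Terminal mid S x₁ x₂ c y
stuck S x₁ x₂ c mid y x₂≤x₁ c≤x₂ bm sm am y≤c le₁ le₂ eq =
  let (C , e₀) = ℕₚ.m≤n⇒∃[o]m+o≡n y≤c
      (q , e₂) = ℕₚ.m≤n⇒∃[o]m+o≡n c≤x₂
      (p , e₁) = ℕₚ.m≤n⇒∃[o]m+o≡n (ℕₚ.≤-trans c≤x₂ x₂≤x₁)
      (μ , e₃) = ℕₚ.m≤n⇒∃[o]m+o≡n le₁
      (ν , e₄) = ℕₚ.m≤n⇒∃[o]m+o≡n le₂
      (K , e₅ , two) = chord c y mid bm am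
      (z₁ , z₂ , z₃ , z₄ , z₅ , z₆) = stuck-zeros y C p q μ ν (sum mid) (sq mid) K c x₁ x₂ S e₀ e₁ e₂ e₃ e₅ e₄ eq
  in stuck-finish S x₁ x₂ c y mid C p q μ ν sm bm (ℕₚ.+-cancelˡ-≤ c q p (subst₂ ℕ._≤_ (sym e₂) (sym e₁) x₂≤x₁))
       e₀ e₁ e₂ e₃ e₄ z₁ z₂ z₃ z₄ z₅ (two z₆)

T₁ : ∀ n → V (suc (suc n))
T₁ n = 1ℤ ∷ 1ℤ ∷ 𝟘 {n}

T₂ : ∀ n → V (suc (9 ℕ.+ n))
T₂ n = + 3 ∷ (𝟙 {9} Vec.++ 𝟘 {n})

∣1⇒≡1 : ∀ c t → + c * t ≡ 1ℤ → c ≡ 1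
∣1⇒≡1 c t e = ℕₚ.m*n≡1⇒m≡1 c ∣ t ∣ (trans (sym (ℤₚ.abs-* (+ c) t)) (cong ∣_∣ e))

⟪·⟫ : ∀ {n} t (Z W : V (suc n)) → ⟪ t · Z , W ⟫ ≡ t * ⟪ Z , W ⟫
⟪·⟫ t (c ∷ z) (d ∷ w) = trans (cong (_- (t * c) * d) (∙-·ˡ t w z)) (lem t c d (z ∙ w))
  where
  lem : ∀ t c d q → t * q - (t * c) * d ≡ t * (q - c * d)
  lem = solve-∀

unimodular-scale : ∀ {n} c (T : V (suc n)) → Unimodular ((+ c) · T) → c ≡ 1
unimodular-scale c T (Y , e) = ∣1⇒≡1 c ⟪ T , Y ⟫ (trans (sym (⟪·⟫ (+ c) T Y)) e)

1· : ∀ {n} (x : V n) → 1ℤ · x ≡ x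
1· [] = refl
1· (a ∷ x) = cong₂ _∷_ (ℤₚ.*-identityˡ a) (1· x)

ι-0 : ∀ n → ι (Vec.replicate n 0) ≡ 𝟘 {n}
ι-0 zero = refl
ι-0 (suc n) = cong (0ℤ ∷_) (ι-0 n)

scale-T₁ : ∀ n S → + S ∷ + S ∷ ι (Vec.replicate n 0) ≡ (+ S) · T₁ n
scale-T₁ n S = cong₂ _∷_ (sym (ℤₚ.*-identityʳ (+ S))) (cong₂ _∷_ (sym (ℤₚ.*-identityʳ (+ S))) (trans (ι-0 n) (sym (·-𝟘 (+ S)))))

scale-T₂ : ∀ n c → + (3 ℕ.* c) ∷ ι (Vec.replicate 9 c Vec.++ Vec.replicate n 0) ≡ (+ c) · T₂ n
scale-T₂ n c = cong₂ _∷_ (trans (ℤₚ.pos-* 3 c) (ℤₚ.*-comm (+ 3) (+ c))) (go 9)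
  where
  go : ∀ k → ι (Vec.replicate k c Vec.++ Vec.replicate n 0) ≡ (+ c) · (𝟙 {k} Vec.++ 𝟘 {n})
  go zero = trans (ι-0 n) (sym (·-𝟘 (+ c)))
  go (suc k) = cong₂ _∷_ (sym (ℤₚ.*-identityʳ (+ c))) (go k)

Above-last : ∀ {n} (v : Vec ℕ n) y → Sorted (v Vec.++ (y ∷ [])) → Sorted v × Above y v
Above-last [] y _ = tt , tt
Above-last (a ∷ v) y (bv , sv) = let (s , h) = Above-last v y sv ; (b , le) = split v bv in (b , s) , (le , h)
  where
  split : ∀ {n} (v : Vec ℕ n) → Below a (v Vec.++ (y ∷ [])) → Below a v × y ℕ.≤ a
  split [] (le , _) = tt , le
  split (x ∷ v) (p , h) = let (b , le) = split v h in (p , b) , le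

Reduces : ∀ {n} → V (suc n) → V (suc n) → Set
Reduces {n} X T = ∃ λ (g : Isom n) → fw g X ≡ T

unimodular-terminal : ∀ {n} c (T X : V (suc n)) → X ≡ (+ c) · T → Unimodular X → X ≡ T
unimodular-terminal c T X e u = trans e (trans (cong (λ c → (+ c) · T) (unimodular-scale c T (subst Unimodular e u))) (1· T))

reduce-via : ∀ {n} (g : Isom n) {X Y T} → fw g X ≡ Y → Reduces Y T → Reduces X T
reduce-via g refl (h , e) = g ⊚ h , e

-- Descent on the time coordinate: after sorting the absolute values, the roots are tested on the
-- three and on the eleven largest entries, where the inner product is greatest. If neither shortens
-- the vector, `stuck` applies with `y` the twelfth entry.
reduce₁₂ : ∀ fuel S (v : V 12) → S ℕ.≤ fuel → 0 ℕ.< S → Null (+ S ∷ v) → Unimodular (+ S ∷ v) →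
           Reduces (+ S ∷ v) (T₁ 11) ⊎ Reduces (+ S ∷ v) (T₂ 3)
reduce₁₂ zero S v S≤ 0<S _ _ = contradiction (ℕₚ.<-≤-trans 0<S S≤) λ ()
reduce₁₂ (suc fuel) S v S≤ 0<S null uni with sortAbs v
... | p , u@(x₁ ∷ x₂ ∷ x₃ ∷ x₄ ∷ x₅ ∷ x₆ ∷ x₇ ∷ x₈ ∷ x₉ ∷ x₁₀ ∷ x₁₁ ∷ x₁₂ ∷ []) , e , su@((x₂≤x₁ , _) , (x₃≤x₂ , _) , bel , s₄) =
  step (1 ℕ.* S ℕ.<? sum (x₁ ∷ x₂ ∷ x₃ ∷ [])) (3 ℕ.* S ℕ.<? sum u₁₁)
  where
  u₁₁ = x₁ ∷ x₂ ∷ x₃ ∷ x₄ ∷ x₅ ∷ x₆ ∷ x₇ ∷ x₈ ∷ x₉ ∷ x₁₀ ∷ x₁₁ ∷ []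
  mid : Vec ℕ 8
  mid = x₄ ∷ x₅ ∷ x₆ ∷ x₇ ∷ x₈ ∷ x₉ ∷ x₁₀ ∷ x₁₁ ∷ []
  e' : fw (permI p) (+ S ∷ v) ≡ + S ∷ ι u
  e' = cong (+ S ∷_) e
  null' : Null (+ S ∷ ι u)
  null' = subst Null e' (null-fw (permI p) {+ S ∷ v} null)
  uni' : Unimodular (+ S ∷ ι u)
  uni' = subst Unimodular e' (unimodular-fw (permI p) {+ S ∷ v} uni)
  recurse : (∃ λ (g : Isom 12) → ∃ λ S' → ∃ λ v' → fw g (+ S ∷ ι u) ≡ + S' ∷ v' × 0 ℕ.< S' × S' ℕ.< S) →
            Reduces (+ S ∷ v) (T₁ 11) ⊎ Reduces (+ S ∷ v) (T₂ 3)
  recurse (g , S' , v' , eq , 0<S' , S'<S)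
    with reduce₁₂ fuel S' v' (ℕₚ.≤-pred (ℕₚ.<-≤-trans S'<S S≤)) 0<S'
           (subst Null eq (null-fw g {+ S ∷ ι u} null')) (subst Unimodular eq (unimodular-fw g {+ S ∷ ι u} uni'))
  ... | inj₁ h = inj₁ (reduce-via (permI p) e' (reduce-via g eq h))
  ... | inj₂ h = inj₂ (reduce-via (permI p) e' (reduce-via g eq h))
  done : ∀ S c x₁ x₂ x₁₂ mid → Terminal mid S x₁ x₂ c x₁₂ → Unimodular (+ S ∷ ι (x₁ ∷ x₂ ∷ c ∷ (mid Vec.++ (x₁₂ ∷ [])))) →
         (+ S ∷ ι (x₁ ∷ x₂ ∷ c ∷ (mid Vec.++ (x₁₂ ∷ [])))) ≡ T₁ 11 ⊎ (+ S ∷ ι (x₁ ∷ x₂ ∷ c ∷ (mid Vec.++ (x₁₂ ∷ [])))) ≡ T₂ 3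
  done S c x₁ x₂ x₁₂ mid (inj₁ (refl , refl , refl , refl , refl)) un = inj₁ (unimodular-terminal S (T₁ 11) _ (scale-T₁ 11 S) un)
  done S c x₁ x₂ x₁₂ mid (inj₂ (refl , refl , refl , refl , refl)) un = inj₂ (unimodular-terminal c (T₂ 3) _ (scale-T₂ 3 c) un)
  step : Dec (1 ℕ.* S ℕ.< sum (x₁ ∷ x₂ ∷ x₃ ∷ [])) → Dec (3 ℕ.* S ℕ.< sum u₁₁) → _
  step (yes lt) _ = recurse (descend 1 refl S (x₁ ∷ x₂ ∷ x₃ ∷ []) (x₄ ∷ x₅ ∷ x₆ ∷ x₇ ∷ x₈ ∷ x₉ ∷ x₁₀ ∷ x₁₁ ∷ x₁₂ ∷ []) null' lt 0<S)
  step (no _) (yes lt) = recurse (descend 3 refl S u₁₁ (x₁₂ ∷ []) null' lt 0<S)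
  step (no ge₁) (no ge₂) = [ (λ h → inj₁ (permI p , trans e' h)) , (λ h → inj₂ (permI p , trans e' h)) ] (done S x₃ x₁ x₂ x₁₂ mid term uni')
    where
    sm = Above-last mid x₁₂ s₄
    bm : Below x₃ mid × x₁₂ ℕ.≤ x₃
    bm = let (b₄ , b₅ , b₆ , b₇ , b₈ , b₉ , b₁₀ , b₁₁ , b₁₂ , _) = bel in (b₄ , b₅ , b₆ , b₇ , b₈ , b₉ , b₁₀ , b₁₁ , tt) , b₁₂
    a3 : ∀ a b c → a ℕ.+ (b ℕ.+ (c ℕ.+ 0)) ≡ a ℕ.+ b ℕ.+ c
    a3 = ℕR.solve-∀
    a4 : ∀ a b c d → a ℕ.+ (b ℕ.+ (c ℕ.+ d)) ≡ a ℕ.+ b ℕ.+ c ℕ.+ d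
    a4 = ℕR.solve-∀
    a5 : ∀ a b c d e → a ℕ.+ b ℕ.+ c ℕ.+ d ℕ.+ e ≡ a ℕ.+ (b ℕ.+ (c ℕ.+ (d ℕ.+ (e ℕ.+ 0))))
    a5 = ℕR.solve-∀
    term : Terminal mid S x₁ x₂ x₃ x₁₂
    term = stuck S x₁ x₂ x₃ mid x₁₂ x₂≤x₁ x₃≤x₂ (proj₁ bm) (proj₁ sm) (proj₂ sm) (proj₂ bm)
      (subst₂ ℕ._≤_ (a3 x₁ x₂ x₃) (ℕₚ.*-identityˡ S) (ℕₚ.≮⇒≥ ge₁))
      (subst (ℕ._≤ 3 ℕ.* S) (a4 x₁ x₂ x₃ (sum mid)) (ℕₚ.≮⇒≥ ge₂))
      (trans (a5 (x₁ ℕ.* x₁) (x₂ ℕ.* x₂) (x₃ ℕ.* x₃) (sq mid) (x₁₂ ℕ.* x₁₂))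
        (trans (cong (λ t → x₁ ℕ.* x₁ ℕ.+ (x₂ ℕ.* x₂ ℕ.+ (x₃ ℕ.* x₃ ℕ.+ t))) (sym (sq-++ mid (x₁₂ ∷ [])))) (null⇒sq S u null')))

-- X is not a characteristic vector, i.e. X^⊥/X is an odd lattice.
NonChar : ∀ {n} → V (suc n) → Set
NonChar X = ∃ λ Y → ¬ (+ 2 ∣ₛ ⟪ Y , Y ⟫ + ⟪ X , Y ⟫)

nonChar-fw : ∀ {n} (g : Isom n) {X} → NonChar X → NonChar (fw g X)
nonChar-fw g {X} (Y , h) = fw g Y , λ d → h (subst (+ 2 ∣ₛ_) (cong₂ _+_ (pres g Y Y) (pres g X Y)) d)

even-n[n+1]ℕ : ∀ n → + 2 ∣ₛ + n * + n + + n
even-n[n+1]ℕ zero = divides 0ℤ refl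
even-n[n+1]ℕ (suc n) = let divides q e = even-n[n+1]ℕ n in
  divides (q + 1ℤ + + n) (trans (lem (+ n)) (trans (cong (λ t → t + + 2 * (1ℤ + + n)) e) (lem₂ q (+ n))))
  where
  lem : ∀ n → (1ℤ + n) * (1ℤ + n) + (1ℤ + n) ≡ (n * n + n) + + 2 * (1ℤ + n)
  lem = solve-∀
  lem₂ : ∀ q n → q * + 2 + + 2 * (1ℤ + n) ≡ (q + 1ℤ + n) * + 2
  lem₂ = solve-∀

even-n[n+1] : ∀ a → + 2 ∣ₛ a * a + a
even-n[n+1] (+ n) = even-n[n+1]ℕ n
even-n[n+1] -[1+ n ] = subst (+ 2 ∣ₛ_) (lem (+ n)) (even-n[n+1]ℕ n)
  where
  lem : ∀ n → n * n + n ≡ (- (1ℤ + n)) * (- (1ℤ + n)) + (- (1ℤ + n))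
  lem = solve-∀

-- All coordinates of `(3; 1⁹)` are odd and `y² + y` is always even. The corresponding quotient is
-- the even lattice E₈.
T₂-char : ¬ NonChar (T₂ 0)
T₂-char (b ∷ y , h) = h (subst (+ 2 ∣ₛ_) (lem (y ∙ y) (𝟙 {9} ∙ y) b)
    (subst (λ t → + 2 ∣ₛ y ∙ y + t - b * b - + 3 * b) (∙-comm y (𝟙 {9}))
      (subst (+ 2 ∣ₛ_) (lem₂ (y ∙ y) (y ∙ 𝟙 {9}) b)
        (∣m∣n⇒∣m-n (∣m∣n⇒∣m-n (even-vec y) (even-n[n+1] b)) (divides b (ℤₚ.*-comm (+ 2) b))))))
  where
  even-vec : ∀ {n} (y : V n) → + 2 ∣ₛ y ∙ y + y ∙ 𝟙
  even-vec [] = divides 0ℤ refl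
  even-vec (a ∷ y) = subst (+ 2 ∣ₛ_) (lem' a (y ∙ y) (y ∙ 𝟙)) (∣m∣n⇒∣m+n (even-n[n+1] a) (even-vec y))
    where
    lem' : ∀ a p q → (a * a + a) + (p + q) ≡ (a * a + p) + (a * 1ℤ + q)
    lem' = solve-∀
  lem : ∀ p q b → p + q - b * b - + 3 * b ≡ (p - b * b) + (q - + 3 * b)
  lem = solve-∀
  lem₂ : ∀ p q b → (p + q) - (b * b + b) - + 2 * b ≡ p + q - b * b - + 3 * b
  lem₂ = solve-∀

-- In ℤ^{9,1} the first root suffices: if it does not shorten, the six remaining entries, at most
-- `x₃` each, sum to at most `2(x₁ + x₂ + x₃) ≤ 2S`, which is the second inequality of `stuck`. The
-- vector is padded with zeros to reuse that lemma.
reduce₉ : ∀ fuel S (v : V 9) → S ℕ.≤ fuel → 0 ℕ.< S → Null (+ S ∷ v) → Unimodular (+ S ∷ v) → NonChar (+ S ∷ v) →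
          Reduces (+ S ∷ v) (T₁ 8)
reduce₉ zero S v S≤ 0<S _ _ _ = contradiction (ℕₚ.<-≤-trans 0<S S≤) λ ()
reduce₉ (suc fuel) S v S≤ 0<S null uni nch with sortAbs v
... | p , u@(x₁ ∷ x₂ ∷ x₃ ∷ x₄ ∷ x₅ ∷ x₆ ∷ x₇ ∷ x₈ ∷ x₉ ∷ []) , e , su@((x₂≤x₁ , _) , (x₃≤x₂ , _) , bel , s₄) =
  step (1 ℕ.* S ℕ.<? sum (x₁ ∷ x₂ ∷ x₃ ∷ []))
  where
  mid₆ : Vec ℕ 6
  mid₆ = x₄ ∷ x₅ ∷ x₆ ∷ x₇ ∷ x₈ ∷ x₉ ∷ []
  mid : Vec ℕ 8
  mid = mid₆ Vec.++ (0 ∷ 0 ∷ [])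
  e' : fw (permI p) (+ S ∷ v) ≡ + S ∷ ι u
  e' = cong (+ S ∷_) e
  null' : Null (+ S ∷ ι u)
  null' = subst Null e' (null-fw (permI p) {+ S ∷ v} null)
  uni' : Unimodular (+ S ∷ ι u)
  uni' = subst Unimodular e' (unimodular-fw (permI p) {+ S ∷ v} uni)
  nch' : NonChar (+ S ∷ ι u)
  nch' = subst NonChar e' (nonChar-fw (permI p) {+ S ∷ v} nch)
  recurse : (∃ λ (g : Isom 9) → ∃ λ S' → ∃ λ v' → fw g (+ S ∷ ι u) ≡ + S' ∷ v' × 0 ℕ.< S' × S' ℕ.< S) → Reduces (+ S ∷ v) (T₁ 8)
  recurse (g , S' , v' , eq , 0<S' , S'<S) = reduce-via (permI p) e' (reduce-via g eq
    (reduce₉ fuel S' v' (ℕₚ.≤-pred (ℕₚ.<-≤-trans S'<S S≤)) 0<S'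
      (subst Null eq (null-fw g {+ S ∷ ι u} null')) (subst Unimodular eq (unimodular-fw g {+ S ∷ ι u} uni'))
      (subst NonChar eq (nonChar-fw g {+ S ∷ ι u} nch'))))
  done : ∀ S c x₁ x₂ (m : Vec ℕ 6) → Terminal (m Vec.++ (0 ∷ 0 ∷ [])) S x₁ x₂ c 0 → Unimodular (+ S ∷ ι (x₁ ∷ x₂ ∷ c ∷ m)) →
         NonChar (+ S ∷ ι (x₁ ∷ x₂ ∷ c ∷ m)) → (+ S ∷ ι (x₁ ∷ x₂ ∷ c ∷ m)) ≡ T₁ 8
  done S c x₁ x₂ (_ ∷ _ ∷ _ ∷ _ ∷ _ ∷ _ ∷ []) (inj₁ (refl , refl , refl , refl , refl)) un nc = unimodular-terminal S (T₁ 8) _ (scale-T₁ 8 S) un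
  done S c x₁ x₂ (_ ∷ _ ∷ _ ∷ _ ∷ _ ∷ _ ∷ []) (inj₂ (refl , refl , refl , refl , refl)) un nc =
    contradiction (subst NonChar (unimodular-terminal c (T₂ 0) _ (scale-T₂ 0 c) un) nc) T₂-char
  step : Dec (1 ℕ.* S ℕ.< sum (x₁ ∷ x₂ ∷ x₃ ∷ [])) → Reduces (+ S ∷ v) (T₁ 8)
  step (yes lt) = recurse (descend 1 refl S (x₁ ∷ x₂ ∷ x₃ ∷ []) mid₆ null' lt 0<S)
  step (no ge) = permI p , trans e' (done S x₃ x₁ x₂ mid₆ term uni' nch')
    where
    a3 : ∀ a b c → a ℕ.+ (b ℕ.+ (c ℕ.+ 0)) ≡ a ℕ.+ b ℕ.+ c
    a3 = ℕR.solve-∀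
    a5 : ∀ a b c d → a ℕ.+ b ℕ.+ c ℕ.+ (d ℕ.+ 0) ℕ.+ 0 ≡ a ℕ.+ (b ℕ.+ (c ℕ.+ d))
    a5 = ℕR.solve-∀
    le₁ : x₁ ℕ.+ x₂ ℕ.+ x₃ ℕ.≤ S
    le₁ = subst₂ ℕ._≤_ (a3 x₁ x₂ x₃) (ℕₚ.*-identityˡ S) (ℕₚ.≮⇒≥ ge)
    bm : Below x₃ mid
    bm = let (b₄ , b₅ , b₆ , b₇ , b₈ , b₉ , _) = bel in b₄ , b₅ , b₆ , b₇ , b₈ , b₉ , ℕ.z≤n , ℕ.z≤n , tt
    sum≤ : ∀ {n c} (v : Vec ℕ n) → Below c v → sum v ℕ.≤ n ℕ.* c
    sum≤ [] _ = ℕ.z≤n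
    sum≤ (a ∷ v) (p , h) = ℕₚ.+-mono-≤ p (sum≤ v h)
    le₂ : x₁ ℕ.+ x₂ ℕ.+ x₃ ℕ.+ sum mid ℕ.≤ 3 ℕ.* S
    le₂ = begin
      x₁ ℕ.+ x₂ ℕ.+ x₃ ℕ.+ sum mid       ≤⟨ ℕₚ.+-monoʳ-≤ (x₁ ℕ.+ x₂ ℕ.+ x₃) (subst (ℕ._≤ 6 ℕ.* x₃) (s6 mid₆) (sum≤ mid₆ bel)) ⟩
      x₁ ℕ.+ x₂ ℕ.+ x₃ ℕ.+ 6 ℕ.* x₃      ≡⟨ r₁ x₁ x₂ x₃ ⟩
      x₁ ℕ.+ x₂ ℕ.+ x₃ ℕ.+ 2 ℕ.* (x₃ ℕ.+ x₃ ℕ.+ x₃) ≤⟨ ℕₚ.+-monoʳ-≤ (x₁ ℕ.+ x₂ ℕ.+ x₃) (ℕₚ.*-monoʳ-≤ 2 (ℕₚ.+-monoˡ-≤ x₃ (ℕₚ.+-mono-≤ (ℕₚ.≤-trans x₃≤x₂ x₂≤x₁) x₃≤x₂))) ⟩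
      x₁ ℕ.+ x₂ ℕ.+ x₃ ℕ.+ 2 ℕ.* (x₁ ℕ.+ x₂ ℕ.+ x₃) ≤⟨ ℕₚ.*-monoʳ-≤ 3 le₁ ⟩
      3 ℕ.* S ∎
      where
      open ℕₚ.≤-Reasoning
      r₁ : ∀ a b c → a ℕ.+ b ℕ.+ c ℕ.+ 6 ℕ.* c ≡ a ℕ.+ b ℕ.+ c ℕ.+ 2 ℕ.* (c ℕ.+ c ℕ.+ c)
      r₁ = ℕR.solve-∀
      s6 : ∀ {n} (v : Vec ℕ n) → sum v ≡ sum (v Vec.++ (0 ∷ 0 ∷ []))
      s6 [] = refl
      s6 (a ∷ v) = cong (ℕ._+_ a) (s6 v)
    sorted₈ : Sorted mid
    sorted₈ = pad s₄
      where
      bel0 : ∀ {n c} (v : Vec ℕ n) → Below c v → Below c (v Vec.++ (0 ∷ 0 ∷ []))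
      bel0 [] _ = ℕ.z≤n , ℕ.z≤n , tt
      bel0 (a ∷ v) (p , h) = p , bel0 v h
      pad : ∀ {n} {v : Vec ℕ n} → Sorted v → Sorted (v Vec.++ (0 ∷ 0 ∷ []))
      pad {v = []} _ = (ℕ.z≤n , tt) , tt , tt
      pad {v = a ∷ v} (b , s) = bel0 v b , pad s
    above₀ : ∀ {n} (v : Vec ℕ n) → Above 0 v
    above₀ [] = tt
    above₀ (a ∷ v) = ℕ.z≤n , above₀ v
    term : Terminal mid S x₁ x₂ x₃ 0
    term = stuck S x₁ x₂ x₃ mid 0 x₂≤x₁ x₃≤x₂ bm sorted₈ (above₀ mid) ℕ.z≤n le₁ le₂
      (trans (cong (λ t → x₁ ℕ.* x₁ ℕ.+ x₂ ℕ.* x₂ ℕ.+ x₃ ℕ.* x₃ ℕ.+ t ℕ.+ 0) (sq-++ mid₆ (0 ∷ 0 ∷ [])))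
        (trans (a5 (x₁ ℕ.* x₁) (x₂ ℕ.* x₂) (x₃ ℕ.* x₃) (sq mid₆)) (null⇒sq S u null')))

-- The quotients X^⊥ / ℤX

takeV : ∀ m {n} → V (m ℕ.+ n) → V m
takeV zero    v       = []
takeV (suc m) (a ∷ v) = a ∷ takeV m v

dropV : ∀ m {n} → V (m ℕ.+ n) → V n
dropV zero    v       = v
dropV (suc m) (a ∷ v) = dropV m v

take++drop : ∀ m {n} (v : V (m ℕ.+ n)) → takeV m v Vec.++ dropV m v ≡ v
take++drop zero    v       = refl
take++drop (suc m) (a ∷ v) = cong (a ∷_) (take++drop m v)

take-++ : ∀ {m n} (v : V m) (w : V n) → takeV m (v Vec.++ w) ≡ v
take-++ []      w = refl
take-++ (a ∷ v) w = cong (a ∷_) (take-++ v w)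

drop-++ : ∀ {m n} (v : V m) (w : V n) → dropV m (v Vec.++ w) ≡ w
drop-++ []      w = refl
drop-++ (a ∷ v) w = drop-++ v w

⟪⟫-++ : ∀ {n M} (X Y : V (suc n)) (z w : V M) → ⟪ X Vec.++ z , Y Vec.++ w ⟫ ≡ ⟪ X , Y ⟫ + z ∙ w
⟪⟫-++ (a ∷ x) (b ∷ y) z w = trans (cong (_- a * b) (∙-++ x y z w)) (lem (x ∙ y) (z ∙ w) (a * b))
  where
  lem : ∀ p q c → (p + q) - c ≡ (p - c) + q
  lem = solve-∀

extend : ∀ {n} M → Isom n → Isom (n ℕ.+ M)
extend {n} M g = record
  { fw = λ Y → fw g (takeV (suc n) Y) Vec.++ dropV (suc n) Y
  ; bw = λ Y → bw g (takeV (suc n) Y) Vec.++ dropV (suc n) Y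
  ; bw∘fw = λ Y → trans (cong₂ (λ u v → bw g u Vec.++ v) (take-++ (fw g (takeV (suc n) Y)) _) (drop-++ (fw g (takeV (suc n) Y)) _))
      (trans (cong (Vec._++ dropV (suc n) Y) (bw∘fw g (takeV (suc n) Y))) (take++drop (suc n) Y))
  ; fw∘bw = λ Y → trans (cong₂ (λ u v → fw g u Vec.++ v) (take-++ (bw g (takeV (suc n) Y)) _) (drop-++ (bw g (takeV (suc n) Y)) _))
      (trans (cong (Vec._++ dropV (suc n) Y) (fw∘bw g (takeV (suc n) Y))) (take++drop (suc n) Y))
  ; pres = λ Y Z → trans (⟪⟫-++ (fw g (takeV (suc n) Y)) (fw g (takeV (suc n) Z)) _ _)
      (trans (cong (_+ dropV (suc n) Y ∙ dropV (suc n) Z) (pres g (takeV (suc n) Y) (takeV (suc n) Z)))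
        (trans (sym (⟪⟫-++ (takeV (suc n) Y) (takeV (suc n) Z) _ _))
          (cong₂ ⟪_,_⟫ (take++drop (suc n) Y) (take++drop (suc n) Z)))) }

extend-fw : ∀ {n} M (g : Isom n) X {T} → fw g X ≡ T → fw (extend M g) (X Vec.++ 𝟘 {M}) ≡ T Vec.++ 𝟘
extend-fw {n} M g X refl = cong₂ (λ u v → fw g u Vec.++ v) (take-++ X (𝟘 {M})) (drop-++ X (𝟘 {M}))

-- Representatives of the classes of norm m in X^⊥ / ℤX, normalised by o ≤ ⟪ Y , W ⟫ < o + d, where ⟪ X , W ⟫ = d.
record Cos {n} (X W : V (suc n)) (o : ℤ) (d : ℕ) (m : ℤ) (Y : V (suc n)) : Set where
  constructor cos
  field
    orth : ⟪ X , Y ⟫ ≡ 0ℤ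
    norm : ⟪ Y , Y ⟫ ≡ m
    lo   : o ≤ ⟪ Y , W ⟫
    hi   : ⟪ Y , W ⟫ < o + + d
open Cos public

window-unique : ∀ o d a u → o ≤ a → a < o + + d → o ≤ a + u * + d → a + u * + d < o + + d → u ≡ 0ℤ
window-unique o d a (+ zero) _ _ _ _ = refl
window-unique o d a (+ suc u) o≤a _ _ lt = contradiction lt (ℤₚ.≤⇒≯ (ℤₚ.+-mono-≤ o≤a
  (subst (+ d ≤_) (ℤₚ.pos-* (suc u) d) (+≤+ (ℕₚ.m≤m+n d _)))))
window-unique o d a -[1+ u ] _ a< o≤ _ = contradiction o≤ (ℤₚ.<⇒≱ (ℤₚ.<-≤-trans (ℤₚ.+-monoˡ-< (-[1+ u ] * + d) a<) le))
  where
  lem : ∀ o d u → o + d + (- (1ℤ + u)) * d ≡ o - u * d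
  lem = solve-∀
  le : o + + d + -[1+ u ] * + d ≤ o
  le = ℤₚ.≤-trans (ℤₚ.≤-reflexive (trans (lem o (+ d) (+ u)) (cong (λ t → o - t) (sym (ℤₚ.pos-* u d))))) (ℤₚ.i-j≤i o (+ (u ℕ.* d)))

divmod-unique : ∀ d .{{_ : ℕ.NonZero d}} t r a → r ℕ.< d → t ≡ + r + a * + d → t /ℕ d ≡ a × t %ℕ d ≡ r
divmod-unique d t r a r<d e = ℤₚ.i-j≡0⇒i≡j (t /ℕ d) a u≡0 , ℤₚ.+-injective r≡
  where
  r' = t %ℕ d
  q = t /ℕ d
  eq : + r ≡ + r' + (q - a) * + d
  eq = trans (l (+ r) a (+ d)) (trans (cong (_- a * + d) (trans (sym e) (a≡a%ℕn+[a/ℕn]*n t d))) (l₂ (+ r') q a (+ d)))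
    where
    l : ∀ r a d → r ≡ (r + a * d) - a * d
    l = solve-∀
    l₂ : ∀ r q a d → (r + q * d) - a * d ≡ r + (q - a) * d
    l₂ = solve-∀
  u≡0 : q - a ≡ 0ℤ
  u≡0 = window-unique 0ℤ d (+ r') (q - a) (+≤+ ℕ.z≤n) (+<+ (n%ℕd<d t d)) (subst (0ℤ ≤_) eq (+≤+ ℕ.z≤n)) (subst (_< + d) eq (+<+ r<d))
  r≡ : + r' ≡ + r
  r≡ = sym (trans eq (trans (cong (λ u → + r' + u * + d) u≡0) (ℤₚ.+-identityʳ (+ r'))))

module _ {n} (X : V (suc n)) (null : Null X) where

  shift-orth : ∀ t Y → ⟪ X , Y ⟫ ≡ 0ℤ → ⟪ X , Y ⊕ t · X ⟫ ≡ 0ℤ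
  shift-orth t Y e = trans (⟪⟫-linʳ t Y X X) (trans (cong₂ (λ u v → u + t * v) e null) (trans (ℤₚ.+-identityˡ _) (ℤₚ.*-zeroʳ t)))

  shift-norm : ∀ t Y → ⟪ X , Y ⟫ ≡ 0ℤ → ⟪ Y ⊕ t · X , Y ⊕ t · X ⟫ ≡ ⟪ Y , Y ⟫
  shift-norm t Y e = trans (⟪⟫-linˡ t Y X (Y ⊕ t · X)) (trans (cong₂ (λ u v → u + t * v) (⟪⟫-linʳ t Y X Y) (shift-orth t Y e))
    (trans (cong (λ u → ⟪ Y , Y ⟫ + t * u + t * 0ℤ) (trans (⟪⟫-comm Y X) e)) (lem ⟪ Y , Y ⟫ t)))
    where
    lem : ∀ a t → a + t * 0ℤ + t * 0ℤ ≡ a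
    lem = solve-∀

  module _ (W : V (suc n)) (o : ℤ) (d : ℕ) .{{_ : ℕ.NonZero d}} (dW : ⟪ X , W ⟫ ≡ + d) where

    shift : V (suc n) → ℤ
    shift Y = - ((⟪ Y , W ⟫ - o) /ℕ d)

    normalise : V (suc n) → V (suc n)
    normalise Y = Y ⊕ shift Y · X

    normalise-ok : ∀ {m Y} → ⟪ X , Y ⟫ ≡ 0ℤ → ⟪ Y , Y ⟫ ≡ m → Cos X W o d m (normalise Y)
    normalise-ok {m} {Y} e₁ e₂ = cos (shift-orth (shift Y) Y e₁) (trans (shift-norm (shift Y) Y e₁) e₂)
      (subst (o ≤_) (sym val) (ℤₚ.i≤i+j o (+ rem))) (subst (_< o + + d) (sym val) (ℤₚ.+-monoʳ-< o (+<+ (n%ℕd<d a d))))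
      where
      a = ⟪ Y , W ⟫ - o
      rem = a %ℕ d
      lem : ∀ o y r q d → y - o ≡ r + q * d → y + (- q) * d ≡ o + r
      lem o y r q d e = trans (l₁ o y q d) (trans (cong (λ t → o + t - q * d) e) (l₂ o r q d))
        where
        l₁ : ∀ o y q d → y + (- q) * d ≡ o + (y - o) - q * d
        l₁ = solve-∀
        l₂ : ∀ o r q d → o + (r + q * d) - q * d ≡ o + r
        l₂ = solve-∀
      val : ⟪ normalise Y , W ⟫ ≡ o + + rem
      val = trans (⟪⟫-linˡ (shift Y) Y X W) (trans (cong (λ t → ⟪ Y , W ⟫ + shift Y * t) dW)
        (lem o ⟪ Y , W ⟫ (+ rem) (a /ℕ d) (+ d) (a≡a%ℕn+[a/ℕn]*n a d)))

    cos-unique : ∀ {m Y} u → Cos X W o d m Y → Cos X W o d m (Y ⊕ u · X) → Y ⊕ u · X ≡ Y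
    cos-unique {m} {Y} u c c' = trans (cong (λ t → Y ⊕ t · X) u≡0) (⊕-0· Y X)
      where
      val : ⟪ Y ⊕ u · X , W ⟫ ≡ ⟪ Y , W ⟫ + u * + d
      val = trans (⟪⟫-linˡ u Y X W) (cong (λ t → ⟪ Y , W ⟫ + u * t) dW)
      u≡0 = window-unique o d ⟪ Y , W ⟫ u (lo c) (hi c) (subst (o ≤_) val (lo c')) (subst (_< o + + d) val (hi c'))

  -- Adding `X` moves `⟪ Y , W ⟫` by `d`, so a half-open window of length `d` meets every class
  -- modulo `ℤX` once. Two windows therefore enumerate the same classes.
  change-window : ∀ W o d .{{_ : ℕ.NonZero d}} → ⟪ X , W ⟫ ≡ + d → ∀ W' o' d' .{{_ : ℕ.NonZero d'}} → ⟪ X , W' ⟫ ≡ + d' →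
                  ∀ m → Bij (Cos X W o d m) (Cos X W' o' d' m)
  change-window W o d dW W' o' d' dW' m = record
    { to = normalise W' o' d' dW' ; from = normalise W o d dW
    ; to-ok = λ c → normalise-ok W' o' d' dW' (orth c) (norm c)
    ; from-ok = λ c → normalise-ok W o d dW (orth c) (norm c)
    ; from∘to = λ {Y} c → roundtrip W o d dW W' o' d' dW' {Y = Y} c
    ; to∘from = λ {Y} c → roundtrip W' o' d' dW' W o d dW {Y = Y} c }
    where
    roundtrip : ∀ W o d .{{_ : ℕ.NonZero d}} (dW : ⟪ X , W ⟫ ≡ + d) W' o' d' .{{_ : ℕ.NonZero d'}} (dW' : ⟪ X , W' ⟫ ≡ + d') {m Y} →
                Cos X W o d m Y → normalise W o d dW (normalise W' o' d' dW' Y) ≡ Y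
    roundtrip W o d dW W' o' d' dW' {m} {Y} c = trans e (cos-unique W o d dW _ c (subst (Cos X W o d m) e c″))
      where
      c' = normalise-ok W' o' d' dW' {Y = Y} (orth c) (norm c)
      c″ = normalise-ok W o d dW {Y = normalise W' o' d' dW' Y} (orth c') (norm c')
      e = ⊕-assoc-· Y X (shift W' o' d' dW' Y) (shift W o d dW (normalise W' o' d' dW' Y))

isom-bij : ∀ {n} (g : Isom n) X W o d m → Bij (Cos X W o d m) (Cos (fw g X) (fw g W) o d m)
isom-bij g X W o d m = record
  { to = fw g ; from = bw g
  ; to-ok = λ {Y} c → cos (trans (pres g X Y) (orth c)) (trans (pres g Y Y) (norm c))
      (subst (o ≤_) (sym (pres g Y W)) (lo c)) (subst (_< o + + d) (sym (pres g Y W)) (hi c))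
  ; from-ok = λ {Y} c →
      cos (trans (p Y X) (orth c)) (trans (p Y (bw g Y)) (trans (cong (λ t → ⟪ t , Y ⟫) (fw∘bw g Y)) (norm c)))
      (subst (o ≤_) (sym (q Y)) (lo c)) (subst (_< o + + d) (sym (q Y)) (hi c))
  ; from∘to = λ {Y} _ → bw∘fw g Y ; to∘from = λ {Y} _ → fw∘bw g Y }
  where
  p : ∀ Y Z → ⟪ Z , bw g Y ⟫ ≡ ⟪ fw g Z , Y ⟫
  p Y Z = trans (sym (pres g Z (bw g Y))) (cong (λ t → ⟪ fw g Z , t ⟫) (fw∘bw g Y))
  q : ∀ Y → ⟪ bw g Y , W ⟫ ≡ ⟪ Y , fw g W ⟫
  q Y = trans (sym (pres g (bw g Y) W)) (cong (λ t → ⟪ t , fw g W ⟫) (fw∘bw g Y))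

-- The isometry acts on the leading coordinates only, the last `M` being carried along; the
-- transported window is then exchanged for a convenient one.
cos-bij : ∀ {n} (X T : V (suc n)) → Null X → Reduces X T → ∀ M W o d .{{_ : ℕ.NonZero d}} → ⟪ X Vec.++ 𝟘 {M} , W ⟫ ≡ + d →
          ∀ W' o' d' .{{_ : ℕ.NonZero d'}} → ⟪ T Vec.++ 𝟘 {M} , W' ⟫ ≡ + d' →
          ∀ m → Bij (Cos (X Vec.++ 𝟘 {M}) W o d m) (Cos (T Vec.++ 𝟘 {M}) W' o' d' m)
cos-bij X T null (g , e) M W o d dW W' o' d' dW' m = Bij-trans (isom-bij G X' W o d m)
  (subst (λ Z → Bij (Cos (fw G X') (fw G W) o d m) (Cos Z W' o' d' m)) e'
    (change-window (fw G X') null' (fw G W) o d (trans (pres G X' W) dW) W' o' d' (trans (cong (λ Z → ⟪ Z , W' ⟫) e') dW') m))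
  where
  G = extend M g
  X' = X Vec.++ 𝟘 {M}
  e' = extend-fw M g X e
  null' : Null (fw G X')
  null' = trans (pres G X' X') (trans (⟪⟫-++ X X (𝟘 {M}) 𝟘) (cong₂ _+_ null (∙-𝟘ʳ (𝟘 {M}))))

-- The window reads `0 ≤ b < 1`, and orthogonality to `(1; 1, 0, …)` reads `a = b`; hence the
-- quotient is ℤⁿ.
T₁-bij : ∀ n m → Bij (Cos (T₁ n) (-1ℤ ∷ 𝟘) 0ℤ 1 m) (Norm {n} m)
T₁-bij n m = record
  { to = λ { (_ ∷ _ ∷ v) → v } ; from = λ v → 0ℤ ∷ 0ℤ ∷ v
  ; to-ok = λ { {b ∷ a ∷ v} c → let b≡ = b≡0 b a v c in
      trans (lem a b (v ∙ v)) (trans (cong₂ (λ x y → a * a + v ∙ v - b * b - (x * x - y * y)) (a≡0 b a v c) b≡) (trans (ℤₚ.+-identityʳ _) (norm c))) }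
  ; from-ok = λ {v} e → cos (trans (cong (λ t → 0ℤ + t - 0ℤ) (∙-𝟘ˡ v)) refl) (trans (lem₂ (v ∙ v)) e)
      (ℤₚ.≤-reflexive (sym (val 0ℤ (0ℤ ∷ v)))) (subst (_< 1ℤ) (sym (val 0ℤ (0ℤ ∷ v))) (+<+ (ℕ.s≤s ℕ.z≤n)))
  ; from∘to = λ { {b ∷ a ∷ v} c → cong₂ (λ x y → x ∷ y ∷ v) (sym (b≡0 b a v c)) (sym (a≡0 b a v c)) }
  ; to∘from = λ _ → refl }
  where
  val : ∀ {n} b (y : V n) → ⟪ b ∷ y , -1ℤ ∷ 𝟘 ⟫ ≡ b
  val b y = trans (cong (_- b * -1ℤ) (∙-𝟘ʳ y)) (l b)
    where
    l : ∀ b → 0ℤ - b * -1ℤ ≡ b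
    l = solve-∀
  0≤b<1 : ∀ b → 0ℤ ≤ b → b < 1ℤ → b ≡ 0ℤ
  0≤b<1 (+ zero) _ _ = refl
  0≤b<1 (+ suc b) _ (+<+ (ℕ.s≤s ()))
  b≡0 : ∀ b a v → Cos (T₁ n) (-1ℤ ∷ 𝟘) 0ℤ 1 m (b ∷ a ∷ v) → b ≡ 0ℤ
  b≡0 b a v c = 0≤b<1 b (subst (0ℤ ≤_) (val b (a ∷ v)) (lo c)) (subst (_< 1ℤ) (val b (a ∷ v)) (hi c))
  a≡0 : ∀ b a v → Cos (T₁ n) (-1ℤ ∷ 𝟘) 0ℤ 1 m (b ∷ a ∷ v) → a ≡ 0ℤ
  a≡0 b a v c = trans (l a b) (trans (cong₂ (λ x y → (1ℤ * a + x - 1ℤ * b) - x + y) (sym (∙-𝟘ˡ v)) (b≡0 b a v c))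
    (trans (cong (λ t → t - 𝟘 ∙ v + 0ℤ) (orth c)) (trans (cong (λ t → 0ℤ - t + 0ℤ) (∙-𝟘ˡ v)) refl)))
    where
    l : ∀ a b → a ≡ (1ℤ * a + 0ℤ - 1ℤ * b) - 0ℤ + b
    l = solve-∀
  lem : ∀ a b q → q ≡ a * a + q - b * b - (a * a - b * b)
  lem = solve-∀
  lem₂ : ∀ q → 0ℤ + q - 0ℤ ≡ q
  lem₂ = solve-∀

-- E₈ ⊕ ℤⁿ and ℤ^{8+n} have the same theta series modulo 16

Even : ℤ → Set
Even t = + 2 ∣ₛ t

even? : ∀ t → Dec (Even t)
even? t = + 2 ∣ₛ? t

half : ℤ → ℤ
half t = t /ℕ 2

half-unique : ∀ t r a → r ℕ.< 2 → t ≡ + r + a * + 2 → half t ≡ a × t %ℕ 2 ≡ r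
half-unique = divmod-unique 2

even-or-odd : ∀ t → t ≡ + 2 * half t ⊎ t ≡ 1ℤ + + 2 * half t
even-or-odd t with t %ℕ 2 | n%ℕd<d t 2 | a≡a%ℕn+[a/ℕn]*n t 2
... | 0 | _ | e = inj₁ (trans e (trans (ℤₚ.+-identityˡ _) (ℤₚ.*-comm (half t) (+ 2))))
... | 1 | _ | e = inj₂ (trans e (cong (_+_ 1ℤ) (ℤₚ.*-comm (half t) (+ 2))))
... | suc (suc _) | ℕ.s≤s (ℕ.s≤s ()) | _

¬even-1+2a : ∀ a → ¬ Even (1ℤ + + 2 * a)
¬even-1+2a a (divides q e) = contradiction (trans (sym (proj₂ (half-unique _ 0 q (ℕ.s≤s ℕ.z≤n) (trans e (sym (ℤₚ.+-identityˡ _))))))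
  (proj₂ (half-unique _ 1 a (ℕ.s≤s (ℕ.s≤s ℕ.z≤n)) (cong (_+_ 1ℤ) (ℤₚ.*-comm (+ 2) a))))) λ ()

even-half : ∀ t → Even t → t ≡ + 2 * half t
even-half t ev with even-or-odd t
... | inj₁ e = e
... | inj₂ e = contradiction (subst Even e ev) (¬even-1+2a (half t))

odd-half : ∀ t → ¬ Even t → t ≡ 1ℤ + + 2 * half t
odd-half t od with even-or-odd t
... | inj₁ e = contradiction (divides (half t) (trans e (ℤₚ.*-comm (+ 2) (half t)))) od
... | inj₂ e = e

odd+→ : ∀ x y → ¬ Even (x + y) → ¬ Even x → ¬ ¬ Even y
odd+→ x y od ox oy = od (divides (1ℤ + half x + half y) (trans (cong₂ _+_ (odd-half x ox) (odd-half y oy)) (lem (half x) (half y))))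
  where
  lem : ∀ a b → (1ℤ + + 2 * a) + (1ℤ + + 2 * b) ≡ (1ℤ + a + b) * + 2
  lem = solve-∀

odd-other : ∀ x y → ¬ Even (x + y) → ¬ (¬ Even x) → ¬ Even y
odd-other x y od nox ey with even? x
... | yes ex = od (∣m∣n⇒∣m+n ex ey)
... | no ox = nox ox

odd-swap : ∀ x y → ¬ Even (x + y) → ¬ Even (y + x)
odd-swap x y = subst (λ t → ¬ Even t) (ℤₚ.+-comm x y)

-- Eight coordinates as a binary tree, whose halves, quarters and entries can be exchanged by
-- involutions.
Pair Quad Oct : Set
Pair = ℤ × ℤ
Quad = Pair × Pair
Oct = Quad × Quad

s₂ n₂ : Pair → ℤ
s₂ (a , b) = a + b
n₂ (a , b) = a * a + b * b
s₄ n₄ : Quad → ℤ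
s₄ (p , q) = s₂ p + s₂ q
n₄ (p , q) = n₂ p + n₂ q
s₈ n₈ : Oct → ℤ
s₈ (u , v) = s₄ u + s₄ v
n₈ (u , v) = n₄ u + n₄ v

odd? : ∀ t → Dec (¬ Even t)
odd? t = ¬? (even? t)

OddNorm : ∀ {n} → ℤ → Oct × V n → Set
OddNorm m (x , w) = n₈ x + w ∙ w ≡ m × ¬ Even (s₈ x)

-- Exchange halves, quarters and entries so that the first entry becomes odd, then choose its sign.
card-oddNorm : ∀ {n} m (F : Finite (OddNorm {n} m)) → + 16 ∣ₛ card F
card-oddNorm {n} m F = divides (card F₄) (trans h₁ (trans (cong (+ 2 *_) (trans h₂ (cong (+ 2 *_) (trans h₃ (cong (+ 2 *_) h₄))))) (lem (card F₄))))
  where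
  lem : ∀ a → + 2 * (+ 2 * (+ 2 * (+ 2 * a))) ≡ a * + 16
  lem = solve-∀
  Q₁ Q₂ Q₃ Q₄ : Oct × V n → Set
  Q₁ ((u , v) , w) = ¬ Even (s₄ u)
  Q₂ (((p , q) , v) , w) = ¬ Even (s₂ p)
  Q₃ ((((a , b) , q) , v) , w) = ¬ Even a
  Q₄ ((((a , b) , q) , v) , w) = 0ℤ < a
  Q₁? : ∀ c → Dec (Q₁ c)
  Q₁? c = odd? _
  Q₂? : ∀ c → Dec (Q₂ c)
  Q₂? c = odd? _
  Q₃? : ∀ c → Dec (Q₃ c)
  Q₃? c = odd? _
  Q₄? : ∀ c → Dec (Q₄ c)
  Q₄? c = 0ℤ ℤₚ.<? _
  F₁ = finite-filter Q₁? F
  F₂ = finite-filter Q₂? F₁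
  F₃ = finite-filter Q₃? F₂
  F₄ = finite-filter Q₄? F₃
  τ₁ τ₂ τ₃ τ₄ : Oct × V n → Oct × V n
  τ₁ ((u , v) , w) = (v , u) , w
  τ₂ (((p , q) , v) , w) = ((q , p) , v) , w
  τ₃ ((((a , b) , q) , v) , w) = (((b , a) , q) , v) , w
  τ₄ ((((a , b) , q) , v) , w) = (((- a , b) , q) , v) , w
  h₁ : card F ≡ + 2 * card F₁
  h₁ = card-half Q₁? F τ₁
    (λ { {(u , v) , w} (e , o) → trans (cong (_+ w ∙ w) (ℤₚ.+-comm (n₄ v) (n₄ u))) e , odd-swap (s₄ u) (s₄ v) o })
    (λ _ → refl)
    (λ { {(u , v) , w} (e , o) q → odd+→ (s₄ u) (s₄ v) o q })
    (λ { {(u , v) , w} (e , o) q → odd-other (s₄ u) (s₄ v) o q })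
  h₂ : card F₁ ≡ + 2 * card F₂
  h₂ = card-half Q₂? F₁ τ₂
    (λ { {((p , q) , v) , w} ((e , o) , o₁) →
      (trans (cong (λ t → t + n₄ v + w ∙ w) (ℤₚ.+-comm (n₂ q) (n₂ p))) e , subst (λ t → ¬ Even (t + s₄ v)) (ℤₚ.+-comm (s₂ p) (s₂ q)) o) , odd-swap (s₂ p) (s₂ q) o₁ })
    (λ _ → refl)
    (λ { {((p , q) , v) , w} (_ , o) h → odd+→ (s₂ p) (s₂ q) o h })
    (λ { {((p , q) , v) , w} (_ , o) h → odd-other (s₂ p) (s₂ q) o h })
  h₃ : card F₂ ≡ + 2 * card F₃
  h₃ = card-half Q₃? F₂ τ₃
    (λ { {(((a , b) , q) , v) , w} (((e , o) , o₁) , o₂) →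
      ((trans (cong (λ t → t + n₂ q + n₄ v + w ∙ w) (ℤₚ.+-comm (b * b) (a * a))) e , subst (λ t → ¬ Even (t + s₂ q + s₄ v)) (ℤₚ.+-comm a b) o)
       , subst (λ t → ¬ Even (t + s₂ q)) (ℤₚ.+-comm a b) o₁) , odd-swap a b o₂ })
    (λ _ → refl)
    (λ { {(((a , b) , q) , v) , w} (_ , o) h → odd+→ a b o h })
    (λ { {(((a , b) , q) , v) , w} (_ , o) h → odd-other a b o h })
  sign-flip : ∀ a z → ¬ Even (a + z) → ¬ Even (- a + z)
  sign-flip a z o (divides q e) = o (divides (q + a) (trans (l a z) (trans (cong (λ t → t + + 2 * a) e) (l₂ q a))))
    where
    l : ∀ a z → a + z ≡ (- a + z) + + 2 * a
    l = solve-∀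
    l₂ : ∀ q a → q * + 2 + + 2 * a ≡ (q + a) * + 2
    l₂ = solve-∀
  assoc₂ : ∀ a b q → a + b + q ≡ a + (b + q)
  assoc₂ = solve-∀
  assoc₃ : ∀ a b q v → a + b + q + v ≡ a + (b + q + v)
  assoc₃ = solve-∀
  h₄ : card F₃ ≡ + 2 * card F₄
  h₄ = card-half Q₄? F₃ τ₄
    (λ { {(((a , b) , q) , v) , w} ((((e , o) , o₁) , o₂) , o₃) →
      (((trans (cong (λ t → t + b * b + n₂ q + n₄ v + w ∙ w) (neg-sq a)) e
        , subst (λ t → ¬ Even t) (sym (assoc₃ (- a) b (s₂ q) (s₄ v))) (sign-flip a _ (subst (λ t → ¬ Even t) (assoc₃ a b (s₂ q) (s₄ v)) o)))
       , subst (λ t → ¬ Even t) (sym (assoc₂ (- a) b (s₂ q))) (sign-flip a _ (subst (λ t → ¬ Even t) (assoc₂ a b (s₂ q)) o₁)))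
       , sign-flip a b o₂) , subst (λ t → ¬ Even t) (ℤₚ.+-identityʳ (- a)) (sign-flip a 0ℤ (subst (λ t → ¬ Even t) (sym (ℤₚ.+-identityʳ a)) o₃)) })
    (λ { {(((a , b) , q) , v) , w} _ → cong (λ t → (((t , b) , q) , v) , w) (ℤₚ.neg-involutive a) })
    (λ { {(((a , b) , q) , v) , w} _ 0<a 0<-a → ℤₚ.<-asym 0<a (subst (_< 0ℤ) (ℤₚ.neg-involutive a) (ℤₚ.neg-mono-< 0<-a)) })
    (λ { {(((a , b) , q) , v) , w} (_ , o) ≮ → pos a o ≮ })
    where
    neg-sq : ∀ a → - a * - a ≡ a * a
    neg-sq = solve-∀
    pos : ∀ a → ¬ Even a → ¬ (0ℤ < a) → 0ℤ < - a
    pos (+ zero) o _ = contradiction (divides 0ℤ refl) o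
    pos (+ suc a) _ ≮ = contradiction (+<+ (ℕ.s≤s ℕ.z≤n)) ≮
    pos -[1+ a ] _ _ = +<+ (ℕ.s≤s ℕ.z≤n)

-- With `y' = y − 1/2` on eight coordinates, `|y'|² = |y|² − s + 2`; the equation thus says that the
-- half-integral vector has norm `m`.
HalfNorm : ∀ {n} → ℤ → Oct × V n → Set
HalfNorm m (x , w) = n₈ x + w ∙ w ≡ m + s₈ x - + 2 × ¬ Even (s₈ x)

-- In the coordinates y − 1/2 the map y ↦ 1 − y is a sign change; change signs in pairs.
card-halfNorm : ∀ {n} m (F : Finite (HalfNorm {n} m)) → + 16 ∣ₛ card F
card-halfNorm {n} m F = divides (card F₄) (trans h₁ (trans (cong (+ 2 *_) (trans h₂ (cong (+ 2 *_) (trans h₃ (cong (+ 2 *_) h₄))))) (lem (card F₄))))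
  where
  lem : ∀ a → + 2 * (+ 2 * (+ 2 * (+ 2 * a))) ≡ a * + 16
  lem = solve-∀
  -- One substitution `a ↦ 1 − a` reverses the parity of the coordinate sum, two together preserve
  -- it.
  τ : Pair → Pair
  τ (a , b) = 1ℤ - a , 1ℤ - b
  Q : Pair → Set
  Q (a , b) = 0ℤ < a
  Q? : ∀ p → Dec (Q p)
  Q? (a , b) = 0ℤ ℤₚ.<? a
  ττ : ∀ p → τ (τ p) ≡ p
  ττ (a , b) = cong₂ _,_ (l a) (l b)
    where
    l : ∀ a → 1ℤ - (1ℤ - a) ≡ a
    l = solve-∀
  1-pos : ∀ a → ¬ (0ℤ < a) → 0ℤ < 1ℤ - a
  1-pos (+ zero) _ = +<+ (ℕ.s≤s ℕ.z≤n)
  1-pos (+ suc a) ≮ = contradiction (+<+ (ℕ.s≤s ℕ.z≤n)) ≮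
  1-pos -[1+ a ] _ = +<+ (ℕ.s≤s ℕ.z≤n)
  1-neg : ∀ a → 0ℤ < a → ¬ (0ℤ < 1ℤ - a)
  1-neg (+ zero) (+<+ ()) _
  1-neg (+ suc zero) _ (+<+ ())
  1-neg (+ suc (suc a)) _ ()
  Qτ : ∀ p → ¬ Q p → Q (τ p)
  Qτ (a , b) = 1-pos a
  Qτ' : ∀ p → Q p → ¬ Q (τ p)
  Qτ' (a , b) = 1-neg a
  G : Pair → Pair → Pair → Pair → V n → Set
  G p q u v w = HalfNorm m (((p , q) , (u , v)) , w)
  core : ∀ p N s (t : ℤ) → n₂ p + N ≡ t + (s₂ p + s) - + 2 × ¬ Even (s₂ p + s) → n₂ (τ p) + N ≡ t + (s₂ (τ p) + s) - + 2 × ¬ Even (s₂ (τ p) + s)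
  core (a , b) N s t (e , o) = trans (l a b N) (trans (cong (λ z → z + + 2 - + 2 * (a + b)) e) (l₂ a b s t)) ,
      λ { (divides q e') → o (divides (q + a + b - 1ℤ) (trans (l₃ a b s) (trans (cong (λ z → z + + 2 * (a + b) - + 2) e') (l₄ q a b)))) }
    where
    l : ∀ a b N → ((1ℤ - a) * (1ℤ - a) + (1ℤ - b) * (1ℤ - b)) + N ≡ (a * a + b * b + N) + + 2 - + 2 * (a + b)
    l = solve-∀
    l₂ : ∀ a b s t → t + (a + b + s) - + 2 + + 2 - + 2 * (a + b) ≡ t + ((1ℤ - a + (1ℤ - b)) + s) - + 2
    l₂ = solve-∀
    l₃ : ∀ a b s → a + b + s ≡ ((1ℤ - a + (1ℤ - b)) + s) + + 2 * (a + b) - + 2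
    l₃ = solve-∀
    l₄ : ∀ q a b → q * + 2 + + 2 * (a + b) - + 2 ≡ (q + a + b - 1ℤ) * + 2
    l₄ = solve-∀
  toFront : ∀ p q u v w → G p q u v w → n₂ p + (n₂ q + (n₂ u + n₂ v) + w ∙ w) ≡ m + (s₂ p + (s₂ q + (s₂ u + s₂ v))) - + 2 × ¬ Even (s₂ p + (s₂ q + (s₂ u + s₂ v)))
  toFront p q u v w (e , o) = trans (sym (l (n₂ p) (n₂ q) (n₂ u + n₂ v) (w ∙ w))) (trans e (cong (λ t → m + t - + 2) (l₂ (s₂ p) (s₂ q) (s₂ u + s₂ v)))) ,
      subst (λ t → ¬ Even t) (l₂ (s₂ p) (s₂ q) (s₂ u + s₂ v)) o
    where
    l : ∀ p q u w → p + q + u + w ≡ p + (q + u + w)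
    l = solve-∀
    l₂ : ∀ p q u → p + q + u ≡ p + (q + u)
    l₂ = solve-∀
  fromFront : ∀ p q u v w → n₂ p + (n₂ q + (n₂ u + n₂ v) + w ∙ w) ≡ m + (s₂ p + (s₂ q + (s₂ u + s₂ v))) - + 2 × ¬ Even (s₂ p + (s₂ q + (s₂ u + s₂ v))) → G p q u v w
  fromFront p q u v w (e , o) = trans (l (n₂ p) (n₂ q) (n₂ u + n₂ v) (w ∙ w)) (trans e (cong (λ t → m + t - + 2) (sym (l₂ (s₂ p) (s₂ q) (s₂ u + s₂ v))))) ,
      subst (λ t → ¬ Even t) (sym (l₂ (s₂ p) (s₂ q) (s₂ u + s₂ v))) o
    where
    l : ∀ p q u w → p + q + u + w ≡ p + (q + u + w)
    l = solve-∀
    l₂ : ∀ p q u → p + q + u ≡ p + (q + u)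
    l₂ = solve-∀
  flip₁ : ∀ p q u v w → G p q u v w → G (τ p) q u v w
  flip₁ p q u v w g = fromFront (τ p) q u v w (core p _ _ m (toFront p q u v w g))
  perm₁ : ∀ p q u v w → G p q u v w → G q p u v w
  perm₁ p q u v w (e , o) = trans (cong (λ t → t + (n₂ u + n₂ v) + w ∙ w) (ℤₚ.+-comm (n₂ q) (n₂ p)))
      (trans e (cong (λ t → m + (t + (s₂ u + s₂ v)) - + 2) (ℤₚ.+-comm (s₂ p) (s₂ q)))) ,
      subst (λ t → ¬ Even (t + (s₂ u + s₂ v))) (ℤₚ.+-comm (s₂ p) (s₂ q)) o
  perm₂ : ∀ p q u v w → G p q u v w → G u v p q w
  perm₂ p q u v w (e , o) = trans (cong (_+ w ∙ w) (ℤₚ.+-comm (n₂ u + n₂ v) (n₂ p + n₂ q))) (trans e (cong (λ t → m + t - + 2) (ℤₚ.+-comm (s₂ p + s₂ q) (s₂ u + s₂ v)))) ,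
      subst (λ t → ¬ Even t) (ℤₚ.+-comm (s₂ p + s₂ q) (s₂ u + s₂ v)) o
  flip₂ : ∀ p q u v w → G p q u v w → G p (τ q) u v w
  flip₂ p q u v w g = perm₁ (τ q) p u v w (flip₁ q p u v w (perm₁ p q u v w g))
  flip₃ : ∀ p q u v w → G p q u v w → G p q (τ u) v w
  flip₃ p q u v w g = perm₂ (τ u) v p q w (flip₁ u v p q w (perm₂ p q u v w g))
  flip₄ : ∀ p q u v w → G p q u v w → G p q u (τ v) w
  flip₄ p q u v w g = perm₂ u (τ v) p q w (flip₂ u v p q w (perm₂ p q u v w g))
  F₁ = finite-filter (λ c → Q? (proj₁ (proj₁ (proj₁ c)))) F
  F₂ = finite-filter (λ c → Q? (proj₂ (proj₁ (proj₁ c)))) F₁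
  F₃ = finite-filter (λ c → Q? (proj₁ (proj₂ (proj₁ c)))) F₂
  F₄ = finite-filter (λ c → Q? (proj₂ (proj₂ (proj₁ c)))) F₃
  h₁ : card F ≡ + 2 * card F₁
  h₁ = card-half (λ c → Q? (proj₁ (proj₁ (proj₁ c)))) F (λ { (((p , q) , (u , v)) , w) → ((τ p , q) , (u , v)) , w })
    (λ { {((p , q) , (u , v)) , w} g → flip₁ p q u v w g }) (λ { {((p , q) , (u , v)) , w} _ → cong (λ t → ((t , q) , (u , v)) , w) (ττ p) })
    (λ { {((p , q) , (u , v)) , w} _ → Qτ' p }) (λ { {((p , q) , (u , v)) , w} _ → Qτ p })
  h₂ : card F₁ ≡ + 2 * card F₂
  h₂ = card-half (λ c → Q? (proj₂ (proj₁ (proj₁ c)))) F₁ (λ { (((p , q) , (u , v)) , w) → ((p , τ q) , (u , v)) , w })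
    (λ { {((p , q) , (u , v)) , w} (g , h) → flip₂ p q u v w g , h }) (λ { {((p , q) , (u , v)) , w} _ → cong (λ t → ((p , t) , (u , v)) , w) (ττ q) })
    (λ { {((p , q) , (u , v)) , w} _ → Qτ' q }) (λ { {((p , q) , (u , v)) , w} _ → Qτ q })
  h₃ : card F₂ ≡ + 2 * card F₃
  h₃ = card-half (λ c → Q? (proj₁ (proj₂ (proj₁ c)))) F₂ (λ { (((p , q) , (u , v)) , w) → ((p , q) , (τ u , v)) , w })
    (λ { {((p , q) , (u , v)) , w} ((g , h) , k) → (flip₃ p q u v w g , h) , k }) (λ { {((p , q) , (u , v)) , w} _ → cong (λ t → ((p , q) , (t , v)) , w) (ττ u) })
    (λ { {((p , q) , (u , v)) , w} _ → Qτ' u }) (λ { {((p , q) , (u , v)) , w} _ → Qτ u })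
  h₄ : card F₃ ≡ + 2 * card F₄
  h₄ = card-half (λ c → Q? (proj₂ (proj₂ (proj₁ c)))) F₃ (λ { (((p , q) , (u , v)) , w) → ((p , q) , (u , τ v)) , w })
    (λ { {((p , q) , (u , v)) , w} (((g , h) , k) , l) → ((flip₄ p q u v w g , h) , k) , l }) (λ { {((p , q) , (u , v)) , w} _ → cong (λ t → ((p , q) , (u , t)) , w) (ττ v) })
    (λ { {((p , q) , (u , v)) , w} _ → Qτ' v }) (λ { {((p , q) , (u , v)) , w} _ → Qτ v })

card-split : ∀ {A : Set} {P Q : A → Set} (Q? : ∀ a → Dec (Q a)) (F : Finite P) →
             card F ≡ card (finite-filter Q? F) + card (finite-filter (λ a → ¬? (Q? a)) F)
card-split Q? F = trans (∑-cong (elems F) (λ a → one (Q? a))) (trans (∑-+ (elems F) _ _)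
  (sym (cong₂ _+_ (card-filter Q? F) (card-filter (λ a → ¬? (Q? a)) F))))
  where
  one : ∀ {P : Set} (d : Dec P) → 1ℤ ≡ ⟦ d ⟧ + ⟦ ¬? d ⟧
  one (yes _) = refl
  one (no _)  = refl

finite-inj₂ : ∀ {A B : Set} {P : A → Set} {Q : B → Set} → B → Finite {A ⊎ B} [ P , Q ] → Finite Q
finite-inj₂ {A} {B} {P} {Q} b₀ F = finite-transport β (finite-filter right? F)
  where
  Right : A ⊎ B → Set
  Right (inj₁ _) = ⊥
  Right (inj₂ _) = ⊤
  right? : ∀ c → Dec (Right c)
  right? (inj₁ _) = no λ ()
  right? (inj₂ _) = yes tt
  β : Bij (λ c → [ P , Q ] c × Right c) Q
  β = record { to = λ { (inj₁ _) → b₀ ; (inj₂ b) → b } ; from = inj₂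
             ; to-ok = λ { {inj₂ b} (q , _) → q } ; from-ok = λ q → q , tt
             ; from∘to = λ { {inj₂ b} _ → refl } ; to∘from = λ _ → refl }

-- An inner product rather than a plain sum, so that `⟪ T₂ n , b ∷ a ∷ y ⟫` unfolds to
-- `1 * a + σ₈ y − 3 * b`.
σ₈ : ∀ {n} → V (8 ℕ.+ n) → ℤ
σ₈ {n} y = (𝟙 {8} Vec.++ 𝟘 {n}) ∙ y

toOct : ∀ {n} → V (8 ℕ.+ n) → Oct × V n
toOct (a ∷ b ∷ c ∷ d ∷ e ∷ f ∷ g ∷ h ∷ w) = ((((a , b) , (c , d)) , ((e , f) , (g , h))) , w)

fromOct : ∀ {n} → Oct × V n → V (8 ℕ.+ n)
fromOct ((((a , b) , (c , d)) , ((e , f) , (g , h))) , w) = a ∷ b ∷ c ∷ d ∷ e ∷ f ∷ g ∷ h ∷ w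

regroup : ∀ a b c d e f g h w → a + b + (c + d) + (e + f + (g + h)) + w ≡ a + (b + (c + (d + (e + (f + (g + (h + w)))))))
regroup = solve-∀

oct-norm : ∀ {n} (c : Oct × V n) → n₈ (proj₁ c) + proj₂ c ∙ proj₂ c ≡ fromOct c ∙ fromOct c
oct-norm ((((a , b) , (c , d)) , ((e , f) , (g , h))) , w) = regroup (a * a) (b * b) (c * c) (d * d) (e * e) (f * f) (g * g) (h * h) (w ∙ w)

oct-sum : ∀ {n} (c : Oct × V n) → s₈ (proj₁ c) ≡ σ₈ (fromOct c)
oct-sum ((((a , b) , (c , d)) , ((e , f) , (g , h))) , w) = trans (sym (ℤₚ.+-identityʳ _)) (trans (cong (_+_ (a + b + (c + d) + (e + f + (g + h)))) (sym (∙-𝟘ˡ w)))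
  (trans (regroup a b c d e f g h (𝟘 ∙ w)) (1*s (1* a) (1*s (1* b) (1*s (1* c) (1*s (1* d) (1*s (1* e) (1*s (1* f) (1*s (1* g) (1*s (1* h) refl))))))))))
  where
  1* : ∀ a → a ≡ 1ℤ * a
  1* a = sym (ℤₚ.*-identityˡ a)
  1*s : ∀ {a b c d} → a ≡ b → c ≡ d → a + c ≡ b + d
  1*s = cong₂ _+_

oct-bij : ∀ {n} {P : V (8 ℕ.+ n) → Set} {Q : Oct × V n → Set} → (∀ {c} → P (fromOct c) → Q c) → (∀ {c} → Q c → P (fromOct c)) → Bij P Q
oct-bij {n} {P} f g = record
  { to = toOct ; from = fromOct
  ; to-ok = λ {y} p → f (subst P (sym (ft y)) p) ; from-ok = g
  ; from∘to = λ {y} _ → ft y ; to∘from = λ _ → refl }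
  where
  ft : ∀ y → fromOct (toOct y) ≡ y
  ft (a ∷ b ∷ c ∷ d ∷ e ∷ f ∷ g ∷ h ∷ w) = refl

W₂ : ∀ n → V (suc (9 ℕ.+ n))
W₂ n = -1ℤ ∷ -1ℤ ∷ 𝟘 {8 ℕ.+ n}

⟪⟫-W : ∀ {n} b a (y : V n) → ⟪ b ∷ a ∷ y , -1ℤ ∷ -1ℤ ∷ 𝟘 ⟫ ≡ b - a
⟪⟫-W b a y = trans (cong (λ t → a * -1ℤ + t - b * -1ℤ) (∙-𝟘ʳ y)) (l a b)
  where
  l : ∀ a b → a * -1ℤ + 0ℤ - b * -1ℤ ≡ b - a
  l = solve-∀

module _ {n : ℕ} (m : ℤ) where

  EvenPart OddPart : V (8 ℕ.+ n) → Set
  EvenPart y = Norm m y × Even (σ₈ y)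
  OddPart y = y ∙ y ≡ m + σ₈ y - + 2 × ¬ Even (σ₈ y)

  C₂ : V (suc (9 ℕ.+ n)) → Set
  C₂ = Cos (T₂ n) (W₂ n) 0ℤ 2 m

  -- T₂^⊥ / T₂ is E₈ ⊕ ℤⁿ, here as the 2-neighbour of ℤ^{8+n}: b − a = 0 gives the vectors in ℤ^{8+n}
  -- with even coordinate sum, b − a = 1 those with half-integral first eight coordinates.
  case₀ : ∀ b a y → C₂ (b ∷ a ∷ y) → b - a ≡ 0ℤ → EvenPart y × half (σ₈ y) ≡ b × half (σ₈ y) ≡ a
  case₀ b a y c e = (norm' , divides a σ≡) , trans h≡ a≡b , h≡
    where
    a≡b : a ≡ b
    a≡b = sym (ℤₚ.i-j≡0⇒i≡j b a e)
    σ≡ : σ₈ y ≡ a * + 2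
    σ≡ = trans (l a b (σ₈ y)) (trans (cong₂ (λ u v → u + v + + 2 * a) (orth c) (cong (+ 3 *_) e)) (l₂ a))
      where
      l : ∀ a b s → s ≡ (1ℤ * a + s - + 3 * b) + + 3 * (b - a) + + 2 * a
      l = solve-∀
      l₂ : ∀ a → 0ℤ + + 3 * 0ℤ + + 2 * a ≡ a * + 2
      l₂ = solve-∀
    h≡ : half (σ₈ y) ≡ a
    h≡ = proj₁ (half-unique (σ₈ y) 0 a (ℕ.s≤s ℕ.z≤n) (trans σ≡ (sym (ℤₚ.+-identityˡ _))))
    norm' : y ∙ y ≡ m
    norm' = trans (l a b (y ∙ y)) (trans (cong₂ (λ u v → u + v * (b + a)) (norm c) e) (ℤₚ.+-identityʳ m))
      where
      l : ∀ a b q → q ≡ (a * a + q - b * b) + (b - a) * (b + a)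
      l = solve-∀

  case₁ : ∀ b a y → C₂ (b ∷ a ∷ y) → b - a ≡ 1ℤ → OddPart y × half (σ₈ y) ≡ b × half (σ₈ y) - 1ℤ ≡ a
  case₁ b a y c e = (norm' , subst (λ t → ¬ Even t) (sym σ≡) (¬even-1+2a b)) , h≡ , trans (cong (_- 1ℤ) (trans h≡ (sym b≡))) (l₃ a)
    where
    b≡ : 1ℤ + a ≡ b
    b≡ = trans (cong (_+ a) (sym e)) (l b a)
      where
      l : ∀ b a → (b - a) + a ≡ b
      l = solve-∀
    l₃ : ∀ a → 1ℤ + a - 1ℤ ≡ a
    l₃ = solve-∀
    σ≡ : σ₈ y ≡ 1ℤ + + 2 * b
    σ≡ = trans (l a b (σ₈ y)) (cong₂ (λ u v → u + v + + 2 * b) (orth c) e)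
      where
      l : ∀ a b s → s ≡ (1ℤ * a + s - + 3 * b) + (b - a) + + 2 * b
      l = solve-∀
    h≡ : half (σ₈ y) ≡ b
    h≡ = proj₁ (half-unique (σ₈ y) 1 b (ℕ.s≤s (ℕ.s≤s ℕ.z≤n)) (trans σ≡ (cong (_+_ 1ℤ) (ℤₚ.*-comm (+ 2) b))))
    norm' : y ∙ y ≡ m + σ₈ y - + 2
    norm' = trans (l a b (y ∙ y)) (trans (cong₂ (λ u v → u + v * (b + b - v)) (norm c) e)
      (trans (l₂ m b) (cong (λ t → m + t - + 2) (sym σ≡))))
      where
      l : ∀ a b q → q ≡ (a * a + q - b * b) + (b - a) * (b + b - (b - a))
      l = solve-∀
      l₂ : ∀ m b → m + 1ℤ * (b + b - 1ℤ) ≡ m + (1ℤ + + 2 * b) - + 2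
      l₂ = solve-∀

  0or1 : ∀ t → 0ℤ ≤ t → t < + 2 → t ≢ 0ℤ → t ≡ 1ℤ
  0or1 (+ 0) _ _ ne = contradiction refl ne
  0or1 (+ 1) _ _ _ = refl
  0or1 (+ suc (suc _)) _ (+<+ (ℕ.s≤s (ℕ.s≤s ()))) _

  diff≡1 : ∀ b a y → C₂ (b ∷ a ∷ y) → b - a ≢ 0ℤ → b - a ≡ 1ℤ
  diff≡1 b a y c = 0or1 (b - a) (subst (0ℤ ≤_) (⟪⟫-W b a y) (lo c)) (subst (_< + 2) (⟪⟫-W b a y) (hi c))

  T₂-bij : Bij C₂ [ EvenPart , OddPart ]
  T₂-bij = record { to = f ; from = g ; to-ok = λ {Y} → f-ok Y ; from-ok = λ {c} → g-ok c ; from∘to = λ {Y} → gf Y ; to∘from = λ {c} → fg c }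
    where
    f : V (suc (9 ℕ.+ n)) → V (8 ℕ.+ n) ⊎ V (8 ℕ.+ n)
    f (b ∷ a ∷ y) with b - a ℤₚ.≟ 0ℤ
    ... | yes _ = inj₁ y
    ... | no _  = inj₂ y
    -- Orthogonality reads `a + σ₈ y = 3b`; with `b − a` equal to 0 or 1, `b` is the half of `σ₈ y`
    -- rounded down in both cases.
    g : V (8 ℕ.+ n) ⊎ V (8 ℕ.+ n) → V (suc (9 ℕ.+ n))
    g (inj₁ y) = half (σ₈ y) ∷ half (σ₈ y) ∷ y
    g (inj₂ y) = half (σ₈ y) ∷ (half (σ₈ y) - 1ℤ) ∷ y
    f-ok : ∀ Y → C₂ Y → [ EvenPart , OddPart ] (f Y)
    f-ok (b ∷ a ∷ y) c with b - a ℤₚ.≟ 0ℤ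
    ... | yes e = proj₁ (case₀ b a y c e)
    ... | no ne = proj₁ (case₁ b a y c (diff≡1 b a y c ne))
    g-ok : ∀ c → [ EvenPart , OddPart ] c → C₂ (g c)
    g-ok (inj₁ y) (nm , ev) = cos (trans (cong (λ t → 1ℤ * h + t - + 3 * h) (even-half (σ₈ y) ev)) (l h))
        (trans (l₂ h (y ∙ y)) nm)
        (ℤₚ.≤-reflexive (sym v)) (subst (_< + 2) (sym v) (+<+ (ℕ.s≤s ℕ.z≤n)))
      where
      h = half (σ₈ y)
      v : ⟪ h ∷ h ∷ y , W₂ n ⟫ ≡ 0ℤ
      v = trans (⟪⟫-W h h y) (ℤₚ.+-inverseʳ h)
      l : ∀ h → 1ℤ * h + + 2 * h - + 3 * h ≡ 0ℤ
      l = solve-∀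
      l₂ : ∀ h q → h * h + q - h * h ≡ q
      l₂ = solve-∀
    g-ok (inj₂ y) (nm , od) = cos (trans (cong (λ t → 1ℤ * (h - 1ℤ) + t - + 3 * h) (odd-half (σ₈ y) od)) (l h))
        (trans (cong (λ t → (h - 1ℤ) * (h - 1ℤ) + t - h * h) (trans nm (cong (λ t → m + t - + 2) (odd-half (σ₈ y) od)))) (l₂ h m))
        (subst (0ℤ ≤_) (sym v) (+≤+ ℕ.z≤n)) (subst (_< + 2) (sym v) (+<+ (ℕ.s≤s (ℕ.s≤s ℕ.z≤n))))
      where
      h = half (σ₈ y)
      v : ⟪ h ∷ (h - 1ℤ) ∷ y , W₂ n ⟫ ≡ 1ℤ
      v = trans (⟪⟫-W h (h - 1ℤ) y) (l₃ h)
        where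
        l₃ : ∀ h → h - (h - 1ℤ) ≡ 1ℤ
        l₃ = solve-∀
      l : ∀ h → 1ℤ * (h - 1ℤ) + (1ℤ + + 2 * h) - + 3 * h ≡ 0ℤ
      l = solve-∀
      l₂ : ∀ h m → (h - 1ℤ) * (h - 1ℤ) + (m + (1ℤ + + 2 * h) - + 2) - h * h ≡ m
      l₂ = solve-∀
    gf : ∀ Y → C₂ Y → g (f Y) ≡ Y
    gf (b ∷ a ∷ y) c with b - a ℤₚ.≟ 0ℤ
    ... | yes e = let (_ , e₁ , e₂) = case₀ b a y c e in cong₂ (λ u v → u ∷ v ∷ y) e₁ e₂
    ... | no ne = let (_ , e₁ , e₂) = case₁ b a y c (diff≡1 b a y c ne) in cong₂ (λ u v → u ∷ v ∷ y) e₁ e₂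
    fg : ∀ c → [ EvenPart , OddPart ] c → f (g c) ≡ c
    fg (inj₁ y) _ with half (σ₈ y) - half (σ₈ y) ℤₚ.≟ 0ℤ
    ... | yes _ = refl
    ... | no ne = contradiction (ℤₚ.+-inverseʳ (half (σ₈ y))) ne
    fg (inj₂ y) _ with half (σ₈ y) - (half (σ₈ y) - 1ℤ) ℤₚ.≟ 0ℤ
    ... | yes e = contradiction (trans (sym (l (half (σ₈ y)))) e) λ ()
      where
      l : ∀ h → h - (h - 1ℤ) ≡ 1ℤ
      l = solve-∀
    ... | no _ = refl

  -- The two lattices share the integral vectors with even `σ₈`. What differs are the half-integral
  -- vectors on one side and the integral ones with odd `σ₈` on the other, and both counts are
  -- divisible by 16.
  T₂-card : (F : Finite C₂) → + 16 ∣ₛ card F - r (8 ℕ.+ n) m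
  T₂-card F = subst (+ 16 ∣ₛ_) (sym diff) (∣m∣n⇒∣m-n halfPart oddPart)
    where
    FN = finite-norm (8 ℕ.+ n) m
    FE : Finite EvenPart
    FE = finite-filter (λ y → even? (σ₈ y)) FN
    FO₁ = finite-filter (λ y → ¬? (even? (σ₈ y))) FN
    FO : Finite OddPart
    FO = finite-inj₂ 𝟘 (finite-transport T₂-bij F)
    l : ∀ e o o' → (e + o) - (e + o') ≡ o - o'
    l = solve-∀
    diff : card F - r (8 ℕ.+ n) m ≡ card FO - card FO₁
    diff = trans (cong₂ _-_ (trans (card-bij F (finite-⊎ FE FO) T₂-bij) (card-⊎ FE FO)) (card-split (λ y → even? (σ₈ y)) FN)) (l (card FE) (card FO) (card FO₁))
    β₁ : Bij (λ y → Norm m y × ¬ Even (σ₈ y)) (OddNorm {n} m)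
    β₁ = oct-bij (λ {c} (e , o) → trans (oct-norm c) e , subst (λ t → ¬ Even t) (sym (oct-sum c)) o)
                 (λ {c} (e , o) → trans (sym (oct-norm c)) e , subst (λ t → ¬ Even t) (oct-sum c) o)
    β₂ : Bij OddPart (HalfNorm {n} m)
    β₂ = oct-bij (λ {c} (e , o) → trans (oct-norm c) (trans e (cong (λ t → m + t - + 2) (sym (oct-sum c)))) , subst (λ t → ¬ Even t) (sym (oct-sum c)) o)
                 (λ {c} (e , o) → trans (sym (oct-norm c)) (trans e (cong (λ t → m + t - + 2) (oct-sum c))) , subst (λ t → ¬ Even t) (oct-sum c) o)
    oddPart : + 16 ∣ₛ card FO₁
    oddPart = subst (+ 16 ∣ₛ_) (sym (card-bij FO₁ (finite-transport β₁ FO₁) β₁)) (card-oddNorm m (finite-transport β₁ FO₁))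
    halfPart : + 16 ∣ₛ card FO
    halfPart = subst (+ 16 ∣ₛ_) (sym (card-bij FO (finite-transport β₂ FO) β₂)) (card-halfNorm m (finite-transport β₂ FO))

-- Signed permutations and supports

act-· : ∀ {n} (p : SP n) t x → act p (t · x) ≡ t · act p x
act-· idp t x = refl
act-· (prep p) t (a ∷ x) = cong (t * a ∷_) (act-· p t x)
act-· swp t (a ∷ b ∷ x) = refl
act-· negate t (a ∷ x) = cong (_∷ t · x) (ℤₚ.neg-distribʳ-* t a)
act-· (p ⨾ q) t x = trans (cong (act q) (act-· p t x)) (act-· q t (act p x))

nz : ∀ {n} → V n → ℕ
nz [] = 0
nz (+ 0 ∷ x) = nz x
nz (_ ∷ x) = suc (nz x)

nz-act : ∀ {n} (p : SP n) x → nz (act p x) ≡ nz x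
nz-act idp x = refl
nz-act (prep p) (+ 0 ∷ x) = nz-act p x
nz-act (prep p) (+ suc _ ∷ x) = cong suc (nz-act p x)
nz-act (prep p) (-[1+ _ ] ∷ x) = cong suc (nz-act p x)
nz-act swp (+ 0 ∷ + 0 ∷ x) = refl
nz-act swp (+ 0 ∷ + suc _ ∷ x) = refl
nz-act swp (+ 0 ∷ -[1+ _ ] ∷ x) = refl
nz-act swp (+ suc _ ∷ + 0 ∷ x) = refl
nz-act swp (+ suc _ ∷ + suc _ ∷ x) = refl
nz-act swp (+ suc _ ∷ -[1+ _ ] ∷ x) = refl
nz-act swp (-[1+ _ ] ∷ + 0 ∷ x) = refl
nz-act swp (-[1+ _ ] ∷ + suc _ ∷ x) = refl
nz-act swp (-[1+ _ ] ∷ -[1+ _ ] ∷ x) = refl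
nz-act negate (+ 0 ∷ x) = refl
nz-act negate (+ suc _ ∷ x) = refl
nz-act negate (-[1+ _ ] ∷ x) = refl
nz-act (p ⨾ q) x = trans (nz-act q (act p x)) (nz-act p x)

Below0⇒𝟘 : ∀ {n} (u : Vec ℕ n) → Below 0 u → ι u ≡ 𝟘
Below0⇒𝟘 [] _ = refl
Below0⇒𝟘 (zero ∷ u) (_ , b) = cong (0ℤ ∷_) (Below0⇒𝟘 u b)

nz0⇒𝟘 : ∀ {n} (u : Vec ℕ n) → nz (ι u) ≡ 0 → ι u ≡ 𝟘
nz0⇒𝟘 [] _ = refl
nz0⇒𝟘 (zero ∷ u) e = cong (0ℤ ∷_) (nz0⇒𝟘 u e)

𝟘-++ : ∀ m {n} → 𝟘 {m ℕ.+ n} ≡ 𝟘 {m} Vec.++ 𝟘 {n}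
𝟘-++ zero = refl
𝟘-++ (suc m) = cong (0ℤ ∷_) (𝟘-++ m)

sorted-support : ∀ a {b} (u : Vec ℕ (a ℕ.+ b)) → Sorted u → nz (ι u) ℕ.≤ a → ∃ λ (x : V a) → ι u ≡ x Vec.++ 𝟘 {b}
sorted-support zero u _ le = [] , nz0⇒𝟘 u (ℕₚ.n≤0⇒n≡0 le)
sorted-support (suc a) (zero ∷ u) (b , _) _ = 𝟘 , cong (0ℤ ∷_) (trans (Below0⇒𝟘 u b) (𝟘-++ a))
sorted-support (suc a) (suc c ∷ u) (_ , s) (ℕ.s≤s le) = let (x , e) = sorted-support a u s le in + suc c ∷ x , cong (+ suc c ∷_) e

compress : ∀ a {b} (z : V (a ℕ.+ b)) → nz z ℕ.≤ a → ∃ λ (p : SP (a ℕ.+ b)) → ∃ λ (x : V a) → act p z ≡ x Vec.++ 𝟘 {b}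
compress a z le with sortAbs z
... | p , u , e , s = let (x , e') = sorted-support a u s (subst (ℕ._≤ a) (trans (sym (nz-act p z)) (cong nz e)) le) in p , x , trans e e'

2^-+ : ∀ a c → 2^ (a ℕ.+ c) ≡ 2^ a * 2^ c
2^-+ zero c = sym (ℤₚ.*-identityˡ (2^ c))
2^-+ (suc a) c = trans (cong (+ 2 *_) (2^-+ a c)) (sym (ℤₚ.*-assoc (+ 2) (2^ a) (2^ c)))

2^-∣ : ∀ a c d {x} → 2^ a ∣ₛ x → 2^ (c ℕ.+ a) ∣ₛ 2^ (d ℕ.+ c) * x
2^-∣ a c d (divides q e) = divides (2^ d * q) (trans (cong₂ _*_ (2^-+ d c) e) (trans (l (2^ d) (2^ c) q (2^ a)) (cong (2^ d * q *_) (sym (2^-+ c a)))))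
  where
  l : ∀ d c q a → d * c * (q * a) ≡ d * q * (c * a)
  l = solve-∀

card-empty : ∀ {A : Set} {P : A → Set} (F : Finite P) → (∀ a → ¬ P a) → card F ≡ 0ℤ
card-empty F np = trans (∑-cong∈ (elems F) (λ {a} m → contradiction (sound F m) (np a))) (∑-0 (elems F))

⟦¬⟧ : ∀ {P : Set} (d : Dec P) → ⟦ ¬? d ⟧ ≡ 1ℤ - ⟦ d ⟧
⟦¬⟧ (yes _) = refl
⟦¬⟧ (no _)  = refl

pbarFrac-∣ : ∀ d .{{_ : ℕ.NonZero d}} n → pbarFrac (n ℕ.* d) d ≡ pbar n
pbarFrac-∣ (suc d) n rewrite ℕD.m*n%n≡0 n (suc d) {{_}} | ℕD.m*n/n≡m n (suc d) {{_}} = refl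

pbarFrac-∤ : ∀ d .{{_ : ℕ.NonZero d}} n → ¬ d ℕ∣.∣ n → pbarFrac n d ≡ 0
pbarFrac-∤ (suc d) n nd with n ℕ.% suc d in eq
... | zero = contradiction (ℕ∣.m%n≡0⇒n∣m n (suc d) eq) nd
... | suc _ = refl

sg-even : ∀ a → sg (a ℕ.+ a) ≡ 1ℤ
sg-even a = trans (sg-+ a a) (sg*sg a)

^-*-distrib : ∀ a b j → (a * b) ^ᶻ j ≡ a ^ᶻ j * b ^ᶻ j
^-*-distrib a b zero = refl
^-*-distrib a b (suc j) = trans (cong (a * b *_) (^-*-distrib a b j)) (l a b (a ^ᶻ j) (b ^ᶻ j))
  where
  l : ∀ a b x y → a * b * (x * y) ≡ a * x * (b * y)
  l = solve-∀

^-odd : ∀ e → e * e ≡ 1ℤ → ∀ i → e ^ᶻ suc (i ℕ.+ i) ≡ e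
^-odd e ee zero = ℤₚ.*-identityʳ e
^-odd e ee (suc i) = trans (cong (λ t → e ^ᶻ suc (suc t)) (ℕₚ.+-suc i i)) (trans (sym (ℤₚ.*-assoc e e _)) (trans (cong (_* e ^ᶻ suc (i ℕ.+ i)) ee) (trans (ℤₚ.*-identityˡ _) (^-odd e ee i))))

-- `L²` times the Hecke relation, with `L² pw` replaced by 1 and `L² ew` by `Lχ`. The cross term
-- `LχR₀` vanishes, and the common sign `s` of all three overpartition numbers cancels because
-- `s² = 1`.
combine : ∀ q L R₂ R R₀ s p₂ p p₀ χ pw ew → s * s ≡ 1ℤ →
  q ∣ₛ L * (R₂ - R) - (pw - ew) * (R - R₀) → q ∣ₛ R₂ - s * p₂ → q ∣ₛ R - s * p → q ∣ₛ R₀ - s * p₀ →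
  q ∣ₛ L * L * pw - 1ℤ → q ∣ₛ L * L * ew - L * χ → χ * R₀ ≡ 0ℤ →
  q ∣ₛ (L * L * L * p₂ + χ * L * p + p₀) - (L * L * L + 1ℤ) * p
combine q L R₂ R R₀ s p₂ p p₀ χ pw ew ss H a₂ a a₀ b₁ b₂ c = subst (q ∣ₛ_) (eq₂ target) (∣n⇒∣m*n s sT)
  where
  target = (L * L * L * p₂ + χ * L * p + p₀) - (L * L * L + 1ℤ) * p
  eq₂ : ∀ t → s * (s * t) ≡ t
  eq₂ t = trans (sym (ℤₚ.*-assoc s s t)) (trans (cong (_* t) ss) (ℤₚ.*-identityˡ t))
  main : q ∣ₛ (L * L * L * R₂ + χ * L * R + R₀) - (L * L * L + 1ℤ) * R
  main = subst (q ∣ₛ_) (trans (sym (ℤₚ.+-identityʳ _)) (trans (cong (λ t → L * L * (L * (R₂ - R) - (pw - ew) * (R - R₀)) + (L * L * pw - 1ℤ) * (R - R₀) - (L * L * ew - L * χ) * (R - R₀) + t) (sym (trans (cong (L *_) c) (ℤₚ.*-zeroʳ L)))) (l L R₂ R R₀ χ pw ew)))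
    (∣m∣n⇒∣m-n (∣m∣n⇒∣m+n (∣n⇒∣m*n (L * L) H) (∣m⇒∣m*n (R - R₀) b₁)) (∣m⇒∣m*n (R - R₀) b₂))
    where
    l : ∀ L R₂ R R₀ χ pw ew → L * L * (L * (R₂ - R) - (pw - ew) * (R - R₀)) + (L * L * pw - 1ℤ) * (R - R₀) - (L * L * ew - L * χ) * (R - R₀) + L * (χ * R₀)
        ≡ (L * L * L * R₂ + χ * L * R + R₀) - (L * L * L + 1ℤ) * R
    l = solve-∀
  sT : q ∣ₛ s * target
  sT = subst (q ∣ₛ_) (l L R₂ R R₀ s p₂ p p₀ χ) (∣m∣n⇒∣m+n (∣m∣n⇒∣m-n (∣m∣n⇒∣m-n (∣m∣n⇒∣m-n main (∣n⇒∣m*n (L * L * L) a₂)) (∣n⇒∣m*n (χ * L) a)) a₀) (∣n⇒∣m*n (L * L * L + 1ℤ) a))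
    where
    l : ∀ L R₂ R R₀ s p₂ p p₀ χ → (((L * L * L * R₂ + χ * L * R + R₀) - (L * L * L + 1ℤ) * R) - L * L * L * (R₂ - s * p₂) - χ * L * (R - s * p) - (R₀ - s * p₀)) + (L * L * L + 1ℤ) * (R - s * p)
        ≡ s * ((L * L * L * p₂ + χ * L * p + p₀) - (L * L * L + 1ℤ) * p)
    l = solve-∀

-- Arithmetic modulo an odd prime ℓ = 2h + 1

module Modℓ (h : ℕ) (prime : Prime (suc (h ℕ.+ h))) where

  ℓ : ℕ
  ℓ = suc (h ℕ.+ h)

  L : ℤ
  L = + ℓ

  L≡1+2h : L ≡ 1ℤ + + 2 * + h
  L≡1+2h = trans (ℤₚ.pos-+ 1 (h ℕ.+ h)) (cong (_+_ 1ℤ) (trans (ℤₚ.pos-+ h h) (dbl (+ h))))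
    where
    dbl : ∀ a → a + a ≡ + 2 * a
    dbl = solve-∀

  euclid : ∀ a b → L ∣ₛ a * b → L ∣ₛ a ⊎ L ∣ₛ b
  euclid a b d with euclidsLemma ∣ a ∣ ∣ b ∣ prime (subst (ℓ ℕ∣.∣_) (ℤₚ.abs-* a b) (∣⇒∣ᵤ d))
  ... | inj₁ p = inj₁ (∣ᵤ⇒∣ p)
  ... | inj₂ p = inj₂ (∣ᵤ⇒∣ p)

  small-unit : ∀ s → ∣ s ∣ ℕ.≤ h → L ∣ₛ s → s ≡ 0ℤ
  small-unit s s≤h d with ∣ s ∣ in eq | ∣⇒∣ᵤ d
  ... | zero  | _ = ℤₚ.∣i∣≡0⇒i≡0 eq
  ... | suc k | p = contradiction (ℕₚ.≤-trans (ℕ∣.∣⇒≤ p) s≤h) (ℕₚ.<⇒≱ (ℕ.s≤s (ℕₚ.m≤m+n h h)))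

  L∤2 : ¬ L ∣ₛ + 2
  L∤2 d = ℓ≢1 (ℓ∣1 d)
    where
    ℓ≢1 : ℓ ≢ 1
    ℓ≢1 e = ¬prime[1] (subst Prime e prime)
    ℓ∣1 : L ∣ₛ + 2 → ℓ ≡ 1
    ℓ∣1 d = ℕ∣.∣1⇒≡1 (∣⇒∣ᵤ (subst (L ∣ₛ_) (trans (cong (_- + 2 * + h) L≡1+2h) (l (+ h))) (∣m∣n⇒∣m-n (∣-refl {L}) (∣m⇒∣m*n (+ h) d))))
      where
      l : ∀ h → (1ℤ + + 2 * h) - + 2 * h ≡ 1ℤ
      l = solve-∀

  cancel-2s : ∀ s t → ∣ s ∣ ℕ.≤ h → s ≢ 0ℤ → L ∣ₛ s * (+ 2 * t) → L ∣ₛ t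
  cancel-2s s t s≤h s≢0 d =
    [ (λ d₁ → contradiction (small-unit s s≤h d₁) s≢0) , (λ d₁ → [ (λ d₂ → contradiction d₂ L∤2) , id ] (euclid (+ 2) t d₁)) ] (euclid s (+ 2 * t) d)

  divL : ℤ → ℤ
  divL t = t /ℕ ℓ

  divL-unique : ∀ a → divL (a * L) ≡ a
  divL-unique a = proj₁ (divmod-unique ℓ (a * L) 0 a (ℕ.s≤s ℕ.z≤n) (sym (ℤₚ.+-identityˡ (a * L))))

  divL-∣ : ∀ t → L ∣ₛ t → divL t * L ≡ t
  divL-∣ t (divides q e) = trans (cong (λ u → divL u * L) e) (trans (cong (_* L) (divL-unique q)) (sym e))

  divV : ∀ {n} → V n → V n
  divV [] = []
  divV (a ∷ v) = divL a ∷ divV v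

  infix 4 _≋_ _≋?_
  _≋_ : ∀ {n} → V n → V n → Set
  [] ≋ [] = ⊤
  (a ∷ x) ≋ (b ∷ y) = L ∣ₛ a - b × x ≋ y

  _≋?_ : ∀ {n} (x y : V n) → Dec (x ≋ y)
  [] ≋? [] = yes tt
  (a ∷ x) ≋? (b ∷ y) = (L ∣ₛ? (a - b)) ×-dec (x ≋? y)

  ≋-shift : ∀ {n} s (v x : V n) → L · v ⊕ s · x ≋ s · x
  ≋-shift s [] [] = tt
  ≋-shift s (a ∷ v) (b ∷ x) = divides a (l L a s b) , ≋-shift s v x
    where
    l : ∀ L a s b → (L * a + s * b) - s * b ≡ a * L
    l = solve-∀

  divV-shift : ∀ {n} s (v x : V n) → divV (L · v ⊕ s · x ⊕ (- s) · x) ≡ v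
  divV-shift s [] [] = refl
  divV-shift s (a ∷ v) (b ∷ x) = cong₂ _∷_ (trans (cong divL (l L a s b)) (divL-unique a)) (divV-shift s v x)
    where
    l : ∀ L a s b → (L * a + s * b) + (- s) * b ≡ a * L
    l = solve-∀

  shift-divV : ∀ {n} s (w x : V n) → w ≋ s · x → L · divV (w ⊕ (- s) · x) ⊕ s · x ≡ w
  shift-divV s [] [] _ = refl
  shift-divV s (a ∷ w) (b ∷ x) (d , c) = cong₂ _∷_
    (trans (cong (_+ s * b) (trans (ℤₚ.*-comm L (divL (a + (- s) * b))) (divL-∣ (a + (- s) * b) (subst (L ∣ₛ_) (l a s b) d)))) (l₂ a s b)) (shift-divV s w x c)
    where
    l : ∀ a s b → a - s * b ≡ a + (- s) * b
    l = solve-∀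
    l₂ : ∀ a s b → a + (- s) * b + s * b ≡ a
    l₂ = solve-∀

  norm-shift : ∀ {k} s (v x : V k) → (L · v ⊕ s · x) ∙ (L · v ⊕ s · x) ≡ L * L * (v ∙ v) + + 2 * (L * s * (v ∙ x)) + s * s * (x ∙ x)
  norm-shift s v x = trans (∙-⊕ˡ (L · v ⊕ s · x) (L · v) (s · x)) (trans (cong₂ _+_
      (trans (∙-⊕ʳ (L · v) (L · v) (s · x)) (cong₂ _+_ (trans (∙-·ˡ L (L · v) v) (cong (L *_) (∙-·ʳ L v v))) (trans (∙-·ˡ L (s · x) v) (cong (L *_) (∙-·ʳ s v x)))))
      (trans (∙-⊕ʳ (s · x) (L · v) (s · x)) (cong₂ _+_ (trans (∙-·ˡ s (L · v) x) (cong (s *_) (trans (∙-·ʳ L x v) (cong (L *_) (∙-comm x v))))) (trans (∙-·ˡ s (s · x) x) (cong (s *_) (∙-·ʳ s x x))))))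
    (l L s (v ∙ v) (v ∙ x) (x ∙ x)))
    where
    l : ∀ L s a b c → L * (L * a) + L * (s * b) + (s * (L * b) + s * (s * c)) ≡ L * L * a + + 2 * (L * s * b) + s * s * c
    l = solve-∀

  -- x spans an isotropic line mod ℓ, and X^⊥/X for the null vector X = (p + ℓ; p, x) is the
  -- ℓ-neighbour of ℤ^k along that line.
  module Neighbour {k : ℕ} (x : V k) (p : ℤ) (xx : x ∙ x ≡ L * (p + p + L)) (m : ℤ) where

    X W : V (suc (suc k))
    X = (p + L) ∷ p ∷ x
    W = -1ℤ ∷ -1ℤ ∷ 𝟘

    -- Here `⟪ X , W ⟫ = ℓ`, and the window makes `s = a − b` run through the balanced residues from
    -- `−h` to `h`.
    C : V (suc (suc k)) → Set
    C = Cos X W (- (+ h)) ℓ m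

    Perp : V k → Set
    Perp v = Norm m v × L ∣ₛ v ∙ x

    -- The class of `(b; a, v)` with `s = a − b ≠ 0` corresponds, after scaling by `ℓ`, to
    -- `w = ℓv + sx` of norm `ℓ²m`: the part of the neighbour besides `Perp`.
    Mult : ℤ × V k → Set
    Mult (s , w) = (∣ s ∣ ℕ.≤ h × s ≢ 0ℤ) × (Norm (L * L * m) w × w ≋ s · x)

    orth≡ : ∀ b a v → ⟪ X , b ∷ a ∷ v ⟫ ≡ v ∙ x - L * a + (p + L) * (a - b)
    orth≡ b a v = trans (cong (λ t → p * a + t - (p + L) * b) (∙-comm x v)) (l p L a b (v ∙ x))
      where
      l : ∀ p L a b t → p * a + t - (p + L) * b ≡ t - L * a + (p + L) * (a - b)
      l = solve-∀

    win : ∀ s → - (+ h) ≤ - s → - s < - (+ h) + L → ∣ s ∣ ℕ.≤ h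
    win s lo hi = bound s (subst₂ _≤_ (ℤₚ.neg-involutive s) (ℤₚ.neg-involutive (+ h)) (ℤₚ.neg-mono-≤ lo)) (subst (- s <_) eq hi)
      where
      eq : - (+ h) + L ≡ 1ℤ + + h
      eq = trans (cong (_+_ (- (+ h))) L≡1+2h) (l (+ h))
        where
        l : ∀ h → - h + (1ℤ + + 2 * h) ≡ 1ℤ + h
        l = solve-∀
      bound : ∀ s → s ≤ + h → - s < 1ℤ + + h → ∣ s ∣ ℕ.≤ h
      bound (+ n) (+≤+ q) _ = q
      bound -[1+ n ] _ (+<+ (ℕ.s≤s q)) = q

    win⁻ : ∀ s → ∣ s ∣ ℕ.≤ h → - (+ h) ≤ - s × - s < - (+ h) + L
    win⁻ s q = ℤₚ.neg-mono-≤ (upper s q) , subst (- s <_) (sym eq) (ℤₚ.≤-<-trans (upper (- s) (subst (ℕ._≤ h) (sym (ℤₚ.∣-i∣≡∣i∣ s)) q)) (+<+ (ℕₚ.n<1+n h)))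
      where
      eq : - (+ h) + L ≡ 1ℤ + + h
      eq = trans (cong (_+_ (- (+ h))) L≡1+2h) (l (+ h))
        where
        l : ∀ h → - h + (1ℤ + + 2 * h) ≡ 1ℤ + h
        l = solve-∀
      upper : ∀ s → ∣ s ∣ ℕ.≤ h → s ≤ + h
      upper (+ n) q = +≤+ q
      upper -[1+ n ] q = -≤+

    neg-diff : ∀ a b → b - a ≡ - (a - b)
    neg-diff = solve-∀

    to-perp : ∀ b a v → C (b ∷ a ∷ v) → a - b ≡ 0ℤ → Perp v × divL (v ∙ x) ≡ a × a ≡ b
    to-perp b a v c e = (trans (l a b (v ∙ v)) (trans (cong₂ (λ u t → u - t * (a + b)) (norm c) e) (l₂ m)) , divides a vx) , trans (cong divL vx) (divL-unique a) , ℤₚ.i-j≡0⇒i≡j a b e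
      where
      l : ∀ a b q → q ≡ (a * a + q - b * b) - (a - b) * (a + b)
      l = solve-∀
      l₂ : ∀ m → m - 0ℤ ≡ m
      l₂ = solve-∀
      vx : v ∙ x ≡ a * L
      vx = trans (l₃ (v ∙ x) L a (p + L) (a - b)) (trans (cong₂ (λ u t → u - (p + L) * t + a * L) (trans (sym (orth≡ b a v)) (orth c)) e) (l₄ (p + L) (a * L)))
        where
        l₃ : ∀ t L a q s → t ≡ (t - L * a + q * s) - q * s + a * L
        l₃ = solve-∀
        l₄ : ∀ q t → 0ℤ - q * 0ℤ + t ≡ t
        l₄ = solve-∀

    vx≡ : ∀ b a v → C (b ∷ a ∷ v) → v ∙ x + (p + L) * (a - b) ≡ a * L
    vx≡ b a v c = trans (l (v ∙ x) L a ((p + L) * (a - b))) (trans (cong (_+ a * L) (trans (sym (orth≡ b a v)) (orth c))) (ℤₚ.+-identityˡ _))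
      where
      l : ∀ t L a s → t + s ≡ (t - L * a + s) + a * L
      l = solve-∀

    to-mult : ∀ b a v → C (b ∷ a ∷ v) → a - b ≢ 0ℤ → Mult (a - b , L · v ⊕ (a - b) · x)
    to-mult b a v c ne = (win s (subst (- (+ h) ≤_) (trans (⟪⟫-W b a v) (neg-diff a b)) (lo c)) (subst (_< - (+ h) + L) (trans (⟪⟫-W b a v) (neg-diff a b)) (hi c)) , ne)
      , (nm , ≋-shift s v x)
      where
      s = a - b
      nm : (L · v ⊕ s · x) ∙ (L · v ⊕ s · x) ≡ L * L * m
      nm = trans (norm-shift s v x) (trans (cong₂ (λ t u → L * L * (v ∙ v) + + 2 * (L * s * t) + s * s * u) vx xx)
        (trans (l L p s a (v ∙ v)) (cong (λ t → L * L * t) (trans (l₂ a b (v ∙ v)) (norm c)))))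
        where
        vx : v ∙ x ≡ a * L - (p + L) * s
        vx = trans (l₃ (v ∙ x) ((p + L) * s)) (cong (_- (p + L) * s) (vx≡ b a v c))
          where
          l₃ : ∀ t u → t ≡ t + u - u
          l₃ = solve-∀
        l : ∀ L p s a q → L * L * q + + 2 * (L * s * (a * L - (p + L) * s)) + s * s * (L * (p + p + L)) ≡ L * L * (q + + 2 * (a * s) - s * s)
        l = solve-∀
        l₂ : ∀ a b q → q + + 2 * (a * (a - b)) - (a - b) * (a - b) ≡ a * a + q - b * b
        l₂ = solve-∀

    -- Expanding `|ℓv + sx|² = ℓ²m` and dividing by `ℓ` shows that `ℓ` divides
    -- `2s(v ∙ x + (p + ℓ)s)`. As `ℓ` divides neither 2 nor `s`, the coordinate `a` is an integer,
    -- and a second division by `ℓ` gives the norm.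
    integral : ∀ s w → Mult (s , w) → let v = divV (w ⊕ (- s) · x) in L ∣ₛ v ∙ x + (p + L) * s × v ∙ v + + 2 * (divL (v ∙ x + (p + L) * s) * s) - s * s ≡ m
    integral s w ((s≤h , s≢0) , (nm , c)) = d₃ , sym mm
      where
      v = divV (w ⊕ (- s) · x)
      t = v ∙ x + (p + L) * s
      eq : L * L * m ≡ L * L * (v ∙ v) + + 2 * (L * s * (v ∙ x)) + s * s * (L * (p + p + L))
      eq = trans (sym nm) (trans (cong (λ u → u ∙ u) (sym (shift-divV s w x c))) (trans (norm-shift s v x)
        (cong (λ u → L * L * (v ∙ v) + + 2 * (L * s * (v ∙ x)) + s * s * u) xx)))
      eq₂ : L * m ≡ L * (v ∙ v) + + 2 * (s * (v ∙ x)) + s * s * (p + p + L)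
      eq₂ = ℤₚ.*-cancelˡ-≡ L _ _ (trans (sym (ℤₚ.*-assoc L L m)) (trans eq (l L s (v ∙ v) (v ∙ x) p)))
        where
        l : ∀ L s q u p → L * L * q + + 2 * (L * s * u) + s * s * (L * (p + p + L)) ≡ L * (L * q + + 2 * (s * u) + s * s * (p + p + L))
        l = solve-∀
      d₁ : L ∣ₛ s * (+ 2 * t)
      d₁ = divides (m - v ∙ v + s * s) (trans (l s (v ∙ x) p L (v ∙ v)) (trans (cong (λ u → u - L * (v ∙ v) + s * s * L) (sym eq₂)) (l₂ L m (v ∙ v) s)))
        where
        l : ∀ s u p L q → s * (+ 2 * (u + (p + L) * s)) ≡ (L * q + + 2 * (s * u) + s * s * (p + p + L)) - L * q + s * s * L
        l = solve-∀
        l₂ : ∀ L m q s → L * m - L * q + s * s * L ≡ (m - q + s * s) * L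
        l₂ = solve-∀
      d₃ : L ∣ₛ t
      d₃ = cancel-2s s t s≤h s≢0 d₁
      a = divL t
      mm : m ≡ v ∙ v + + 2 * (a * s) - s * s
      mm = ℤₚ.*-cancelˡ-≡ L _ _ (trans eq₂ (trans (l s (v ∙ x) p L (v ∙ v)) (trans (cong (λ u → L * (v ∙ v) + + 2 * (s * u) - s * s * L) (sym (divL-∣ t d₃))) (l₂ L (v ∙ v) a s))))
        where
        l : ∀ s u p L q → L * q + + 2 * (s * u) + s * s * (p + p + L) ≡ L * q + + 2 * (s * (u + (p + L) * s)) - s * s * L
        l = solve-∀
        l₂ : ∀ L q a s → L * q + + 2 * (s * (a * L)) - s * s * L ≡ L * (q + + 2 * (a * s) - s * s)
        l₂ = solve-∀

    neighbour-bij : Bij C [ Perp , Mult ]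
    neighbour-bij = record { to = f ; from = g ; to-ok = λ {Y} → f-ok Y ; from-ok = λ {c} → g-ok c ; from∘to = λ {Y} → gf Y ; to∘from = λ {c} → fg c }
      where
      f : V (suc (suc k)) → V k ⊎ (ℤ × V k)
      f (b ∷ a ∷ v) with a - b ℤₚ.≟ 0ℤ
      ... | yes _ = inj₁ v
      ... | no _  = inj₂ (a - b , L · v ⊕ (a - b) · x)
      g : V k ⊎ (ℤ × V k) → V (suc (suc k))
      g (inj₁ v) = divL (v ∙ x) ∷ divL (v ∙ x) ∷ v
      -- `a` is the solution of the orthogonality relation `ℓa = v ∙ x + (p + ℓ)s`.
      g (inj₂ (s , w)) = let v = divV (w ⊕ (- s) · x) ; a = divL (v ∙ x + (p + L) * s) in (a - s) ∷ a ∷ v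
      f-ok : ∀ Y → C Y → [ Perp , Mult ] (f Y)
      f-ok (b ∷ a ∷ v) c with a - b ℤₚ.≟ 0ℤ
      ... | yes e = proj₁ (to-perp b a v c e)
      ... | no ne = to-mult b a v c ne
      a-[a-s] : ∀ a s → a - (a - s) ≡ s
      a-[a-s] = solve-∀
      g-ok : ∀ c → [ Perp , Mult ] c → C (g c)
      g-ok (inj₁ v) (nm , d) = cos (trans (orth≡ a a v) (trans (cong (λ t → t - L * a + (p + L) * (a - a)) (sym (divL-∣ (v ∙ x) d))) (l a L (p + L)))) (trans (l₂ a (v ∙ v)) nm)
          (subst (- (+ h) ≤_) (sym (trans (⟪⟫-W a a v) (ℤₚ.+-inverseʳ a))) (proj₁ (win⁻ 0ℤ ℕ.z≤n))) (subst (_< - (+ h) + L) (sym (trans (⟪⟫-W a a v) (ℤₚ.+-inverseʳ a))) (proj₂ (win⁻ 0ℤ ℕ.z≤n)))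
        where
        a = divL (v ∙ x)
        l : ∀ a L q → a * L - L * a + q * (a - a) ≡ 0ℤ
        l = solve-∀
        l₂ : ∀ a q → a * a + q - a * a ≡ q
        l₂ = solve-∀
      g-ok (inj₂ (s , w)) M@((s≤h , _) , _) = cos
          (trans (orth≡ (a - s) a v) (trans (l (v ∙ x) L a (p + L) s) (trans (cong (_- L * a) (sym (divL-∣ _ (proj₁ I)))) (l₂ a L))))
          (trans (l₃ a s (v ∙ v)) (proj₂ I))
          (subst (- (+ h) ≤_) (sym (trans (⟪⟫-W (a - s) a v) (l₄ a s))) (proj₁ (win⁻ s s≤h)))
          (subst (_< - (+ h) + L) (sym (trans (⟪⟫-W (a - s) a v) (l₄ a s))) (proj₂ (win⁻ s s≤h)))
        where
        v = divV (w ⊕ (- s) · x)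
        I = integral s w M
        a = divL (v ∙ x + (p + L) * s)
        l : ∀ t L a q s → t - L * a + q * (a - (a - s)) ≡ (t + q * s) - L * a
        l = solve-∀
        l₂ : ∀ a L → a * L - L * a ≡ 0ℤ
        l₂ = solve-∀
        l₃ : ∀ a s q → a * a + q - (a - s) * (a - s) ≡ q + + 2 * (a * s) - s * s
        l₃ = solve-∀
        l₄ : ∀ a s → (a - s) - a ≡ - s
        l₄ = solve-∀
      gf : ∀ Y → C Y → g (f Y) ≡ Y
      gf (b ∷ a ∷ v) c with a - b ℤₚ.≟ 0ℤ
      ... | yes e = let (_ , e₁ , e₂) = to-perp b a v c e in cong₂ (λ u t → u ∷ t ∷ v) (trans e₁ e₂) e₁
      ... | no ne = trans (cong (λ u → (divL (u ∙ x + (p + L) * (a - b)) - (a - b)) ∷ divL (u ∙ x + (p + L) * (a - b)) ∷ u) (divV-shift (a - b) v x))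
                          (cong₂ (λ u t → u ∷ t ∷ v) (trans (cong (_- (a - b)) a≡) (a-[a-s] a b)) a≡)
        where
        a≡ : divL (v ∙ x + (p + L) * (a - b)) ≡ a
        a≡ = trans (cong divL (vx≡ b a v c)) (divL-unique a)
      fg : ∀ c → [ Perp , Mult ] c → f (g c) ≡ c
      fg (inj₁ v) _ with divL (v ∙ x) - divL (v ∙ x) ℤₚ.≟ 0ℤ
      ... | yes _ = refl
      ... | no ne = contradiction (ℤₚ.+-inverseʳ (divL (v ∙ x))) ne
      fg (inj₂ (s , w)) ((_ , s≢0) , (_ , c)) with divL (divV (w ⊕ (- s) · x) ∙ x + (p + L) * s) - (divL (divV (w ⊕ (- s) · x) ∙ x + (p + L) * s) - s) ℤₚ.≟ 0ℤ
      ... | yes e = contradiction (trans (sym (a-[a-s] (divL (divV (w ⊕ (- s) · x) ∙ x + (p + L) * s)) s)) e) s≢0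
      ... | no _ = cong inj₂ (trans (cong (λ u → u , L · divV (w ⊕ (- s) · x) ⊕ u · x) (a-[a-s] (divL (divV (w ⊕ (- s) · x) ∙ x + (p + L) * s)) s))
                                    (cong (s ,_) (shift-divV s w x c)))

  -- Neighbours of ℤ^k

  ≋-act : ∀ {n} (p : SP n) {x y} → x ≋ y → act p x ≋ act p y
  ≋-act idp c = c
  ≋-act (prep p) {_ ∷ _} {_ ∷ _} (d , c) = d , ≋-act p c
  ≋-act swp {_ ∷ _ ∷ _} {_ ∷ _ ∷ _} (d , d' , c) = d' , d , c
  ≋-act negate {a ∷ _} {b ∷ _} (d , c) = subst (L ∣ₛ_) (l a b) (∣m⇒∣-m d) , c
    where
    l : ∀ a b → - (a - b) ≡ - a - - b
    l = solve-∀
  ≋-act (p ⨾ q) c = ≋-act q (≋-act p c)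

  ≋-refl : ∀ {n} (x : V n) → x ≋ x
  ≋-refl [] = tt
  ≋-refl (a ∷ x) = divides 0ℤ (ℤₚ.+-inverseʳ a) , ≋-refl x

  ≋-sym : ∀ {n} {x y : V n} → x ≋ y → y ≋ x
  ≋-sym {x = []} {[]} _ = tt
  ≋-sym {x = a ∷ x} {b ∷ y} (d , c) = subst (L ∣ₛ_) (l a b) (∣m⇒∣-m d) , ≋-sym c
    where
    l : ∀ a b → - (a - b) ≡ b - a
    l = solve-∀

  ≋-trans : ∀ {n} {x y z : V n} → x ≋ y → y ≋ z → x ≋ z
  ≋-trans {x = []} {[]} {[]} _ _ = tt
  ≋-trans {x = a ∷ x} {b ∷ y} {c ∷ z} (d , e) (d' , e') = subst (L ∣ₛ_) (l a b c) (∣m∣n⇒∣m+n d d') , ≋-trans e e'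
    where
    l : ∀ a b c → (a - b) + (b - c) ≡ a - c
    l = solve-∀

  ≋-· : ∀ {n} s {x y : V n} → x ≋ y → s · x ≋ s · y
  ≋-· s {[]} {[]} _ = tt
  ≋-· s {a ∷ x} {b ∷ y} (d , c) = subst (L ∣ₛ_) (l s a b) (∣n⇒∣m*n s d) , ≋-· s c
    where
    l : ∀ s a b → s * (a - b) ≡ s * a - s * b
    l = solve-∀

  ≋-∙ : ∀ {n} (w : V n) {x y} → x ≋ y → L ∣ₛ w ∙ x - w ∙ y
  ≋-∙ [] {[]} {[]} _ = divides 0ℤ refl
  ≋-∙ (c ∷ w) {a ∷ x} {b ∷ y} (d , e) = subst (L ∣ₛ_) (l c a b (w ∙ x) (w ∙ y)) (∣m∣n⇒∣m+n (∣n⇒∣m*n c d) (≋-∙ w e))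
    where
    l : ∀ c a b p q → c * (a - b) + (p - q) ≡ (c * a + p) - (c * b + q)
    l = solve-∀

  ∣-resp : ∀ {a b} → L ∣ₛ a - b → L ∣ₛ b → L ∣ₛ a
  ∣-resp {a} {b} d e = subst (L ∣ₛ_) (l a b) (∣m∣n⇒∣m+n d e)
    where
    l : ∀ a b → (a - b) + b ≡ a
    l = solve-∀

  MultP : ∀ {k} → V k → ℤ → ℤ × V k → Set
  MultP z m (s , w) = (∣ s ∣ ℕ.≤ h × s ≢ 0ℤ) × (Norm (L * L * m) w × w ≋ s · z)

  NonPerp : ∀ {k} → V k → ℤ → V k → Set
  NonPerp z m y = Norm m y × ¬ L ∣ₛ y ∙ z

  finite-Mult : ∀ {k} (z : V k) m → Finite (MultP z m)
  finite-Mult {k} z m = finite-Σ (finite-filter (λ s → ¬? (s ℤₚ.≟ 0ℤ)) (finite-symInterval h))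
    (λ s → finite-filter (λ w → w ≋? s · z) (finite-norm k (L * L * m)))

  finite-NonPerp : ∀ {k} (z : V k) m → Finite (NonPerp z m)
  finite-NonPerp {k} z m = finite-filter (λ y → ¬? (L ∣ₛ? (y ∙ z))) (finite-norm k m)

  -- `Neighbour` needs a lift with `|x|² = ℓ(2p + ℓ)`, whereas these counts make sense for every
  -- `z`, depend only on `z` modulo `ℓ` and are invariant under signed permutations. The defect can
  -- thus be computed on a convenient lift.
  U Vv D : ∀ {k} → V k → ℤ → ℤ
  U z m = card (finite-Mult z m)
  Vv z m = card (finite-NonPerp z m)
  D z m = U z m - Vv z m

  D-cong : ∀ {k} {x y : V k} m → x ≋ y → D x m ≡ D y m
  D-cong {k} {x} {y} m c = cong₂ _-_ (card-bij (finite-Mult x m) (finite-Mult y m) β₁) (card-bij (finite-NonPerp x m) (finite-NonPerp y m) β₂)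
    where
    β₁ : Bij (MultP x m) (MultP y m)
    β₁ = record { to = id ; from = id
      ; to-ok = λ { {s , w} (p , (q , e)) → p , (q , ≋-trans e (≋-· s c)) }
      ; from-ok = λ { {s , w} (p , (q , e)) → p , (q , ≋-trans e (≋-· s (≋-sym c))) }
      ; from∘to = λ _ → refl ; to∘from = λ _ → refl }
    β₂ : Bij (NonPerp x m) (NonPerp y m)
    β₂ = record { to = id ; from = id
      ; to-ok = λ { {w} (p , nd) → p , λ d → nd (∣-resp (≋-∙ w c) d) }
      ; from-ok = λ { {w} (p , nd) → p , λ d → nd (∣-resp (≋-∙ w (≋-sym c)) d) }
      ; from∘to = λ _ → refl ; to∘from = λ _ → refl }

  D-act : ∀ {k} (p : SP k) (z : V k) m → D z m ≡ D (act p z) m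
  D-act {k} p z m = cong₂ _-_ (card-bij (finite-Mult z m) (finite-Mult (act p z) m) β₁) (card-bij (finite-NonPerp z m) (finite-NonPerp (act p z) m) β₂)
    where
    β₁ : Bij (MultP z m) (MultP (act p z) m)
    β₁ = record { to = λ (s , w) → s , act p w ; from = λ (s , w) → s , act (inv p) w
      ; to-ok = λ { {s , w} (q , (e , c)) → q , (trans (act-∙ p w w) e , subst (act p w ≋_) (act-· p s z) (≋-act p c)) }
      ; from-ok = λ { {s , w} (q , (e , c)) → q , (trans (act-∙ (inv p) w w) e ,
          subst (act (inv p) w ≋_) (trans (act-· (inv p) s (act p z)) (cong (s ·_) (inv-act p z))) (≋-act (inv p) c)) }
      ; from∘to = λ { {s , w} _ → cong (s ,_) (inv-act p w) } ; to∘from = λ { {s , w} _ → cong (s ,_) (act-inv p w) } }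
    β₂ : Bij (NonPerp z m) (NonPerp (act p z) m)
    β₂ = record { to = act p ; from = act (inv p)
      ; to-ok = λ { {y} (e , nd) → trans (act-∙ p y y) e , λ d → nd (subst (L ∣ₛ_) (act-∙ p y z) d) }
      ; from-ok = λ { {y} (e , nd) → trans (act-∙ (inv p) y y) e ,
          λ d → nd (subst (L ∣ₛ_) (trans (sym (act-∙ p (act (inv p) y) z)) (cong (_∙ act p z) (act-inv p y))) d) }
      ; from∘to = λ {y} _ → inv-act p y ; to∘from = λ {y} _ → act-inv p y }

  -- `v ↦ −v` acts freely on both sets; a half is selected by the sign of `s` in one and by the
  -- residue of `y ∙ z` being at most `h` in the other.
  even-D : ∀ {k} (z : V k) m → + 2 ∣ₛ D z m
  even-D {k} z m = ∣m∣n⇒∣m-n (divides (card F₁) (trans h₁ (ℤₚ.*-comm (+ 2) _))) (divides (card F₂) (trans h₂ (ℤₚ.*-comm (+ 2) _)))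
    where
    negV : V k → V k
    negV w = -1ℤ · w
    negneg : ∀ {n} (w : V n) → -1ℤ · (-1ℤ · w) ≡ w
    negneg [] = refl
    negneg (a ∷ w) = cong₂ _∷_ (l a) (negneg w)
      where
      l : ∀ a → -1ℤ * (-1ℤ * a) ≡ a
      l = solve-∀
    neg-norm : ∀ {n} (w : V n) → (-1ℤ · w) ∙ (-1ℤ · w) ≡ w ∙ w
    neg-norm w = trans (∙-·ˡ -1ℤ (-1ℤ · w) w) (trans (cong (-1ℤ *_) (∙-·ʳ -1ℤ w w)) (l (w ∙ w)))
      where
      l : ∀ a → -1ℤ * (-1ℤ * a) ≡ a
      l = solve-∀
    neg-≋ : ∀ {n} s {w x : V n} → w ≋ s · x → -1ℤ · w ≋ (- s) · x
    neg-≋ s {[]} {[]} _ = tt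
    neg-≋ s {a ∷ w} {b ∷ x} (d , c) = subst (L ∣ₛ_) (l a s b) (∣m⇒∣-m d) , neg-≋ s c
      where
      l : ∀ a s b → - (a - s * b) ≡ -1ℤ * a - (- s) * b
      l = solve-∀
    pos : ∀ s → s ≢ 0ℤ → ¬ (0ℤ < s) → 0ℤ < - s
    pos (+ zero) ne _ = contradiction refl ne
    pos (+ suc _) _ ≮ = contradiction (+<+ (ℕ.s≤s ℕ.z≤n)) ≮
    pos -[1+ _ ] _ _ = +<+ (ℕ.s≤s ℕ.z≤n)
    F₁ = finite-filter (λ c → 0ℤ ℤₚ.<? proj₁ c) (finite-Mult z m)
    h₁ : U z m ≡ + 2 * card F₁
    h₁ = card-half (λ c → 0ℤ ℤₚ.<? proj₁ c) (finite-Mult z m) (λ (s , w) → - s , negV w)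
      (λ { {s , w} ((q , ne) , (e , c)) → (subst (ℕ._≤ h) (sym (ℤₚ.∣-i∣≡∣i∣ s)) q , λ e' → ne (trans (sym (ℤₚ.neg-involutive s)) (cong -_ e'))) , (trans (neg-norm w) e , neg-≋ s c) })
      (λ { {s , w} _ → cong₂ _,_ (ℤₚ.neg-involutive s) (negneg w) })
      (λ { {s , w} _ 0<s 0<-s → ℤₚ.<-asym 0<s (subst (_< 0ℤ) (ℤₚ.neg-involutive s) (ℤₚ.neg-mono-< 0<-s)) })
      (λ { {s , w} ((_ , ne) , _) ≮ → pos s ne ≮ })
    Q : V k → Set
    Q y = (y ∙ z) %ℕ ℓ ℕ.≤ h
    neg-dot : ∀ y → negV y ∙ z ≡ - (y ∙ z)
    neg-dot y = trans (∙-·ˡ -1ℤ z y) (ℤₚ.-1*i≡-i _)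
    rem-neg : ∀ t → ¬ L ∣ₛ t → (- t) %ℕ ℓ ≡ ℓ ℕ.∸ t %ℕ ℓ
    rem-neg t nd = proj₂ (divmod-unique ℓ (- t) (ℓ ℕ.∸ t %ℕ ℓ) (- (t /ℕ ℓ) - 1ℤ) lt eq)
      where
      r₀ = t %ℕ ℓ
      r≢0 : r₀ ≢ 0
      r≢0 e = nd (divides (t /ℕ ℓ) (trans (a≡a%ℕn+[a/ℕn]*n t ℓ) (trans (cong (λ r → + r + t /ℕ ℓ * L) e) (ℤₚ.+-identityˡ _))))
      lt : ℓ ℕ.∸ r₀ ℕ.< ℓ
      lt = ℕₚ.∸-monoʳ-< (ℕₚ.n≢0⇒n>0 r≢0) (ℕₚ.<⇒≤ (n%ℕd<d t ℓ))
      eq : - t ≡ + (ℓ ℕ.∸ r₀) + (- (t /ℕ ℓ) - 1ℤ) * L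
      eq = trans (cong -_ (a≡a%ℕn+[a/ℕn]*n t ℓ)) (trans (l (+ r₀) (t /ℕ ℓ) L) (cong (_+ (- (t /ℕ ℓ) - 1ℤ) * L)
        (trans (ℤₚ.m-n≡m⊖n ℓ r₀) (ℤₚ.⊖-≥ (ℕₚ.<⇒≤ (n%ℕd<d t ℓ))))))
        where
        l : ∀ r q L → - (r + q * L) ≡ (L - r) + (- q - 1ℤ) * L
        l = solve-∀
    F₂ = finite-filter (λ y → (y ∙ z) %ℕ ℓ ℕ.≤? h) (finite-NonPerp z m)
    h₂ : Vv z m ≡ + 2 * card F₂
    h₂ = card-half (λ y → (y ∙ z) %ℕ ℓ ℕ.≤? h) (finite-NonPerp z m) negV
      (λ { {y} (e , nd) → trans (neg-norm y) e , λ d → nd (subst (L ∣ₛ_) (trans (cong -_ (neg-dot y)) (ℤₚ.neg-involutive _)) (∣m⇒∣-m d)) })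
      (λ {y} _ → negneg y)
      (λ { {y} (_ , nd) q q' → ℕₚ.<-irrefl refl (ℕₚ.<-≤-trans (ℕₚ.n<1+n (h ℕ.+ h))
         (ℕₚ.≤-trans (ℕₚ.≤-reflexive (sym (ℕₚ.m∸n+n≡m (ℕₚ.<⇒≤ (n%ℕd<d (y ∙ z) ℓ)))))
           (ℕₚ.+-mono-≤ (subst (ℕ._≤ h) (trans (cong (_%ℕ ℓ) (neg-dot y)) (rem-neg (y ∙ z) nd)) q') q))) })
      (λ { {y} (_ , nd) nq → subst (ℕ._≤ h) (sym (trans (cong (_%ℕ ℓ) (neg-dot y)) (rem-neg (y ∙ z) nd)))
         (ℕₚ.≤-trans (ℕₚ.∸-monoʳ-≤ ℓ (ℕₚ.≰⇒> nq)) (ℕₚ.≤-reflexive (ℕₚ.m+n∸m≡n h h))) })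

  -- The neighbour and ℤ^k have the vectors of `Perp` in common, which cancel in the difference.
  neighbour-card : ∀ {k} (x : V k) p (xx : x ∙ x ≡ L * (p + p + L)) m (F : Finite (Neighbour.C x p xx m)) →
                   card F - r k m ≡ D x m
  neighbour-card {k} x p xx m F = trans (cong₂ _-_ (trans (card-bij F (finite-⊎ FP (finite-Mult x m)) (Neighbour.neighbour-bij x p xx m)) (card-⊎ FP (finite-Mult x m)))
      (card-split (λ y → L ∣ₛ? (y ∙ x)) (finite-norm k m))) (l (card FP) (U x m) (Vv x m))
    where
    FP = finite-filter (λ y → L ∣ₛ? (y ∙ x)) (finite-norm k m)
    l : ∀ a u v → (a + u) - (a + v) ≡ u - v
    l = solve-∀

  -- Neighbours along lines with few nonzero coordinates

  Unit : ∀ {n} → V n → Set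
  Unit x = ∃ λ y → ∃ λ t → x ∙ y ≡ 1ℤ + L * t

  module Reduce {N : ℕ} (x : V N) (p : ℤ) (xx : x ∙ x ≡ L * (p + p + L)) (un : Unit x) where

    S = ∣ p + L ∣

    0<p+L : 0ℤ < p + L
    0<p+L = ℤₚ.≰⇒> λ le → ℤₚ.<⇒≱ (neg le) (0≤∙ x)
      where
      l : ∀ p L → p + p + L ≡ (p + L) + (p + L) - L
      l = solve-∀
      neg : p + L ≤ 0ℤ → x ∙ x < 0ℤ
      neg le = subst (_< 0ℤ) (sym xx) (ℤₚ.≤-<-trans (ℤₚ.*-monoˡ-≤-nonNeg L
        (ℤₚ.≤-trans (ℤₚ.≤-reflexive (l p L)) (ℤₚ.+-monoˡ-≤ (- L) (ℤₚ.+-mono-≤ le le)))) -<+)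

    S≡ : + S ≡ p + L
    S≡ = ℤₚ.0≤i⇒+∣i∣≡i (ℤₚ.<⇒≤ 0<p+L)

    0<S : 0 ℕ.< S
    0<S = ℤₚ.drop‿+<+ (subst (0ℤ <_) (sym S≡) 0<p+L)

    X₀ X : V (suc (suc N))
    X₀ = + S ∷ p ∷ x
    X = (p + L) ∷ p ∷ x

    X≡ : X₀ ≡ X
    X≡ = cong (_∷ p ∷ x) S≡

    nullX : Null X
    nullX = trans (cong (λ t → p * p + t - (p + L) * (p + L)) xx) (l p L)
      where
      l : ∀ p L → p * p + L * (p + p + L) - (p + L) * (p + L) ≡ 0ℤ
      l = solve-∀

    uniX : Unimodular X
    -- `(t; t, y)` has inner product `x ∙ y − ℓt = 1` with `X`.
    uniX = let (y , t , e) = un in t ∷ t ∷ y , trans (cong (λ u → p * t + u - (p + L) * t) e) (l p L t)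
      where
      l : ∀ p L t → p * t + (1ℤ + L * t) - (p + L) * t ≡ 1ℤ
      l = solve-∀

    -- As `ℓ` is odd, one of the coordinates `p` and `p + ℓ` is even, and the unit vector in that
    -- coordinate is the witness. This is the parity argument that excludes E₈.
    ncX : NonChar X
    ncX with even? p
    ... | yes (divides q e) = 0ℤ ∷ 1ℤ ∷ 𝟘 , λ d → ¬even-1+2a q (subst Even (trans (cong₂ (λ u v → (1ℤ * 1ℤ + u - 0ℤ * 0ℤ) + (p * 1ℤ + v - (p + L) * 0ℤ)) (∙-𝟘ʳ (𝟘 {N})) (∙-𝟘ʳ x))
          (trans (l p L) (trans (cong (_+_ 1ℤ) e) (cong (_+_ 1ℤ) (ℤₚ.*-comm q (+ 2)))))) d)
      where
      l : ∀ p L → (1ℤ * 1ℤ + 0ℤ - 0ℤ * 0ℤ) + (p * 1ℤ + 0ℤ - (p + L) * 0ℤ) ≡ 1ℤ + p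
      l = solve-∀
    ... | no od = 1ℤ ∷ 0ℤ ∷ 𝟘 , λ d → ¬even-1+2a (- half p - + 2 - + h) (subst Even (trans (cong₂ (λ u v → (0ℤ * 0ℤ + u - 1ℤ * 1ℤ) + (p * 0ℤ + v - (p + L) * 1ℤ)) (∙-𝟘ʳ (𝟘 {N})) (∙-𝟘ʳ x))
          (trans (l p L) (trans (cong₂ (λ u v → - 1ℤ - (u + v)) (odd-half p od) L≡1+2h) (l₂ (half p) (+ h))))) d)
      where
      l : ∀ p L → (0ℤ * 0ℤ + 0ℤ - 1ℤ * 1ℤ) + (p * 0ℤ + 0ℤ - (p + L) * 1ℤ) ≡ - 1ℤ - (p + L)
      l = solve-∀
      l₂ : ∀ a h → - 1ℤ - ((1ℤ + + 2 * a) + (1ℤ + + 2 * h)) ≡ 1ℤ + + 2 * (- a - + 2 - h)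
      l₂ = solve-∀

    module _ (M : ℕ) (m : ℤ) where

      x' : V (N ℕ.+ M)
      x' = x Vec.++ 𝟘 {M}

      xx' : x' ∙ x' ≡ L * (p + p + L)
      xx' = trans (∙-++ x x (𝟘 {M}) 𝟘) (trans (cong₂ _+_ xx (∙-𝟘ʳ (𝟘 {M}))) (ℤₚ.+-identityʳ _))

      FC : Finite (Neighbour.C x' p xx' m)
      FC = finite-transport (Bij-sym (Neighbour.neighbour-bij x' p xx' m)) (finite-⊎ (finite-filter (λ y → L ∣ₛ? (y ∙ x')) (finite-norm (N ℕ.+ M) m)) (finite-Mult x' m))

      dW : ⟪ X Vec.++ 𝟘 {M} , -1ℤ ∷ -1ℤ ∷ 𝟘 ⟫ ≡ L
      dW = trans (⟪⟫-W (p + L) p x') (l p L)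
        where
        l : ∀ p L → p + L - p ≡ L
        l = solve-∀

  T₁-window : ∀ n → ⟪ T₁ n , -1ℤ ∷ 𝟘 ⟫ ≡ + 1
  T₁-window n = cong (λ t → 0ℤ + t - 1ℤ * -1ℤ) (∙-𝟘ʳ (𝟘 {n}))

  -- Eight coordinates, `p` and the time coordinate fill ℤ^{9,1}, where only `T₁ 8` remains; the
  -- neighbour then has the representation numbers of ℤ^{8+M}.
  D₈ : ∀ (x : V 8) p → x ∙ x ≡ L * (p + p + L) → Unit x → ∀ M m → D (x Vec.++ 𝟘 {M}) m ≡ 0ℤ
  D₈ x p xx un M m = trans (sym (neighbour-card x' p (xx' M m) m FC')) (trans (cong (_- r (8 ℕ.+ M) m)
      (card-bij FC' (finite-norm (8 ℕ.+ M) m) (Bij-trans (cos-bij X (T₁ 8) nullX red M _ (- (+ h)) ℓ (dW M m) (-1ℤ ∷ 𝟘) 0ℤ 1 (T₁-window (8 ℕ.+ M)) m) (T₁-bij (8 ℕ.+ M) m)))) (ℤₚ.+-inverseʳ (r (8 ℕ.+ M) m)))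
    where
    open Reduce x p xx un hiding (x')
    x' = x Vec.++ 𝟘 {M}
    FC' = FC M m
    red : Reduces X (T₁ 8)
    red = subst (λ Z → Reduces Z (T₁ 8)) X≡ (reduce₉ S S (p ∷ x) ℕₚ.≤-refl 0<S (subst Null (sym X≡) nullX) (subst Unimodular (sym X≡) uniX) (subst NonChar (sym X≡) ncX))

  -- Eleven coordinates, `p` and the time coordinate fill ℤ^{12,1}; `T₁ 11` gives defect 0 and
  -- `T₂ 3` gives E₈ ⊕ ℤ^{3+M}.
  D₁₁ : ∀ (x : V 11) p → x ∙ x ≡ L * (p + p + L) → Unit x → ∀ M m → + 16 ∣ₛ D (x Vec.++ 𝟘 {M}) m
  D₁₁ x p xx un M m = subst (+ 16 ∣ₛ_) (neighbour-card x' p (xx' M m) m FC') (go red)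
    where
    open Reduce x p xx un hiding (x')
    x' = x Vec.++ 𝟘 {M}
    FC' = FC M m
    red : Reduces X (T₁ 11) ⊎ Reduces X (T₂ 3)
    red = subst (λ Z → Reduces Z (T₁ 11) ⊎ Reduces Z (T₂ 3)) X≡ (reduce₁₂ S S (p ∷ x) ℕₚ.≤-refl 0<S (subst Null (sym X≡) nullX) (subst Unimodular (sym X≡) uniX))
    T₂-window : ∀ n → ⟪ T₂ n , W₂ n ⟫ ≡ + 2
    T₂-window n = ⟪⟫-W (+ 3) 1ℤ (𝟙 {8} Vec.++ 𝟘 {n})
    go : Reduces X (T₁ 11) ⊎ Reduces X (T₂ 3) → + 16 ∣ₛ card FC' - r (11 ℕ.+ M) m
    go (inj₁ rd) = divides 0ℤ (trans (cong (_- r (11 ℕ.+ M) m)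
      (card-bij FC' (finite-norm (11 ℕ.+ M) m) (Bij-trans (cos-bij X (T₁ 11) nullX rd M _ (- (+ h)) ℓ (dW M m) (-1ℤ ∷ 𝟘) 0ℤ 1 (T₁-window (11 ℕ.+ M)) m) (T₁-bij (11 ℕ.+ M) m)))) (ℤₚ.+-inverseʳ (r (11 ℕ.+ M) m)))
    go (inj₂ rd) = subst (λ c → + 16 ∣ₛ c - r (11 ℕ.+ M) m) (sym (card-bij FC' FT β)) (T₂-card {3 ℕ.+ M} m FT)
      where
      β = cos-bij X (T₂ 3) nullX rd M (-1ℤ ∷ -1ℤ ∷ 𝟘) (- (+ h)) ℓ (dW M m) (W₂ (3 ℕ.+ M)) 0ℤ 2 (T₂-window (3 ℕ.+ M)) m
      FT = finite-transport β FC'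

  -- Replacing a by a + ℓ in the first coordinate changes the parity of |z|²/ℓ.
  fix-parity : ∀ {N} (z : V (suc N)) → L ∣ₛ z ∙ z → Unit z → ∃ λ x → ∃ λ p → x ≋ z × x ∙ x ≡ L * (p + p + L) × Unit x
  fix-parity (a ∷ z) (divides c e) un@(b ∷ y , t , u) with even-or-odd c
  ... | inj₂ o = a ∷ z , half c - + h , ≋-refl (a ∷ z) , trans e (trans (cong (_* L) o) (trans (l (half c) (+ h) L) (cong (λ t → L * (half c - + h + (half c - + h) + t)) (sym L≡1+2h)))) , un
    where
    l : ∀ g h L → (1ℤ + + 2 * g) * L ≡ L * (g - h + (g - h) + (1ℤ + + 2 * h))
    l = solve-∀
  ... | inj₁ o = (a + L) ∷ z , half c + a , (divides 1ℤ (l a L) , ≋-refl z) ,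
        trans (l₂ a L (z ∙ z)) (trans (cong (λ t → t + + 2 * (a * L) + L * L) (trans e (cong (_* L) o))) (l₃ (half c) a L)) ,
        (b ∷ y , t + b , trans (l₄ a L b (z ∙ y)) (trans (cong (_+ L * b) u) (l₅ L t b)))
    where
    l : ∀ a L → a + L - a ≡ 1ℤ * L
    l = solve-∀
    l₂ : ∀ a L q → (a + L) * (a + L) + q ≡ (a * a + q) + + 2 * (a * L) + L * L
    l₂ = solve-∀
    l₃ : ∀ g a L → + 2 * g * L + + 2 * (a * L) + L * L ≡ L * (g + a + (g + a) + L)
    l₃ = solve-∀
    l₄ : ∀ a L b q → (a + L) * b + q ≡ (a * b + q) + L * b
    l₄ = solve-∀
    l₅ : ∀ L t b → 1ℤ + L * t + L * b ≡ 1ℤ + L * (t + b)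
    l₅ = solve-∀

  ≋-++ : ∀ {m n} {x y : V m} (w : V n) → x ≋ y → x Vec.++ w ≋ y Vec.++ w
  ≋-++ {x = []} {[]} w _ = ≋-refl w
  ≋-++ {x = a ∷ x} {b ∷ y} w (d , c) = d , ≋-++ w c

  unit-act : ∀ {n} (p : SP n) {z} → Unit z → Unit (act p z)
  unit-act p {z} (y , t , e) = act p y , t , trans (act-∙ p z y) e

  unit-drop : ∀ {m n} (x : V m) → Unit (x Vec.++ 𝟘 {n}) → Unit x
  unit-drop {m} {n} x (y , t , e) = takeV m y , t , trans (sym (trans (cong ((x Vec.++ 𝟘) ∙_) (sym (take++drop m y)))
    (trans (∙-++ x (takeV m y) 𝟘 (dropV m y)) (trans (cong (_+_ (x ∙ takeV m y)) (∙-𝟘ˡ (dropV m y))) (ℤₚ.+-identityʳ _))))) e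

  iso-drop : ∀ {m n} (x : V m) → (x Vec.++ 𝟘 {n}) ∙ (x Vec.++ 𝟘 {n}) ≡ x ∙ x
  iso-drop {m} {n} x = trans (∙-++ x x (𝟘 {n}) 𝟘) (trans (cong (_+_ (x ∙ x)) (∙-𝟘ʳ (𝟘 {n}))) (ℤₚ.+-identityʳ _))

  -- `y` is congruent to the compressed vector `x` and makes `|y|²/ℓ` odd, as `Neighbour` requires.
  record Normal {N M : ℕ} (z : V (N ℕ.+ M)) : Set where
    field
      perm   : SP (N ℕ.+ M)
      x y    : V N
      p      : ℤ
      perm-z : act perm z ≡ x Vec.++ 𝟘 {M}
      y≋x    : y ≋ x
      yy     : y ∙ y ≡ L * (p + p + L)
      unit   : Unit y

  normal : ∀ N {M} (z : V (suc N ℕ.+ M)) → L ∣ₛ z ∙ z → Unit z → nz z ℕ.≤ suc N → Normal {suc N} {M} z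
  normal N {M} z iso un le = build (compress (suc N) {M} z le)
    where
    build : (∃ λ q → ∃ λ x → act q z ≡ x Vec.++ 𝟘 {M}) → Normal {suc N} {M} z
    build (q , x , e) = fix (fix-parity x (subst (L ∣ₛ_) (trans (sym (act-∙ q z z)) (trans (cong (λ u → u ∙ u) e) (iso-drop x))) iso)
        (unit-drop x (subst Unit e (unit-act q un))))
      where
      fix : (∃ λ y → ∃ λ p → y ≋ x × y ∙ y ≡ L * (p + p + L) × Unit y) → Normal {suc N} {M} z
      fix (y , p , c , yy , uy) = record { perm = q ; x = x ; y = y ; p = p ; perm-z = e ; y≋x = c ; yy = yy ; unit = uy }

  D-normal : ∀ {N M} (z : V (N ℕ.+ M)) m (n : Normal {N} {M} z) → D z m ≡ D (Normal.y n Vec.++ 𝟘 {M}) m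
  D-normal {M = M} z m n = trans (D-act (Normal.perm n) z m) (trans (cong (λ u → D u m) (Normal.perm-z n)) (sym (D-cong m (≋-++ (𝟘 {M}) (Normal.y≋x n)))))

  D-8 : ∀ {M} (z : V (8 ℕ.+ M)) m → L ∣ₛ z ∙ z → Unit z → nz z ℕ.≤ 8 → D z m ≡ 0ℤ
  D-8 {M} z m iso un le = trans (D-normal {8} {M} z m n) (D₈ (Normal.y n) (Normal.p n) (Normal.yy n) (Normal.unit n) M m)
    where n = normal 7 {M} z iso un le

  D-11 : ∀ {M} (z : V (11 ℕ.+ M)) m → L ∣ₛ z ∙ z → Unit z → nz z ℕ.≤ 11 → + 16 ∣ₛ D z m
  D-11 {M} z m iso un le = subst (+ 16 ∣ₛ_) (sym (D-normal {11} {M} z m n)) (D₁₁ (Normal.y n) (Normal.p n) (Normal.yy n) (Normal.unit n) M m)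
    where n = normal 10 {M} z iso un le

  -- The cases are `j ≤ 7` with defect 0, `8 ≤ j ≤ 10` with `2^8 · 2^4 = 2^12`, and `j ≥ 11` with
  -- `2^11 · 2 = 2^12`.
  weigh : ∀ x j → (suc j ℕ.≤ 8 → x ≡ 0ℤ) → (suc j ℕ.≤ 11 → 2^ 4 ∣ₛ x) → 2^ 1 ∣ₛ x → 2^ 12 ∣ₛ 2^ j * x
  weigh x j f g ev with suc j ℕ.≤? 8 | suc j ℕ.≤? 11
  ... | yes le | _ = divides 0ℤ (trans (cong (2^ j *_) (f le)) (ℤₚ.*-zeroʳ (2^ j)))
  ... | no ≰8 | yes le = let (d , e) = ℕₚ.m≤n⇒∃[o]m+o≡n (ℕₚ.≤-pred (ℕₚ.≰⇒> ≰8)) in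
        subst (λ t → 2^ 12 ∣ₛ 2^ t * x) (trans (ℕₚ.+-comm d 8) e) (2^-∣ 4 8 d (g le))
  ... | no _ | no ≰11 = let (d , e) = ℕₚ.m≤n⇒∃[o]m+o≡n (ℕₚ.≤-pred (ℕₚ.≰⇒> ≰11)) in
        subst (λ t → 2^ 12 ∣ₛ 2^ t * x) (trans (ℕₚ.+-comm d 11) e) (2^-∣ 1 11 d ev)

  D-weight : ∀ {M} (z : V (11 ℕ.+ M)) m → L ∣ₛ z ∙ z → Unit z → ∀ j → nz z ≡ suc j → 2^ 12 ∣ₛ 2^ j * D z m
  D-weight {M} z m iso un j e = weigh (D z m) j (λ le → D-8 {3 ℕ.+ M} z m iso un (subst (ℕ._≤ 8) (sym e) le))
    (λ le → D-11 {M} z m iso un (subst (ℕ._≤ 11) (sym e) le)) (even-D z m)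

  -- Sums over 𝔽_ℓ^k and over its lines

  Rs : List ℤ
  Rs = symInterval h

  SumV : ∀ k → (V k → ℤ) → ℤ
  SumV zero    f = f []
  SumV (suc k) f = ∑ Rs (λ a → SumV k (λ x → f (a ∷ x)))

  -- One summand for each line of 𝔽_ℓ^k: the first nonzero entry is 1.
  SumZ : ∀ k → (V k → ℤ) → ℤ
  SumZ zero    f = 0ℤ
  SumZ (suc k) f = SumZ k (λ x → f (0ℤ ∷ x)) + SumV k (λ x → f (1ℤ ∷ x))

  SumV-cong : ∀ k {f g : V k → ℤ} → (∀ x → f x ≡ g x) → SumV k f ≡ SumV k g
  SumV-cong zero e = e []
  SumV-cong (suc k) e = ∑-cong Rs (λ a → SumV-cong k (λ x → e (a ∷ x)))

  SumV-*ˡ : ∀ k c (f : V k → ℤ) → SumV k (λ x → c * f x) ≡ c * SumV k f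
  SumV-*ˡ zero c f = refl
  SumV-*ˡ (suc k) c f = trans (∑-cong Rs (λ a → SumV-*ˡ k c (λ x → f (a ∷ x)))) (∑-*ˡ Rs c (λ a → SumV k (λ x → f (a ∷ x))))

  -- The nonzero entries of x can be changed in sign independently, giving a factor 2 for each.
  SumV-div : ∀ k (f : V k → ℤ) → (∀ p x → f (act p x) ≡ f x) → (∀ x → 2^ 12 ∣ₛ 2^ (nz x) * f x) → 2^ 12 ∣ₛ SumV k f
  SumV-div zero f inv wt = subst (2^ 12 ∣ₛ_) (ℤₚ.*-identityˡ (f [])) (wt [])
  SumV-div (suc k) f iv wt = subst (2^ 12 ∣ₛ_) (sym (∑-symInterval h F)) (∣m∣n⇒∣m+n zero-part (∑-∣ (2^ 12) (applyUpTo id h) _ pairs))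
    where
    F : ℤ → ℤ
    F a = SumV k (λ x → f (a ∷ x))
    zero-part : 2^ 12 ∣ₛ F 0ℤ
    zero-part = SumV-div k (λ x → f (0ℤ ∷ x)) (λ p x → iv (prep p) (0ℤ ∷ x)) (λ x → wt (0ℤ ∷ x))
    l : ∀ a → a + a ≡ + 2 * a
    l = solve-∀
    l₂ : ∀ c a → + 2 * c * a ≡ c * (+ 2 * a)
    l₂ = solve-∀
    pairs : ∀ i → 2^ 12 ∣ₛ F (+ suc i) + F -[1+ i ]
    pairs i = subst (2^ 12 ∣ₛ_) (sym (trans (cong (_+_ (F (+ suc i))) (SumV-cong k (λ x → iv negate (+ suc i ∷ x)))) (trans (l (F (+ suc i))) (sym (SumV-*ˡ k (+ 2) (λ x → f (+ suc i ∷ x)))))))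
      (SumV-div k (λ x → + 2 * f (+ suc i ∷ x)) (λ p x → cong (+ 2 *_) (iv (prep p) (+ suc i ∷ x)))
        (λ x → subst (2^ 12 ∣ₛ_) (l₂ (2^ nz x) (f (+ suc i ∷ x))) (wt (+ suc i ∷ x))))

  -- The leading entry is normalised to 1, so only the `j` other nonzero entries change sign freely;
  -- this is why `j + 1` nonzero entries give the factor `2^j`.
  SumZ-div : ∀ k (f : V k → ℤ) → (∀ p x → f (act p x) ≡ f x) →
             (∀ z → (∃ λ y → z ∙ y ≡ 1ℤ) → ∀ j → nz z ≡ suc j → 2^ 12 ∣ₛ 2^ j * f z) → 2^ 12 ∣ₛ SumZ k f
  SumZ-div zero f iv wt = divides 0ℤ refl
  SumZ-div (suc k) f iv wt = ∣m∣n⇒∣m+n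
    (SumZ-div k (λ x → f (0ℤ ∷ x)) (λ p x → iv (prep p) (0ℤ ∷ x)) (λ z (y , e) → wt (0ℤ ∷ z) (0ℤ ∷ y , trans (ℤₚ.+-identityˡ _) e)))
    (SumV-div k (λ x → f (1ℤ ∷ x)) (λ p x → iv (prep p) (1ℤ ∷ x)) (λ x → wt (1ℤ ∷ x) (1ℤ ∷ 𝟘 , cong (_+_ 1ℤ) (∙-𝟘ʳ x)) (nz x) refl))

  iso? : ∀ {k} (z : V k) → Dec (L ∣ₛ z ∙ z)
  iso? z = L ∣ₛ? (z ∙ z)

  isoD : ∀ {k} → ℤ → V k → ℤ
  isoD m z = ⟦ iso? z ⟧ * D z m

  isoD-act : ∀ {k} m (p : SP k) x → isoD m (act p x) ≡ isoD m x
  isoD-act m p x = cong₂ _*_ (⟦⟧-cong (iso? (act p x)) (iso? x) (subst (L ∣ₛ_) (act-∙ p x x)) (subst (L ∣ₛ_) (sym (act-∙ p x x)))) (sym (D-act p x m))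

  isoD-weight : ∀ k M → k ≡ 11 ℕ.+ M → ∀ m (z : V k) → (∃ λ y → z ∙ y ≡ 1ℤ) → ∀ j → nz z ≡ suc j → 2^ 12 ∣ₛ 2^ j * isoD m z
  isoD-weight k M refl m z (y , e) j ej = go (iso? z) (λ iso → D-weight {M} z m iso (y , 0ℤ , trans e (cong (_+_ 1ℤ) (sym (ℤₚ.*-zeroʳ L)))) j ej)
    where
    go : ∀ {P : Set} (d : Dec P) {x} → (P → 2^ 12 ∣ₛ 2^ j * x) → 2^ 12 ∣ₛ 2^ j * (⟦ d ⟧ * x)
    go (yes p) {x} f = subst (λ t → 2^ 12 ∣ₛ 2^ j * t) (sym (ℤₚ.*-identityˡ x)) (f p)
    go (no _) {x} _ = divides 0ℤ (trans (cong (2^ j *_) (ℤₚ.*-zeroˡ x)) (ℤₚ.*-zeroʳ (2^ j)))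

  SumZ-D : ∀ k M → k ≡ 11 ℕ.+ M → ∀ m → 2^ 12 ∣ₛ SumZ k (isoD m)
  SumZ-D k M e m = SumZ-div k (isoD m) (isoD-act m) (isoD-weight k M e m)

  -- Points on quadrics over 𝔽_ℓ

  infix 4 _≈_
  -- A record rather than a synonym, so that `a` and `b` can be inferred from a proof of `a ≈ b`.
  record _≈_ (a b : ℤ) : Set where
    constructor mk≈
    field diff∣ : L ∣ₛ a - b
  open _≈_

  ≈-refl : ∀ {a} → a ≈ a
  ≈-refl {a} = mk≈ (divides 0ℤ (ℤₚ.+-inverseʳ a))

  ≈-reflexive : ∀ {a b} → a ≡ b → a ≈ b
  ≈-reflexive refl = ≈-refl

  ≈-sym : ∀ {a b} → a ≈ b → b ≈ a
  ≈-sym {a} {b} (mk≈ d) = mk≈ (subst (L ∣ₛ_) (l a b) (∣m⇒∣-m d))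
    where
    l : ∀ a b → - (a - b) ≡ b - a
    l = solve-∀

  ≈-trans : ∀ {a b c} → a ≈ b → b ≈ c → a ≈ c
  ≈-trans {a} {b} {c} (mk≈ d) (mk≈ e) = mk≈ (subst (L ∣ₛ_) (l a b c) (∣m∣n⇒∣m+n d e))
    where
    l : ∀ a b c → (a - b) + (b - c) ≡ a - c
    l = solve-∀

  ≈-+ : ∀ {a b c d} → a ≈ b → c ≈ d → a + c ≈ b + d
  ≈-+ {a} {b} {c} {d} (mk≈ p) (mk≈ q) = mk≈ (subst (L ∣ₛ_) (l a b c d) (∣m∣n⇒∣m+n p q))
    where
    l : ∀ a b c d → (a - b) + (c - d) ≡ a + c - (b + d)
    l = solve-∀

  ≈-neg : ∀ {a b} → a ≈ b → - a ≈ - b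
  ≈-neg {a} {b} (mk≈ d) = mk≈ (subst (L ∣ₛ_) (l a b) (∣m⇒∣-m d))
    where
    l : ∀ a b → - (a - b) ≡ - a - - b
    l = solve-∀

  ≈-* : ∀ {a b c d} → a ≈ b → c ≈ d → a * c ≈ b * d
  ≈-* {a} {b} {c} {d} (mk≈ p) (mk≈ q) = mk≈ (subst (L ∣ₛ_) (l a b c d) (∣m∣n⇒∣m+n (∣m⇒∣m*n c p) (∣n⇒∣m*n b q)))
    where
    l : ∀ a b c d → (a - b) * c + b * (c - d) ≡ a * c - b * d
    l = solve-∀

  Per : (ℤ → ℤ) → Set
  Per g = ∀ {a b} → a ≈ b → g a ≡ g b

  red : ℤ → ℤ
  red t with t %ℕ ℓ ℕ.≤? h
  ... | yes _ = + (t %ℕ ℓ)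
  ... | no _  = + (t %ℕ ℓ) - L

  rem≈ : ∀ t → + (t %ℕ ℓ) ≈ t
  rem≈ t = ≈-sym (mk≈ (divides (t /ℕ ℓ) (trans (cong (_- + (t %ℕ ℓ)) (a≡a%ℕn+[a/ℕn]*n t ℓ)) (l (+ (t %ℕ ℓ)) (t /ℕ ℓ * L)))))
    where
    l : ∀ r q → r + q - r ≡ q
    l = solve-∀

  red≈ : ∀ t → red t ≈ t
  red≈ t with t %ℕ ℓ ℕ.≤? h
  ... | yes _ = rem≈ t
  ... | no _  = mk≈ (subst (L ∣ₛ_) (l (+ (t %ℕ ℓ)) L t) (∣m∣n⇒∣m-n (diff∣ (rem≈ t)) (∣-refl {L})))
    where
    l : ∀ r L t → r - t - L ≡ r - L - t
    l = solve-∀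

  red-range : ∀ t → ∣ red t ∣ ℕ.≤ h
  red-range t with t %ℕ ℓ ℕ.≤? h
  ... | yes p = p
  ... | no ≰ = subst (ℕ._≤ h) (sym (trans (cong ∣_∣ (ℤₚ.m-n≡m⊖n (t %ℕ ℓ) ℓ)) (trans (ℤₚ.∣⊖∣-≤ (ℕₚ.<⇒≤ (n%ℕd<d t ℓ))) refl)))
      (ℕₚ.≤-trans (ℕₚ.∸-monoʳ-≤ ℓ (ℕₚ.≰⇒> ≰)) (ℕₚ.≤-reflexive (ℕₚ.m+n∸m≡n h h)))

  rs-unique : ∀ {a b} → ∣ a ∣ ℕ.≤ h → ∣ b ∣ ℕ.≤ h → a ≈ b → a ≡ b
  rs-unique {a} {b} p q (mk≈ d) with ∣ a - b ∣ in eq | ∣⇒∣ᵤ d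
  ... | zero  | _ = ℤₚ.i-j≡0⇒i≡j a b (ℤₚ.∣i∣≡0⇒i≡0 eq)
  ... | suc k | dv = contradiction (ℕₚ.≤-trans (ℕ∣.∣⇒≤ dv) (subst (ℕ._≤ h ℕ.+ h) eq (ℕₚ.≤-trans (ℤₚ.∣i-j∣≤∣i∣+∣j∣ a b) (ℕₚ.+-mono-≤ p q)))) (ℕₚ.<⇒≱ (ℕₚ.n<1+n (h ℕ.+ h)))

  ∑-reindex : ∀ g → Per g → ∀ φ ψ → (∀ {a b} → a ≈ b → φ a ≈ φ b) → (∀ {a b} → a ≈ b → ψ a ≈ ψ b) →
              (∀ u → ψ (φ u) ≈ u) → (∀ u → φ (ψ u) ≈ u) → ∑ Rs (λ u → g (φ u)) ≡ ∑ Rs g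
  ∑-reindex g per φ ψ φc ψc ψφ φψ = ∑-bij F F β (λ u → g (φ u)) g (λ {u} _ → per (≈-sym (red≈ (φ u))))
    where
    F = finite-symInterval h
    β : Bij (λ u → ∣ u ∣ ℕ.≤ h) (λ u → ∣ u ∣ ℕ.≤ h)
    β = record { to = red ∘ φ ; from = red ∘ ψ ; to-ok = λ {u} _ → red-range (φ u) ; from-ok = λ {u} _ → red-range (ψ u)
      ; from∘to = λ {u} p → rs-unique (red-range (ψ (red (φ u)))) p (≈-trans (red≈ _) (≈-trans (ψc (red≈ (φ u))) (ψφ u)))
      ; to∘from = λ {u} p → rs-unique (red-range (φ (red (ψ u)))) p (≈-trans (red≈ _) (≈-trans (φc (red≈ (ψ u))) (φψ u))) }

  ∑-shift : ∀ g → Per g → ∀ c → ∑ Rs (λ u → g (u + c)) ≡ ∑ Rs g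
  ∑-shift g per c = ∑-reindex g per (_+ c) (_- c) (λ d → ≈-+ d ≈-refl) (λ d → ≈-+ d ≈-refl) (λ u → ≈-reflexive (l u c)) (λ u → ≈-reflexive (l₂ u c))
    where
    l : ∀ u c → u + c - c ≡ u
    l = solve-∀
    l₂ : ∀ u c → u - c + c ≡ u
    l₂ = solve-∀

  ¬1≈0 : ¬ L ∣ₛ 1ℤ
  ¬1≈0 d = L∤2 (∣-trans d (divides (+ 2) refl))

  inverse : ∀ a → ¬ L ∣ₛ a → ∃ λ b → a * b ≈ 1ℤ
  inverse a nd = let (b , e) = inv-rem in b , ≈-trans (≈-* (≈-sym (rem≈ a)) (≈-refl {b})) e
    where
    r₀ = a %ℕ ℓ
    r≢0 : r₀ ≢ 0
    r≢0 e = nd (subst (L ∣ₛ_) (l a) (diff∣ (≈-sym (subst (λ r → + r ≈ a) e (rem≈ a)))))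
      where
      l : ∀ a → a - 0ℤ ≡ a
      l = solve-∀
    inv-rem : ∃ λ b → + r₀ * b ≈ 1ℤ
    inv-rem with coprime-Bézout (prime⇒coprime prime {{ℕ.≢-nonZero r≢0}} (n%ℕd<d a ℓ))
    ... | Bézout.+- x y e = - (+ y) , mk≈ (divides (- (+ x)) (trans (l (+ r₀) (+ y)) (trans (cong -_ (sym (eqℤ e))) (ℤₚ.neg-distribˡ-* (+ x) L))))
      where
      l : ∀ r y → r * - y - 1ℤ ≡ - (1ℤ + y * r)
      l = solve-∀
      eqℤ : 1 ℕ.+ y ℕ.* r₀ ≡ x ℕ.* ℓ → + x * L ≡ 1ℤ + + y * + r₀
      eqℤ e = trans (sym (ℤₚ.pos-* x ℓ)) (trans (cong +_ (sym e)) (cong (_+_ 1ℤ) (ℤₚ.pos-* y r₀)))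
    ... | Bézout.-+ x y e = + y , mk≈ (divides (+ x) (trans (cong (_- 1ℤ) (trans (ℤₚ.*-comm (+ r₀) (+ y)) (sym (eqℤ e)))) (l (+ x * L))))
      where
      l : ∀ t → 1ℤ + t - 1ℤ ≡ t
      l = solve-∀
      eqℤ : 1 ℕ.+ x ℕ.* ℓ ≡ y ℕ.* r₀ → 1ℤ + + x * L ≡ + y * + r₀
      eqℤ e = trans (cong (_+_ 1ℤ) (sym (ℤₚ.pos-* x ℓ))) (trans (cong +_ e) (ℤₚ.pos-* y r₀))

  ∑-unit : ∀ g → Per g → ∀ a → ¬ L ∣ₛ a → ∑ Rs (λ u → g (a * u)) ≡ ∑ Rs g
  ∑-unit g per a nd = let (b , e) = inverse a nd in
    ∑-reindex g per (a *_) (b *_) (λ d → ≈-* (≈-refl {a}) d) (λ d → ≈-* (≈-refl {b}) d)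
      (λ u → ≈-trans (≈-reflexive (l a b u)) (≈-trans (≈-* e (≈-refl {u})) (≈-reflexive (ℤₚ.*-identityˡ u))))
      (λ u → ≈-trans (≈-reflexive (l₂ a b u)) (≈-trans (≈-* e (≈-refl {u})) (≈-reflexive (ℤₚ.*-identityˡ u))))
    where
    l : ∀ a b u → b * (a * u) ≡ a * b * u
    l = solve-∀
    l₂ : ∀ a b u → a * (b * u) ≡ a * b * u
    l₂ = solve-∀

  ind : ℤ → ℤ
  ind t = ⟦ L ∣ₛ? t ⟧

  ind-cong : ∀ {a b} → (L ∣ₛ a → L ∣ₛ b) → (L ∣ₛ b → L ∣ₛ a) → ind a ≡ ind b
  ind-cong {a} {b} = ⟦⟧-cong (L ∣ₛ? a) (L ∣ₛ? b)

  ind-per : Per ind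
  ind-per d = ind-cong (∣-resp (diff∣ (≈-sym d))) (∣-resp (diff∣ d))

  ind-neg : ∀ a b → - a ≡ b → ind a ≡ ind b
  ind-neg a b e = ind-cong (λ d → subst (L ∣ₛ_) e (∣m⇒∣-m d)) (λ d → subst (L ∣ₛ_) (trans (cong -_ (sym e)) (ℤₚ.neg-involutive a)) (∣m⇒∣-m d))

  ∑-upTo-1 : ∀ n → ∑ (applyUpTo id n) (λ _ → 1ℤ) ≡ + n
  ∑-upTo-1 zero = refl
  ∑-upTo-1 (suc n) = trans (∑-last n (λ _ → 1ℤ)) (trans (cong (_+ 1ℤ) (∑-upTo-1 n)) (cong +_ (ℕₚ.+-comm n 1)))

  ∑-Rs-1 : ∑ Rs (λ _ → 1ℤ) ≡ L
  ∑-Rs-1 = trans (∑-symInterval h (λ _ → 1ℤ)) (trans (cong (_+_ 1ℤ) (trans (∑-const (applyUpTo id h) (+ 2)) (trans (cong (_* + 2) (∑-upTo-1 h)) (ℤₚ.*-comm (+ h) (+ 2))))) (sym L≡1+2h))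

  ∑-Rs-const : ∀ c → ∑ Rs (λ _ → c) ≡ L * c
  ∑-Rs-const c = trans (∑-const Rs c) (cong (_* c) ∑-Rs-1)

  ind-unit : ∀ s → ∣ s ∣ ℕ.≤ h → s ≢ 0ℤ → ind s ≡ 0ℤ
  ind-unit s p ne = ⟦⟧-no (L ∣ₛ? s) (λ d → ne (small-unit s p d))

  0∈ : L ∣ₛ 0ℤ
  0∈ = divides 0ℤ refl

  ∑-ind-* : ∀ g → Per g → ∑ Rs (λ u → ind u * g u) ≡ g 0ℤ
  ∑-ind-* g per = trans (∑-symInterval h (λ u → ind u * g u)) (trans (cong₂ _+_ (trans (cong (_* g 0ℤ) (⟦⟧-yes (L ∣ₛ? 0ℤ) 0∈)) (ℤₚ.*-identityˡ (g 0ℤ)))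
      (trans (∑-cong∈ (applyUpTo id h) (λ {i} i∈ → cong₂ _+_ (trans (cong (_* g (+ suc i)) (ind-unit (+ suc i) (lt i∈) λ ())) refl) (trans (cong (_* g -[1+ i ]) (ind-unit -[1+ i ] (lt i∈) λ ())) refl)))
        (∑-0 (applyUpTo id h)))) (ℤₚ.+-identityʳ (g 0ℤ)))
    where
    lt : ∀ {i} → i ∈ applyUpTo id h → suc i ℕ.≤ h
    lt m with ∈-applyUpTo⁻ id m
    ... | i , i<h , refl = i<h

  ∑-pick : ∀ g → Per g → ∀ c → ∑ Rs (λ u → ind (u - c) * g u) ≡ g c
  ∑-pick g per c = trans (sym (∑-shift (λ u → ind (u - c) * g u) (λ d → cong₂ _*_ (ind-per (≈-+ d ≈-refl)) (per d)) c))
    (trans (∑-cong Rs (λ u → cong (λ t → ind t * g (u + c)) (l u c))) (trans (∑-ind-* (λ u → g (u + c)) (λ d → per (≈-+ d ≈-refl))) (cong g (ℤₚ.+-identityˡ c))))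
    where
    l : ∀ u c → u + c - c ≡ u
    l = solve-∀

  ∑-ind : ∀ c → ∑ Rs (λ u → ind (u - c)) ≡ 1ℤ
  ∑-ind c = trans (∑-cong Rs (λ u → sym (ℤₚ.*-identityʳ (ind (u - c))))) (∑-pick (λ _ → 1ℤ) (λ _ → refl) c)

  ∑-split0 : ∀ g → Per g → ∑ Rs g ≡ g 0ℤ + ∑ Rs (λ u → (1ℤ - ind u) * g u)
  ∑-split0 g per = trans (∑-cong Rs (λ u → l (ind u) (g u))) (trans (∑-+ Rs (λ u → ind u * g u) (λ u → (1ℤ - ind u) * g u)) (cong (_+ ∑ Rs (λ u → (1ℤ - ind u) * g u)) (∑-ind-* g per)))
    where
    l : ∀ i g → g ≡ i * g + (1ℤ - i) * g
    l = solve-∀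

  ∑-units-1 : ∑ Rs (λ u → 1ℤ - ind u) ≡ L - 1ℤ
  ∑-units-1 = trans (∑-- Rs (λ _ → 1ℤ) ind) (cong₂ _-_ ∑-Rs-1 (trans (∑-cong Rs (λ u → sym (ℤₚ.*-identityʳ (ind u)))) (∑-ind-* (λ _ → 1ℤ) (λ _ → refl))))

  unit-term : ∀ u x y → (¬ L ∣ₛ u → x ≡ y) → (1ℤ - ind u) * x ≡ (1ℤ - ind u) * y
  unit-term u x y f with L ∣ₛ? u
  ... | yes _ = refl
  ... | no nd = cong (1ℤ *_) (f nd)

  -- t² − τ² = (t − τ)(t + τ): the hyperbola.
  hyperbola : ∀ g → Per g → ∑ Rs (λ t → ∑ Rs (λ τ → g (t * t - τ * τ))) ≡ L * g 0ℤ + (L - 1ℤ) * ∑ Rs g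
  hyperbola g per = begin
    ∑ Rs (λ t → ∑ Rs (λ τ → g (t * t - τ * τ)))            ≡⟨ ∑-swap Rs Rs (λ t τ → g (t * t - τ * τ)) ⟩
    ∑ Rs (λ τ → ∑ Rs (λ t → g (t * t - τ * τ)))
      ≡⟨ ∑-cong Rs (λ τ → sym (∑-shift (λ t → g (t * t - τ * τ)) (λ d → per (≈-+ (≈-* d d) ≈-refl)) τ)) ⟩
    ∑ Rs (λ τ → ∑ Rs (λ t → g ((t + τ) * (t + τ) - τ * τ))) ≡⟨ ∑-cong Rs (λ τ → ∑-cong Rs (λ t → cong g (l t τ))) ⟩
    ∑ Rs (λ τ → ∑ Rs (λ t → g (+ 2 * t * τ + t * t)))      ≡⟨ ∑-swap Rs Rs (λ τ t → g (+ 2 * t * τ + t * t)) ⟩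
    -- After the shift the argument is affine in `τ`: for `t ≢ 0` it takes every residue once, for
    -- `t ≡ 0` it is constantly 0.
    ∑ Rs F                                                 ≡⟨ ∑-split0 F F-per ⟩
    F 0ℤ + ∑ Rs (λ t → (1ℤ - ind t) * F t)
      ≡⟨ cong₂ _+_ (trans (∑-cong Rs (λ τ → cong g (l₂ τ))) (∑-Rs-const (g 0ℤ))) (∑-cong Rs (λ t → unit-term t (F t) (∑ Rs g) (F-unit t))) ⟩
    L * g 0ℤ + ∑ Rs (λ t → (1ℤ - ind t) * ∑ Rs g)          ≡⟨ cong (_+_ (L * g 0ℤ)) (trans (∑-*ʳ Rs (∑ Rs g) (λ t → 1ℤ - ind t)) (cong (_* ∑ Rs g) ∑-units-1)) ⟩
    L * g 0ℤ + (L - 1ℤ) * ∑ Rs g ∎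
    where
    open ≡-Reasoning
    F : ℤ → ℤ
    F t = ∑ Rs (λ τ → g (+ 2 * t * τ + t * t))
    F-per : Per F
    F-per d = ∑-cong Rs (λ τ → per (≈-+ (≈-* (≈-* (≈-refl {+ 2}) d) (≈-refl {τ})) (≈-* d d)))
    l : ∀ t τ → (t + τ) * (t + τ) - τ * τ ≡ + 2 * t * τ + t * t
    l = solve-∀
    l₂ : ∀ τ → + 2 * 0ℤ * τ + 0ℤ * 0ℤ ≡ 0ℤ
    l₂ = solve-∀
    F-unit : ∀ t → ¬ L ∣ₛ t → F t ≡ ∑ Rs g
    F-unit t nd = trans (∑-unit (λ u → g (u + t * t)) (λ d → per (≈-+ d ≈-refl)) (+ 2 * t) (λ d → [ L∤2 , nd ] (euclid (+ 2) t d))) (∑-shift g per (t * t))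

  -- `η` is the quadratic character, as the number of square roots minus 1. Summation over `a − u²`
  -- turns `δ` into `ℓη` and `η` into `εδ`, so point counts follow by induction on the dimension,
  -- without Gauss sums.
  N₁ η δ : ℤ → ℤ
  N₁ a = ∑ Rs (λ u → ind (u * u - a))
  η a = N₁ a - 1ℤ
  δ a = L * ind a - 1ℤ

  N₁-per : Per N₁
  N₁-per d = ∑-cong Rs (λ u → ind-per (≈-+ (≈-refl {u * u}) (≈-neg d)))

  ∑-δ : ∀ a → ∑ Rs (λ u → δ (a - u * u)) ≡ L * η a
  ∑-δ a = trans (∑-- Rs (λ u → L * ind (a - u * u)) (λ _ → 1ℤ)) (trans (cong₂ _-_ (trans (∑-*ˡ Rs L (λ u → ind (a - u * u)))
      (cong (L *_) (∑-cong Rs (λ u → ind-neg (a - u * u) (u * u - a) (l a (u * u)))))) ∑-Rs-1) (l₂ L (N₁ a)))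
    where
    l : ∀ a b → - (a - b) ≡ b - a
    l = solve-∀
    l₂ : ∀ L n → L * n - L ≡ L * (n - 1ℤ)
    l₂ = solve-∀

  -- `N₁ (u² − a)` counts the `w` with `u² − w² = a`, so the sum counts the points of a hyperbola.
  ∑-η' : ∀ a → ∑ Rs (λ u → η (u * u - a)) ≡ δ a
  ∑-η' a = begin
    ∑ Rs (λ u → N₁ (u * u - a) - 1ℤ)                           ≡⟨ ∑-- Rs (λ u → N₁ (u * u - a)) (λ _ → 1ℤ) ⟩
    ∑ Rs (λ u → ∑ Rs (λ w → ind (w * w - (u * u - a)))) - ∑ Rs (λ _ → 1ℤ)
      ≡⟨ cong₂ _-_ (∑-cong Rs (λ u → ∑-cong Rs (λ w → ind-neg (w * w - (u * u - a)) ((u * u - w * w) - a) (l (w * w) (u * u) a)))) ∑-Rs-1 ⟩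
    ∑ Rs (λ u → ∑ Rs (λ w → ind ((u * u - w * w) - a))) - L     ≡⟨ cong (_- L) (hyperbola (λ s → ind (s - a)) (λ d → ind-per (≈-+ d ≈-refl))) ⟩
    L * ind (0ℤ - a) + (L - 1ℤ) * ∑ Rs (λ s → ind (s - a)) - L  ≡⟨ cong₂ (λ x y → L * x + (L - 1ℤ) * y - L) (ind-neg (0ℤ - a) a (l₂ a)) (∑-ind a) ⟩
    L * ind a + (L - 1ℤ) * 1ℤ - L                              ≡⟨ l₃ L (ind a) ⟩
    δ a ∎
    where
    open ≡-Reasoning
    l : ∀ w u a → - (w - (u - a)) ≡ (u - w) - a
    l = solve-∀
    l₂ : ∀ a → - (0ℤ - a) ≡ a
    l₂ = solve-∀
    l₃ : ∀ L i → L * i + (L - 1ℤ) * 1ℤ - L ≡ L * i - 1ℤ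
    l₃ = solve-∀

  ∣→≈ : ∀ {a} → L ∣ₛ a → a ≈ 0ℤ
  ∣→≈ {a} d = mk≈ (subst (L ∣ₛ_) (sym (ℤₚ.+-identityʳ a)) d)

  ≈→∣ : ∀ {a} → a ≈ 0ℤ → L ∣ₛ a
  ≈→∣ {a} (mk≈ d) = subst (L ∣ₛ_) (ℤₚ.+-identityʳ a) d

  square-roots : ∀ u v → ¬ L ∣ₛ u → ind (v * v - u * u) ≡ ind (v - u) + ind (v - - u)
  square-roots u v nu with L ∣ₛ? (v - u) | L ∣ₛ? (v - - u)
  ... | yes d | yes e = contradiction ([ (λ d₂ → contradiction d₂ L∤2) , id ] (euclid (+ 2) u (subst (L ∣ₛ_) (l v u) (∣m∣n⇒∣m-n e d)))) nu
    where
    l : ∀ v u → (v - - u) - (v - u) ≡ + 2 * u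
    l = solve-∀
  ... | yes d | no _ = ⟦⟧-yes (L ∣ₛ? (v * v - u * u)) (subst (L ∣ₛ_) (l v u) (∣m⇒∣m*n (v - - u) d))
    where
    l : ∀ v u → (v - u) * (v - - u) ≡ v * v - u * u
    l = solve-∀
  ... | no _ | yes e = ⟦⟧-yes (L ∣ₛ? (v * v - u * u)) (subst (L ∣ₛ_) (l v u) (∣n⇒∣m*n (v - u) e))
    where
    l : ∀ v u → (v - u) * (v - - u) ≡ v * v - u * u
    l = solve-∀
  ... | no nd | no ne = ⟦⟧-no (L ∣ₛ? (v * v - u * u)) (λ d → [ nd , ne ] (euclid (v - u) (v - - u) (subst (L ∣ₛ_) (l v u) d)))
    where
    l : ∀ v u → v * v - u * u ≡ (v - u) * (v - - u)
    l = solve-∀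

  N₁-square : ∀ u → ¬ L ∣ₛ u → N₁ (u * u) ≡ + 2
  N₁-square u nu = trans (∑-cong Rs (λ v → square-roots u v nu)) (trans (∑-+ Rs (λ v → ind (v - u)) (λ v → ind (v - - u))) (cong₂ _+_ (∑-ind u) (∑-ind (- u))))

  N₁-0 : ∀ {a} → a ≈ 0ℤ → N₁ a ≡ 1ℤ
  N₁-0 {a} d = trans (∑-cong Rs (λ u → ind-cong
      (λ e → subst (L ∣ₛ_) (sym (ℤₚ.+-identityʳ u)) ([ id , id ] (euclid u u (u*u∣ u e d))))
      (λ e → u²∣ u e d))) (∑-ind 0ℤ)
    where
    u*u∣ : ∀ u → L ∣ₛ u * u - a → a ≈ 0ℤ → L ∣ₛ u * u
    u*u∣ u e d = ∣-resp e (≈→∣ d)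
    u²∣ : ∀ u → L ∣ₛ u - 0ℤ → a ≈ 0ℤ → L ∣ₛ u * u - a
    u²∣ u e d = ∣m∣n⇒∣m-n (∣m⇒∣m*n u (subst (L ∣ₛ_) (ℤₚ.+-identityʳ u) e)) (≈→∣ d)

  η-0 : ∀ {a} → a ≈ 0ℤ → η a ≡ 0ℤ
  η-0 d = cong (_- 1ℤ) (N₁-0 d)

  search : ∀ {P : ℤ → Set} → (∀ u → Dec (P u)) → (xs : List ℤ) → (∃ λ u → P u) ⊎ (∀ u → u ∈ xs → ¬ P u)
  search P? [] = inj₂ (λ u ())
  search P? (x ∷ xs) with P? x | search P? xs
  ... | yes p | _ = inj₁ (x , p)
  ... | no _ | inj₁ r = inj₁ r
  ... | no np | inj₂ q = inj₂ λ { u (here refl) → np ; u (there m) → q u m }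

  root? : ∀ a → (∃ λ u → u * u ≈ a) ⊎ (∀ u → ¬ (u * u ≈ a))
  root? a with search (λ u → L ∣ₛ? (u * u - a)) Rs
  ... | inj₁ (u , d) = inj₁ (u , mk≈ d)
  ... | inj₂ q = inj₂ λ u d → q (red u) (complete (finite-symInterval h) (red-range u)) (diff∣ (≈-trans (≈-* (red≈ u) (red≈ u)) d))

  N₁-nonsquare : ∀ a → (∀ u → ¬ (u * u ≈ a)) → N₁ a ≡ 0ℤ
  N₁-nonsquare a q = trans (∑-cong Rs (λ u → ⟦⟧-no (L ∣ₛ? (u * u - a)) (λ d → q u (mk≈ d)))) (∑-0 Rs)

  ∑-nonneg-zero : ∀ (xs : List ℤ) f → (∀ u → 0ℤ ≤ f u) → ∑ xs f ≡ 0ℤ → ∀ {u} → u ∈ xs → f u ≡ 0ℤ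
  ∑-nonneg-zero (x ∷ xs) f pos e m = go m
    where
    ∑≥0 : ∀ ys → 0ℤ ≤ ∑ ys f
    ∑≥0 [] = ℤₚ.≤-refl
    ∑≥0 (y ∷ ys) = ℤₚ.+-mono-≤ (pos y) (∑≥0 ys)
    two : ∀ a b → 0ℤ ≤ a → 0ℤ ≤ b → a + b ≡ 0ℤ → a ≡ 0ℤ × b ≡ 0ℤ
    two (+ zero) (+ zero) _ _ _ = refl , refl
    two (+ zero) (+ suc _) _ _ ()
    two (+ suc _) (+ _) _ _ ()
    parts = two (f x) (∑ xs f) (pos x) (∑≥0 xs) e
    go : ∀ {u} → u ∈ x ∷ xs → f u ≡ 0ℤ
    go (here refl) = proj₁ parts
    go (there m) = ∑-nonneg-zero xs f pos (proj₂ parts) m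

  ∑-N₁ : ∑ Rs N₁ ≡ L
  ∑-N₁ = trans (∑-swap Rs Rs (λ t u → ind (u * u - t))) (trans (∑-cong Rs (λ u → trans (∑-cong Rs (λ t → ind-neg (u * u - t) (t - u * u) (l (u * u) t))) (∑-ind (u * u)))) ∑-Rs-1)
    where
    l : ∀ a b → - (a - b) ≡ b - a
    l = solve-∀

  -- ε = (−1/ℓ)
  ε-exists : ∃ λ ε → ε * ε ≡ 1ℤ × (∀ t → η (- t) ≡ ε * η t)
  ε-exists with root? (- 1ℤ)
  ... | inj₁ (i , ii) = 1ℤ , refl , λ t → trans (cong (_- 1ℤ) (N₁-neg t)) (sym (ℤₚ.*-identityˡ (η t)))
    where
    ¬i : ¬ L ∣ₛ i
    ¬i d = ¬1≈0 (subst (L ∣ₛ_) refl (∣m⇒∣-m (≈→∣ (≈-trans (≈-sym ii) (∣→≈ (∣m⇒∣m*n i d))))))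
    N₁-neg : ∀ t → N₁ (- t) ≡ N₁ t
    N₁-neg t = trans (sym (∑-unit (λ u → ind (u * u - - t)) (λ d → ind-per (≈-+ (≈-* d d) ≈-refl)) i ¬i))
      (∑-cong Rs (λ u → trans (ind-per (≈-trans (≈-reflexive (l i u t)) (≈-+ (≈-* ii (≈-refl {u * u})) (≈-refl {t})))) (ind-neg (- 1ℤ * (u * u) + t) (u * u - t) (l₂ (u * u) t))))
      where
      l : ∀ i u t → (i * u) * (i * u) - - t ≡ i * i * (u * u) + t
      l = solve-∀
      l₂ : ∀ a t → - (- 1ℤ * a + t) ≡ a - t
      l₂ = solve-∀
  ... | inj₂ no-i = - 1ℤ , refl , λ t → l (N₁ (- t)) (N₁ t) (sum2 t)
    where
    l : ∀ a b → + 2 - b - a ≡ 0ℤ → a - 1ℤ ≡ - 1ℤ * (b - 1ℤ)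
    l a b e = trans (l₁ a b) (trans (cong (λ z → (1ℤ - b) - z) e) (l₂ b))
      where
      l₁ : ∀ a b → a - 1ℤ ≡ (1ℤ - b) - (+ 2 - b - a)
      l₁ = solve-∀
      l₂ : ∀ b → (1ℤ - b) - 0ℤ ≡ - 1ℤ * (b - 1ℤ)
      l₂ = solve-∀
    defect : ℤ → ℤ
    defect t = + 2 - N₁ t - N₁ (- t)
    both : ∀ t u v → ¬ L ∣ₛ t → u * u ≈ t → v * v ≈ - t → ⊥
    both t u v nt p q = let (w , e) = inverse v nv in no-i (u * w) (≈-trans (≈-reflexive (k₁ u w)) (≈-trans (≈-* p (≈-refl {w * w}))
        (≈-trans (≈-reflexive (k₂ t w)) (≈-trans (≈-neg (≈-* (≈-sym q) (≈-refl {w * w}))) (≈-trans (≈-reflexive (k₃ v w)) (≈-neg (≈-* e e)))))))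
      where
      nv : ¬ L ∣ₛ v
      nv d = nt (subst (L ∣ₛ_) (ℤₚ.neg-involutive t) (∣m⇒∣-m (≈→∣ (≈-trans (≈-sym q) (∣→≈ (∣m⇒∣m*n v d))))))
      k₁ : ∀ u w → u * w * (u * w) ≡ u * u * (w * w)
      k₁ = solve-∀
      k₂ : ∀ t w → t * (w * w) ≡ - (- t * (w * w))
      k₂ = solve-∀
      k₃ : ∀ v w → - (v * v * (w * w)) ≡ - (v * w * (v * w))
      k₃ = solve-∀
    N₁-root : ∀ t u → ¬ L ∣ₛ t → u * u ≈ t → N₁ t ≡ + 2
    N₁-root t u nt p = trans (N₁-per (≈-sym p)) (N₁-square u (λ d → nt (≈→∣ (≈-trans (≈-sym p) (∣→≈ (∣m⇒∣m*n u d))))))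
    ¬-neg : ∀ t → ¬ L ∣ₛ t → ¬ L ∣ₛ - t
    ¬-neg t nt d = nt (subst (L ∣ₛ_) (ℤₚ.neg-involutive t) (∣m⇒∣-m d))
    2-0-0 : ∀ {x y a b} → x ≡ a → y ≡ b → 0ℤ ≤ + 2 - a - b → 0ℤ ≤ + 2 - x - y
    2-0-0 refl refl p = p
    defect≥0 : ∀ t → 0ℤ ≤ defect t
    defect≥0 t with L ∣ₛ? t
    ... | yes d = 2-0-0 (N₁-0 (∣→≈ d)) (N₁-0 (∣→≈ (∣m⇒∣-m d))) (+≤+ ℕ.z≤n)
    ... | no nt with root? t | root? (- t)
    ...   | inj₁ (u , p) | inj₁ (v , q) = ⊥-elim (both t u v nt p q)
    ...   | inj₁ (u , p) | inj₂ nq = 2-0-0 (N₁-root t u nt p) (N₁-nonsquare (- t) nq) (+≤+ ℕ.z≤n)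
    ...   | inj₂ np | inj₁ (v , q) = 2-0-0 (N₁-nonsquare t np) (N₁-root (- t) v (¬-neg t nt) q) (+≤+ ℕ.z≤n)
    ...   | inj₂ np | inj₂ nq = 2-0-0 (N₁-nonsquare t np) (N₁-nonsquare (- t) nq) (+≤+ ℕ.z≤n)
    ∑-defect : ∑ Rs defect ≡ 0ℤ
    ∑-defect = trans (∑-- Rs (λ t → + 2 - N₁ t) (λ t → N₁ (- t))) (trans (cong₂ _-_ (trans (∑-- Rs (λ _ → + 2) N₁) (cong₂ _-_ (∑-Rs-const (+ 2)) ∑-N₁))
        (trans (∑-reindex N₁ N₁-per -_ -_ ≈-neg ≈-neg (λ u → ≈-reflexive (ℤₚ.neg-involutive u)) (λ u → ≈-reflexive (ℤₚ.neg-involutive u))) ∑-N₁)) (k L))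
      where
      k : ∀ L → L * + 2 - L - L ≡ 0ℤ
      k = solve-∀
    sum2 : ∀ t → defect t ≡ 0ℤ
    sum2 t = trans (cong₂ (λ a b → + 2 - a - b) (N₁-per (≈-sym (red≈ t))) (N₁-per (≈-neg (≈-sym (red≈ t)))))
      (∑-nonneg-zero Rs defect defect≥0 ∑-defect {red t} (complete (finite-symInterval h) (red-range t)))

  SumV-- : ∀ k (f g : V k → ℤ) → SumV k (λ x → f x - g x) ≡ SumV k f - SumV k g
  SumV-- zero f g = refl
  SumV-- (suc k) f g = trans (∑-cong Rs (λ a → SumV-- k (λ x → f (a ∷ x)) (λ x → g (a ∷ x)))) (∑-- Rs (λ a → SumV k (λ x → f (a ∷ x))) (λ a → SumV k (λ x → g (a ∷ x))))

  SumV-∑ : ∀ {A : Set} k (xs : List A) (f : A → V k → ℤ) → SumV k (λ z → ∑ xs (λ a → f a z)) ≡ ∑ xs (λ a → SumV k (f a))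
  SumV-∑ zero xs f = refl
  SumV-∑ (suc k) xs f = trans (∑-cong Rs (λ b → SumV-∑ k xs (λ a z → f a (b ∷ z)))) (∑-swap Rs xs (λ b a → SumV k (λ z → f a (b ∷ z))))

  SumZ-cong : ∀ k {f g : V k → ℤ} → (∀ x → f x ≡ g x) → SumZ k f ≡ SumZ k g
  SumZ-cong zero e = refl
  SumZ-cong (suc k) e = cong₂ _+_ (SumZ-cong k (λ x → e (0ℤ ∷ x))) (SumV-cong k (λ x → e (1ℤ ∷ x)))

  SumZ-- : ∀ k (f g : V k → ℤ) → SumZ k (λ x → f x - g x) ≡ SumZ k f - SumZ k g
  SumZ-- zero f g = refl
  SumZ-- (suc k) f g = trans (cong₂ _+_ (SumZ-- k (λ x → f (0ℤ ∷ x)) (λ x → g (0ℤ ∷ x))) (SumV-- k (λ x → f (1ℤ ∷ x)) (λ x → g (1ℤ ∷ x))))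
      (l (SumZ k (λ x → f (0ℤ ∷ x))) (SumZ k (λ x → g (0ℤ ∷ x))) (SumV k (λ x → f (1ℤ ∷ x))) (SumV k (λ x → g (1ℤ ∷ x))))
    where
    l : ∀ a b c d → (a - b) + (c - d) ≡ (a + c) - (b + d)
    l = solve-∀

  SumZ-*ˡ : ∀ k c (f : V k → ℤ) → SumZ k (λ x → c * f x) ≡ c * SumZ k f
  SumZ-*ˡ zero c f = sym (ℤₚ.*-zeroʳ c)
  SumZ-*ˡ (suc k) c f = trans (cong₂ _+_ (SumZ-*ˡ k c (λ x → f (0ℤ ∷ x))) (SumV-*ˡ k c (λ x → f (1ℤ ∷ x)))) (sym (ℤₚ.*-distribˡ-+ c _ _))

  SumZ-∑ : ∀ {A : Set} k (xs : List A) (f : A → V k → ℤ) → SumZ k (λ z → ∑ xs (λ a → f a z)) ≡ ∑ xs (λ a → SumZ k (f a))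
  SumZ-∑ zero xs f = sym (∑-0 xs)
  SumZ-∑ (suc k) xs f = trans (cong₂ _+_ (SumZ-∑ k xs (λ a z → f a (0ℤ ∷ z))) (SumV-∑ k xs (λ a z → f a (1ℤ ∷ z))))
    (sym (∑-+ xs (λ a → SumZ k (λ z → f a (0ℤ ∷ z))) (λ a → SumV k (λ z → f a (1ℤ ∷ z)))))

  SumV-const : ∀ k c → SumV k (λ _ → c) ≡ L ^ᶻ k * c
  SumV-const zero c = sym (ℤₚ.*-identityˡ c)
  SumV-const (suc k) c = trans (∑-cong Rs (λ _ → SumV-const k c)) (trans (∑-Rs-const (L ^ᶻ k * c)) (sym (ℤₚ.*-assoc L (L ^ᶻ k) c)))

  PerV : ∀ {k} → (V k → ℤ) → Set
  PerV g = ∀ {x y} → x ≋ y → g x ≡ g y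

  head-per : ∀ {k} (g : V (suc k) → ℤ) → PerV g → Per (λ a → SumV k (λ z → g (a ∷ z)))
  head-per {k} g per (mk≈ d) = SumV-cong k (λ z → per (d , ≋-refl z))

  SumV-shift : ∀ k (g : V k → ℤ) → PerV g → ∀ w → SumV k (λ z → g (z ⊕ w)) ≡ SumV k g
  SumV-shift zero g per [] = refl
  SumV-shift (suc k) g per (c ∷ w) = trans (∑-cong Rs (λ a → SumV-shift k (λ z → g ((a + c) ∷ z)) (λ e → per (diff∣ (≈-refl {a + c}) , e)) w))
    (∑-shift (λ a → SumV k (λ z → g (a ∷ z))) (head-per g per) c)

  SumV-unit : ∀ k (g : V k → ℤ) → PerV g → ∀ s → ¬ L ∣ₛ s → SumV k (λ z → g (s · z)) ≡ SumV k g
  SumV-unit zero g per s ns = refl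
  SumV-unit (suc k) g per s ns = trans (∑-cong Rs (λ a → SumV-unit k (λ z → g ((s * a) ∷ z)) (λ e → per (diff∣ (≈-refl {s * a}) , e)) s ns))
    (∑-unit (λ a → SumV k (λ z → g (a ∷ z))) (head-per g per) s ns)

  -- Every nonzero vector is `s · z` for exactly one unit `s` and one normalised `z`; the factor
  -- `1 − ind s` restricts the sum to units.
  SumV-lines : ∀ k (g : V k → ℤ) → PerV g → SumV k g ≡ g 𝟘 + SumZ k (λ z → ∑ Rs (λ s → (1ℤ - ind s) * g (s · z)))
  SumV-lines zero g per = sym (ℤₚ.+-identityʳ (g []))
  SumV-lines (suc k) g per = begin
    ∑ Rs G                                           ≡⟨ ∑-split0 G (head-per g per) ⟩
    G 0ℤ + ∑ Rs (λ a → (1ℤ - ind a) * G a)           ≡⟨ cong₂ _+_ (SumV-lines k (λ z → g (0ℤ ∷ z)) (λ e → per (diff∣ (≈-refl {0ℤ}) , e)))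
                                                         (∑-cong Rs (λ a → unit-term a (G a) (SumV k (λ z → g (a · (1ℤ ∷ z)))) (G-unit a))) ⟩
    (g 𝟘 + SumZ k (λ z → ∑ Rs (λ s → (1ℤ - ind s) * g (0ℤ ∷ (s · z))))) + ∑ Rs (λ a → (1ℤ - ind a) * SumV k (λ z → g (a · (1ℤ ∷ z))))
      ≡⟨ cong₂ (λ x y → (g 𝟘 + x) + y)
           (SumZ-cong k (λ z → ∑-cong Rs (λ s → cong (λ t → (1ℤ - ind s) * g (t ∷ (s · z))) (sym (ℤₚ.*-zeroʳ s)))))
           (trans (∑-cong Rs (λ a → sym (SumV-*ˡ k (1ℤ - ind a) (λ z → g (a · (1ℤ ∷ z)))))) (sym (SumV-∑ k Rs (λ a z → (1ℤ - ind a) * g (a · (1ℤ ∷ z)))))) ⟩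
    (g 𝟘 + SumZ k (λ z → ∑ Rs (λ s → (1ℤ - ind s) * g (s · (0ℤ ∷ z))))) + SumV k (λ z → ∑ Rs (λ s → (1ℤ - ind s) * g (s · (1ℤ ∷ z))))
      ≡⟨ ℤₚ.+-assoc (g 𝟘) _ _ ⟩
    g 𝟘 + SumZ (suc k) (λ z → ∑ Rs (λ s → (1ℤ - ind s) * g (s · z))) ∎
    where
    open ≡-Reasoning
    G : ℤ → ℤ
    G a = SumV k (λ z → g (a ∷ z))
    G-unit : ∀ a → ¬ L ∣ₛ a → G a ≡ SumV k (λ z → g (a · (1ℤ ∷ z)))
    G-unit a na = trans (sym (SumV-unit k (λ z → g (a ∷ z)) (λ e → per (diff∣ (≈-refl {a}) , e)) a na))
      (SumV-cong k (λ z → cong (λ t → g (t ∷ (a · z))) (sym (ℤₚ.*-identityʳ a))))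

  ε : ℤ
  ε = proj₁ ε-exists

  ∑-η : ∀ a → ∑ Rs (λ u → η (a - u * u)) ≡ ε * δ a
  ∑-η a = trans (∑-cong Rs (λ u → trans (cong η (l a (u * u))) (proj₂ (proj₂ ε-exists) (u * u - a)))) (trans (∑-*ˡ Rs ε (λ u → η (u * u - a))) (cong (ε *_) (∑-η' a)))
    where
    l : ∀ a b → a - b ≡ - (b - a)
    l = solve-∀

  NK : ∀ k → ℤ → ℤ
  NK k a = SumV k (λ z → ind (z ∙ z - a))

  NK-suc : ∀ k a → NK (suc k) a ≡ ∑ Rs (λ u → NK k (a - u * u))
  NK-suc k a = ∑-cong Rs (λ u → SumV-cong k (λ z → cong ind (l (u * u) (z ∙ z) a)))
    where
    l : ∀ u z a → u + z - a ≡ z - (a - u)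
    l = solve-∀

  pw ew : ℕ → ℤ
  pw j = L ^ᶻ j * L ^ᶻ j
  ew j = (ε * L) ^ᶻ j

  -- Mutual induction, splitting off one coordinate at a time: the main term gains a factor `ℓ` and
  -- the oscillating term alternates between `η` and `δ`.
  NK-odd : ∀ j a → NK (suc (j ℕ.+ j)) a ≡ pw j + ew j * η a
  NK-even : ∀ j a → NK (suc (suc (j ℕ.+ j))) a ≡ L * pw j + ew j * ε * δ a
  NK-odd zero a = trans (∑-cong Rs (λ u → cong (λ t → ind (t - a)) (ℤₚ.+-identityʳ (u * u)))) (l (N₁ a))
    where
    l : ∀ n → n ≡ 1ℤ * 1ℤ + 1ℤ * (n - 1ℤ)
    l = solve-∀
  NK-odd (suc j) a = trans (cong (λ t → NK (suc (suc t)) a) (ℕₚ.+-suc j j)) (trans (NK-suc (suc (suc (j ℕ.+ j))) a)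
    (trans (∑-cong Rs (λ u → NK-even j (a - u * u))) (trans (∑-+ Rs (λ _ → L * pw j) (λ u → ew j * ε * δ (a - u * u)))
      (trans (cong₂ _+_ (∑-Rs-const (L * pw j)) (trans (∑-*ˡ Rs (ew j * ε) (λ u → δ (a - u * u))) (cong (ew j * ε *_) (∑-δ a)))) (l L (L ^ᶻ j) (ew j) ε (η a))))))
    where
    l : ∀ L A E ε n → L * (L * (A * A)) + E * ε * (L * n) ≡ (L * A) * (L * A) + ε * L * E * n
    l = solve-∀
  NK-even j a = trans (NK-suc (suc (j ℕ.+ j)) a) (trans (∑-cong Rs (λ u → NK-odd j (a - u * u))) (trans (∑-+ Rs (λ _ → pw j) (λ u → ew j * η (a - u * u)))
      (cong₂ _+_ (∑-Rs-const (pw j)) (trans (∑-*ˡ Rs (ew j) (λ u → η (a - u * u))) (trans (cong (ew j *_) (∑-η a)) (sym (ℤₚ.*-assoc (ew j) ε (δ a))))))))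

  Lin : ∀ {k} → V k → ℤ → ℤ
  Lin {k} y b = SumV k (λ z → ind (z ∙ y - b))

  -- If the leading entry of `y` is a unit, the first coordinate of `z` is determined by the others;
  -- otherwise it is free, and the count passes to the tail of `y`.
  Lin-formula : ∀ {k} (y : V k) b → ¬ (y ≋ 𝟘) → L * Lin y b ≡ L ^ᶻ k
  Lin-formula [] b ny = contradiction tt ny
  Lin-formula {suc k} (c ∷ y) b ny with L ∣ₛ? c
  ... | no nc = cong (L *_) (trans (sym (SumV-∑ k Rs (λ a z → ind (a * c + z ∙ y - b)))) (trans (SumV-cong k (λ z → one z)) (trans (SumV-const k 1ℤ) (ℤₚ.*-identityʳ (L ^ᶻ k)))))
    where
    l : ∀ a c t b → a * c + t - b ≡ c * a - (b - t)
    l = solve-∀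
    one : ∀ z → ∑ Rs (λ a → ind (a * c + z ∙ y - b)) ≡ 1ℤ
    one z = trans (∑-cong Rs (λ a → cong ind (l a c (z ∙ y) b))) (trans (∑-unit (λ u → ind (u - (b - z ∙ y))) (λ d → ind-per (≈-+ d ≈-refl)) c nc) (∑-ind (b - z ∙ y)))
  ... | yes dc = cong (L *_) (trans (∑-cong Rs (λ a → SumV-cong k (λ z → ind-per (≈-+ (drop a (z ∙ y)) (≈-refl { - b}))))) (trans (∑-Rs-const (Lin y b)) (Lin-formula y b ny')))
    where
    drop : ∀ a t → a * c + t ≈ t
    drop a t = mk≈ (subst (L ∣ₛ_) (l (a * c) t) (∣n⇒∣m*n a dc))
      where
      l : ∀ x t → x ≡ x + t - t
      l = solve-∀
    ny' : ¬ (y ≋ 𝟘)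
    ny' e = ny (subst (L ∣ₛ_) (sym (ℤₚ.+-identityʳ c)) dc , e)

  ind-* : ∀ p q r → (L ∣ₛ p → q ≈ r) → ind p * ind q ≡ ind p * ind r
  ind-* p q r f with L ∣ₛ? p
  ... | yes d = cong (1ℤ *_) (ind-per (f d))
  ... | no _ = refl

  ∙-shift : ∀ {k} (y z : V k) τ → (z ⊕ τ · y) ∙ (z ⊕ τ · y) ≡ z ∙ z + + 2 * τ * (z ∙ y) + τ * τ * (y ∙ y)
  ∙-shift y z τ = trans (∙-⊕ˡ (z ⊕ τ · y) z (τ · y)) (trans (cong₂ _+_ (trans (∙-⊕ʳ z z (τ · y)) (cong (_+_ (z ∙ z)) (∙-·ʳ τ z y)))
      (trans (∙-·ˡ τ (z ⊕ τ · y) y) (cong (τ *_) (trans (∙-⊕ʳ y z (τ · y)) (cong₂ _+_ (∙-comm y z) (∙-·ʳ τ y y)))))) (l (z ∙ z) (z ∙ y) (y ∙ y) τ))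
    where
    l : ∀ a b c t → (a + t * b) + t * (b + t * c) ≡ a + + 2 * t * b + t * t * c
    l = solve-∀

  ≋⇒∙≈ : ∀ {k} (w : V k) {x y : V k} → x ≋ y → x ∙ w ≈ y ∙ w
  ≋⇒∙≈ w {x} {y} e = mk≈ (subst (L ∣ₛ_) (cong₂ _-_ (∙-comm w x) (∙-comm w y)) (≋-∙ w e))

  ≋⇒norm≈ : ∀ {k} {x y : V k} → x ≋ y → x ∙ x ≈ y ∙ y
  ≋⇒norm≈ {x = x} {y} e = ≈-trans (≋⇒∙≈ x e) (≈-trans (≈-reflexive (∙-comm y x)) (≋⇒∙≈ y e))

  -- Finds how many isotropic `z` are orthogonal to `y`. Translations `z ↦ z + τy` relate the counts
  -- `Dd b c`; they replace the splitting into `y` and its complement, which fails for isotropic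
  -- `y`.
  module Quadric {k : ℕ} (y : V k) (ny : ¬ (y ≋ 𝟘)) where

    a₀ : ℤ
    a₀ = y ∙ y

    Dd : ℤ → ℤ → ℤ
    Dd b c = SumV k (λ z → ind (z ∙ y - b) * ind (z ∙ z - c))

    Dd-per : ∀ {b b' c c'} → b ≈ b' → c ≈ c' → Dd b c ≡ Dd b' c'
    Dd-per p q = SumV-cong k (λ z → cong₂ _*_ (ind-per (≈-+ (≈-refl {z ∙ y}) (≈-neg p))) (ind-per (≈-+ (≈-refl {z ∙ z}) (≈-neg q))))

    ∑-ind' : ∀ x → ∑ Rs (λ c → ind (x - c)) ≡ 1ℤ
    ∑-ind' x = trans (∑-cong Rs (λ c → ind-neg (x - c) (c - x) (l x c))) (∑-ind x)
      where
      l : ∀ x c → - (x - c) ≡ c - x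
      l = solve-∀

    ∑-Dd-c : ∀ b → ∑ Rs (Dd b) ≡ Lin y b
    ∑-Dd-c b = trans (sym (SumV-∑ k Rs (λ c z → ind (z ∙ y - b) * ind (z ∙ z - c)))) (SumV-cong k (λ z →
      trans (∑-*ˡ Rs (ind (z ∙ y - b)) (λ c → ind (z ∙ z - c))) (trans (cong (ind (z ∙ y - b) *_) (∑-ind' (z ∙ z))) (ℤₚ.*-identityʳ _))))

    ∑-Dd-b : ∀ c → ∑ Rs (λ b → Dd b c) ≡ NK k c
    ∑-Dd-b c = trans (sym (SumV-∑ k Rs (λ b z → ind (z ∙ y - b) * ind (z ∙ z - c)))) (SumV-cong k (λ z →
      trans (∑-*ʳ Rs (ind (z ∙ z - c)) (λ b → ind (z ∙ y - b))) (trans (cong (_* ind (z ∙ z - c)) (∑-ind' (z ∙ y))) (ℤₚ.*-identityˡ _))))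

    Dd-shift : ∀ b c τ → Dd b c ≡ Dd (b + τ * a₀) (c + + 2 * τ * b + τ * τ * a₀)
    Dd-shift b c τ = sym (trans (sym (SumV-shift k (λ z → ind (z ∙ y - b') * ind (z ∙ z - c'))
        (λ e → cong₂ _*_ (ind-per (≈-+ (≋⇒∙≈ y e) (≈-refl { - b'}))) (ind-per (≈-+ (≋⇒norm≈ e) (≈-refl { - c'})))) (τ · y)))
      (SumV-cong k (λ z → trans (cong₂ (λ u v → ind (u - b') * ind (v - c')) (trans (∙-⊕ˡ y z (τ · y)) (cong (_+_ (z ∙ y)) (∙-·ˡ τ y y))) (∙-shift y z τ))
        (trans (cong (λ u → ind u * ind (z ∙ z + + 2 * τ * (z ∙ y) + τ * τ * a₀ - c')) (l (z ∙ y) (τ * a₀) b))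
          (ind-* (z ∙ y - b) _ _ (λ d → mk≈ (subst (L ∣ₛ_) (l₂ τ (z ∙ y) b (z ∙ z) (τ * τ * a₀) c) (∣n⇒∣m*n (+ 2 * τ) d))))))))
      where
      b' = b + τ * a₀
      c' = c + + 2 * τ * b + τ * τ * a₀
      l : ∀ p t b → p + t - (b + t) ≡ p - b
      l = solve-∀
      l₂ : ∀ τ p b n t c → + 2 * τ * (p - b) ≡ (n + + 2 * τ * p + t - (c + + 2 * τ * b + t)) - (n - c)
      l₂ = solve-∀

    module Odd (j : ℕ) (k≡ : k ≡ suc (j ℕ.+ j)) where

      NK-formula : ∀ a → NK k a ≡ pw j + ew j * η a
      NK-formula a = trans (cong (λ t → NK t a) k≡) (NK-odd j a)

      Lin≡ : ∀ b → Lin y b ≡ pw j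
      Lin≡ b = ℤₚ.*-cancelˡ-≡ L _ _ (trans (Lin-formula y b ny) (trans (cong (L ^ᶻ_) k≡) (cong (L *_) (ℤₚ.^-distribˡ-+-* L j j))))

      -- For `b ≢ 0` the translation fixes `z ∙ y = b` and moves `z ∙ z` by `2τb`, so all norms are
      -- equally frequent on that hyperplane.
      iso-case : a₀ ≈ 0ℤ → L * (NK k 0ℤ - Dd 0ℤ 0ℤ) ≡ (L - 1ℤ) * pw j
      iso-case a≈0 = trans (ℤₚ.*-distribˡ-+ L (NK k 0ℤ) (- Dd 0ℤ 0ℤ)) (trans (cong (_+ L * - Dd 0ℤ 0ℤ) total) (l (L * Dd 0ℤ 0ℤ) L (Dd 0ℤ 0ℤ) ((L - 1ℤ) * pw j) refl))
        where
        l : ∀ x L d t → x ≡ L * d → x + t + L * - d ≡ t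
        l x L d t refl = l' L d t
          where
          l' : ∀ L d t → L * d + t + L * - d ≡ t
          l' = solve-∀
        each : ∀ b → ¬ L ∣ₛ b → L * Dd b 0ℤ ≡ pw j
        each b nb = trans (sym (∑-Rs-const (Dd b 0ℤ))) (trans (∑-cong Rs (λ τ → trans (Dd-shift b 0ℤ τ)
            (Dd-per (≈-trans (≈-+ (≈-refl {b}) (≈-* (≈-refl {τ}) a≈0)) (≈-reflexive (l₁ b τ))) (≈-trans (≈-+ (≈-refl {0ℤ + + 2 * τ * b}) (≈-* (≈-refl {τ * τ}) a≈0)) (≈-reflexive (l₂ b τ))))))
          (trans (∑-unit (Dd b) (λ d → Dd-per (≈-refl {b}) d) (+ 2 * b) (λ d → [ L∤2 , nb ] (euclid (+ 2) b d))) (trans (∑-Dd-c b) (Lin≡ b))))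
          where
          l₁ : ∀ b τ → b + τ * 0ℤ ≡ b
          l₁ = solve-∀
          l₂ : ∀ b τ → 0ℤ + + 2 * τ * b + τ * τ * 0ℤ ≡ + 2 * b * τ
          l₂ = solve-∀
        total : L * NK k 0ℤ ≡ L * Dd 0ℤ 0ℤ + (L - 1ℤ) * pw j
        total = trans (cong (L *_) (sym (∑-Dd-b 0ℤ))) (trans (sym (∑-*ˡ Rs L (λ b → Dd b 0ℤ))) (trans (∑-split0 (λ b → L * Dd b 0ℤ) (λ d → cong (L *_) (Dd-per d (≈-refl {0ℤ}))))
          (cong (_+_ (L * Dd 0ℤ 0ℤ)) (trans (∑-cong Rs (λ b → unit-term b (L * Dd b 0ℤ) (pw j) (each b))) (trans (∑-*ʳ Rs (pw j) (λ b → 1ℤ - ind b)) (cong (_* pw j) ∑-units-1))))))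

      ∑-η-at² : ∀ a → ∑ Rs (λ t → η (a * (t * t))) ≡ (L - 1ℤ) * η a
      ∑-η-at² a = trans (∑-split0 (λ t → η (a * (t * t))) (λ d → cong (_- 1ℤ) (N₁-per (≈-* (≈-refl {a}) (≈-* d d)))))
        (trans (cong₂ _+_ (η-0 (≈-reflexive (ℤₚ.*-zeroʳ a))) (trans (∑-cong Rs (λ t → unit-term t (η (a * (t * t))) (η a) (λ nt → cong (_- 1ℤ) (scale t nt)))) (trans (∑-*ʳ Rs (η a) (λ t → 1ℤ - ind t)) (cong (_* η a) ∑-units-1))))
          (ℤₚ.+-identityˡ _))
        where
        l : ∀ t u a → (t * u) * (t * u) - a * (t * t) ≡ (t * t) * (u * u - a)
        l = solve-∀
        scale : ∀ t → ¬ L ∣ₛ t → N₁ (a * (t * t)) ≡ N₁ a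
        scale t nt = trans (sym (∑-unit (λ u → ind (u * u - a * (t * t))) (λ d → ind-per (≈-+ (≈-* d d) ≈-refl)) t nt))
          (∑-cong Rs (λ u → trans (cong ind (l t u a)) (ind-cong (λ d → [ (λ d' → ⊥-elim ([ nt , nt ] (euclid t t d'))) , id ] (euclid (t * t) (u * u - a) d)) (∣n⇒∣m*n (t * t)))))

      -- Computes `Σ_t NK k (a₀t²)` twice. One way uses the point count. The other splits `z` by
      -- `z ∙ y = a₀τ`: removing `τy` leaves a vector orthogonal to `y` of norm `a₀(t² − τ²)`, and
      -- `hyperbola` evaluates the sum.
      unit-case : ¬ L ∣ₛ a₀ → L * (NK k 0ℤ - Dd 0ℤ 0ℤ) ≡ (L - 1ℤ) * (pw j - ew j * η a₀)
      unit-case na = final L (NK k 0ℤ) (Dd 0ℤ 0ℤ) (pw j) (ew j * η a₀) NK0 (trans (sym lhs) rhs)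
        where
        NK0 : NK k 0ℤ ≡ pw j
        NK0 = trans (NK-formula 0ℤ) (trans (cong (λ t → pw j + ew j * t) (η-0 (≈-refl {0ℤ}))) (trans (cong (_+_ (pw j)) (ℤₚ.*-zeroʳ (ew j))) (ℤₚ.+-identityʳ (pw j))))
        final : ∀ L n d p e → n ≡ p → L * p + (L - 1ℤ) * e ≡ L * d + (L - 1ℤ) * p → L * (n - d) ≡ (L - 1ℤ) * (p - e)
        final L n d p e refl q = trans (l₁ L p d e) (trans (cong (λ t → t - L * d - (L - 1ℤ) * e) q) (l₂ L p d e))
          where
          l₁ : ∀ L p d e → L * (p - d) ≡ (L * p + (L - 1ℤ) * e) - L * d - (L - 1ℤ) * e
          l₁ = solve-∀
          l₂ : ∀ L p d e → (L * d + (L - 1ℤ) * p) - L * d - (L - 1ℤ) * e ≡ (L - 1ℤ) * (p - e)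
          l₂ = solve-∀
        lhs : ∑ Rs (λ t → NK k (a₀ * (t * t))) ≡ L * pw j + (L - 1ℤ) * (ew j * η a₀)
        lhs = trans (∑-cong Rs (λ t → NK-formula (a₀ * (t * t)))) (trans (∑-+ Rs (λ _ → pw j) (λ t → ew j * η (a₀ * (t * t))))
          (cong₂ _+_ (∑-Rs-const (pw j)) (trans (∑-*ˡ Rs (ew j) (λ t → η (a₀ * (t * t)))) (trans (cong (ew j *_) (∑-η-at² a₀)) (l (ew j) L (η a₀))))))
          where
          l : ∀ e L n → e * ((L - 1ℤ) * n) ≡ (L - 1ℤ) * (e * n)
          l = solve-∀
        rhs : ∑ Rs (λ t → NK k (a₀ * (t * t))) ≡ L * Dd 0ℤ 0ℤ + (L - 1ℤ) * pw j
        rhs = trans (∑-cong Rs (λ t → trans (sym (∑-Dd-b (a₀ * (t * t)))) (trans (sym (∑-unit (λ b → Dd b (a₀ * (t * t))) (λ d → Dd-per d (≈-refl {a₀ * (t * t)})) a₀ na))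
            (∑-cong Rs (λ τ → trans (Dd-per (≈-reflexive (l₁ a₀ τ)) (≈-reflexive (l₂ a₀ t τ))) (sym (Dd-shift 0ℤ (a₀ * (t * t - τ * τ)) τ)))))))
          (trans (hyperbola (λ s → Dd 0ℤ (a₀ * s)) (λ d → Dd-per (≈-refl {0ℤ}) (≈-* (≈-refl {a₀}) d)))
            (cong₂ _+_ (cong (λ t → L * Dd 0ℤ t) (ℤₚ.*-zeroʳ a₀)) (cong ((L - 1ℤ) *_) (trans (∑-unit (Dd 0ℤ) (λ d → Dd-per (≈-refl {0ℤ}) d) a₀ na) (trans (∑-Dd-c 0ℤ) (Lin≡ 0ℤ))))))
          where
          l₁ : ∀ a τ → a * τ ≡ 0ℤ + τ * a
          l₁ = solve-∀
          l₂ : ∀ a t τ → a * (t * t) ≡ a * (t * t - τ * τ) + + 2 * τ * 0ℤ + τ * τ * a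
          l₂ = solve-∀

      NK-Dd : L * (NK k 0ℤ - Dd 0ℤ 0ℤ) ≡ (L - 1ℤ) * (pw j - ew j * η a₀)
      NK-Dd with L ∣ₛ? a₀
      ... | no na = unit-case na
      ... | yes d = trans (iso-case (∣→≈ d)) (cong ((L - 1ℤ) *_) (sym (trans (cong (λ t → pw j - ew j * t) (η-0 (∣→≈ d))) (trans (cong (λ t → pw j - t) (ℤₚ.*-zeroʳ (ew j))) (ℤₚ.+-identityʳ (pw j))))))

  -- The Hecke relation for r_k

  module Lines {k : ℕ} where

    nonPerp : V k → V k → ℤ
    nonPerp y z = ind (z ∙ z) * (1ℤ - ind (y ∙ z))

    C : V k → ℤ
    C y = SumZ k (nonPerp y)

    nonPerp-per : ∀ y → PerV (nonPerp y)
    nonPerp-per y {x} {x'} e = cong₂ (λ u v → u * (1ℤ - v)) (ind-per (≋⇒norm≈ e)) (ind-per (mk≈ {y ∙ x} {y ∙ x'} (≋-∙ y e)))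

    nonPerp-scale : ∀ y z s → ¬ L ∣ₛ s → nonPerp y (s · z) ≡ nonPerp y z
    nonPerp-scale y z s ns = cong₂ (λ u v → u * (1ℤ - v))
      (trans (cong ind (trans (∙-·ˡ s (s · z) z) (cong (s *_) (∙-·ʳ s z z)))) (trans (strip (s * (z ∙ z))) (strip (z ∙ z))))
      (trans (cong ind (∙-·ʳ s y z)) (strip (y ∙ z)))
      where
      strip : ∀ t → ind (s * t) ≡ ind t
      strip t = ind-cong (λ d → [ (λ d' → contradiction d' ns) , id ] (euclid s t d)) (∣n⇒∣m*n s)

    SumV-nonPerp : ∀ y → SumV k (nonPerp y) ≡ (L - 1ℤ) * C y
    SumV-nonPerp y = trans (SumV-lines k (nonPerp y) (nonPerp-per y)) (trans (cong₂ _+_ zero-term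
        (trans (SumZ-cong k (λ z → trans (∑-cong Rs (λ s → unit-term s (nonPerp y (s · z)) (nonPerp y z) (nonPerp-scale y z s)))
          (trans (∑-*ʳ Rs (nonPerp y z) (λ s → 1ℤ - ind s)) (cong (_* nonPerp y z) ∑-units-1)))) (SumZ-*ˡ k (L - 1ℤ) (nonPerp y)))) (ℤₚ.+-identityˡ _))
      where
      zero-term : nonPerp y 𝟘 ≡ 0ℤ
      zero-term = trans (cong (λ t → ind (𝟘 {k} ∙ 𝟘) * (1ℤ - t)) (⟦⟧-yes (L ∣ₛ? (y ∙ 𝟘)) (subst (L ∣ₛ_) (sym (∙-𝟘ʳ y)) 0∈))) (ℤₚ.*-zeroʳ (ind (𝟘 {k} ∙ 𝟘)))

    C-zero : ∀ y → y ≋ 𝟘 → C y ≡ 0ℤ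
    C-zero y e = trans (SumZ-cong k {g = λ _ → 0ℤ * 0ℤ} (λ z → trans (cong (λ t → ind (z ∙ z) * (1ℤ - t))
        (⟦⟧-yes (L ∣ₛ? (y ∙ z)) (≈→∣ (≈-trans (≋⇒∙≈ z e) (≈-reflexive (∙-𝟘ˡ z)))))) (ℤₚ.*-zeroʳ (ind (z ∙ z))))) (trans (SumZ-*ˡ k 0ℤ (λ _ → 0ℤ)) refl)

    -- `NK-Dd` counts vectors, `ℓ − 1` on each line, and this factor is cancelled.
    C-formula : ∀ j → k ≡ suc (j ℕ.+ j) → ∀ y → ¬ (y ≋ 𝟘) → L * C y ≡ pw j - ew j * η (y ∙ y)
    C-formula j k≡ y ny = ℤₚ.*-cancelˡ-≡ (L - 1ℤ) _ _ {{ℤ≢0}} (trans (l L (C y)) (trans (cong (L *_) (sym main)) (Quadric.Odd.NK-Dd y ny j k≡)))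
      where
      l : ∀ L c → (L - 1ℤ) * (L * c) ≡ L * ((L - 1ℤ) * c)
      l = solve-∀
      ℤ≢0 : Data.Integer.NonZero (L - 1ℤ)
      ℤ≢0 = Data.Integer.≢-nonZero {L - 1ℤ} λ e → ¬1≈0 (subst (L ∣ₛ_) (l₁ L) (subst (λ t → L ∣ₛ L - t) (sym e) (subst (L ∣ₛ_) (sym (ℤₚ.+-identityʳ L)) ∣-refl)))
        where
        l₁ : ∀ L → L - (L - 1ℤ) ≡ 1ℤ
        l₁ = solve-∀
      main : NK k 0ℤ - Quadric.Dd y ny 0ℤ 0ℤ ≡ (L - 1ℤ) * C y
      main = trans (sym (SumV-- k (λ z → ind (z ∙ z - 0ℤ)) (λ z → ind (z ∙ y - 0ℤ) * ind (z ∙ z - 0ℤ))))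
        (trans (SumV-cong k (λ z → trans (cong₂ (λ u v → ind u - ind v * ind u) (ℤₚ.+-identityʳ (z ∙ z)) (trans (ℤₚ.+-identityʳ (z ∙ y)) (∙-comm z y))) (l₂ (ind (z ∙ z)) (ind (y ∙ z))))) (SumV-nonPerp y))
        where
        l₂ : ∀ a b → a - b * a ≡ a * (1ℤ - b)
        l₂ = solve-∀

    hit : V k → V k → ℤ
    hit w c = ⟦ w ≋? c ⟧

    hit-per : ∀ w → PerV (hit w)
    hit-per w {x} {y} e = ⟦⟧-cong (w ≋? x) (w ≋? y) (λ p → ≋-trans p e) (λ p → ≋-trans p (≋-sym e))

  SumV-hit : ∀ {k} (w : V k) → SumV k (Lines.hit w) ≡ 1ℤ
  SumV-hit [] = refl
  SumV-hit {suc k} (a ∷ w) = trans (∑-cong Rs (λ b → trans (SumV-cong k (λ c → prod (L ∣ₛ? (a - b)) (w ≋? c))) (trans (SumV-*ˡ k (ind (a - b)) (Lines.hit w))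
      (trans (cong (ind (a - b) *_) (SumV-hit w)) (trans (ℤₚ.*-identityʳ (ind (a - b))) (ind-neg (a - b) (b - a) (l a b))))))) (∑-ind a)
    where
    l : ∀ a b → - (a - b) ≡ b - a
    l = solve-∀
    prod : ∀ {P Q : Set} (p : Dec P) (q : Dec Q) → ⟦ p ×-dec q ⟧ ≡ ⟦ p ⟧ * ⟦ q ⟧
    prod (yes _) (yes _) = refl
    prod (yes _) (no _) = refl
    prod (no _) (yes _) = refl
    prod (no _) (no _) = refl

  module Count (k : ℕ) (m : ℤ) where
    open Lines {k}

    E = elems (finite-norm k m)
    E' = elems (finite-norm k (L * L * m))

    U≡ : ∀ z → U z m ≡ ∑ E' (λ w → ∑ Rs (λ s → (1ℤ - ind s) * hit w (s · z)))
    U≡ z = begin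
      U z m ≡⟨ ∑-Σ FU (λ s → FW s) (λ _ → 1ℤ) ⟩
      ∑ (elems FU) (λ s → card (FW s)) ≡⟨ ∑-filter (λ s → ¬? (s ℤₚ.≟ 0ℤ)) Rs (λ s → card (FW s)) ⟩
      ∑ Rs (λ s → ⟦ ¬? (s ℤₚ.≟ 0ℤ) ⟧ * card (FW s))
        ≡⟨ ∑-cong∈ Rs (λ {s} s∈ → cong₂ _*_ (unit≡ s (sound (finite-symInterval h) s∈)) (card-filter (λ w → w ≋? s · z) (finite-norm k (L * L * m)))) ⟩
      ∑ Rs (λ s → (1ℤ - ind s) * ∑ E' (λ w → hit w (s · z))) ≡⟨ ∑-cong Rs (λ s → sym (∑-*ˡ E' (1ℤ - ind s) (λ w → hit w (s · z)))) ⟩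
      ∑ Rs (λ s → ∑ E' (λ w → (1ℤ - ind s) * hit w (s · z))) ≡⟨ ∑-swap Rs E' (λ s w → (1ℤ - ind s) * hit w (s · z)) ⟩
      ∑ E' (λ w → ∑ Rs (λ s → (1ℤ - ind s) * hit w (s · z))) ∎
      where
      open ≡-Reasoning
      FU = finite-filter (λ s → ¬? (s ℤₚ.≟ 0ℤ)) (finite-symInterval h)
      FW = λ s → finite-filter (λ w → w ≋? s · z) (finite-norm k (L * L * m))
      unit≡ : ∀ s → ∣ s ∣ ℕ.≤ h → ⟦ ¬? (s ℤₚ.≟ 0ℤ) ⟧ ≡ 1ℤ - ind s
      unit≡ s s≤h = trans (⟦¬⟧ (s ℤₚ.≟ 0ℤ)) (cong (λ t → 1ℤ - t) (⟦⟧-cong (s ℤₚ.≟ 0ℤ) (L ∣ₛ? s) (λ e → subst (L ∣ₛ_) (sym e) 0∈) (small-unit s s≤h)))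

    -- A vector `w ≢ 0` of norm `ℓ²m` lies on exactly one line, with exactly one multiplier `s`;
    -- only the vectors `w ≡ 0` are missed.
    SumZ-U : SumZ k (λ z → U z m) ≡ r k (L * L * m) - ∑ E' (λ w → ⟦ w ≋? 𝟘 ⟧)
    SumZ-U = trans (SumZ-cong k U≡) (trans (SumZ-∑ k E' (λ w z → ∑ Rs (λ s → (1ℤ - ind s) * hit w (s · z))))
      (trans (∑-cong E' (λ w → trans (l (hit w 𝟘) (SumZ k (λ z → ∑ Rs (λ s → (1ℤ - ind s) * hit w (s · z)))))
          (cong (_- hit w 𝟘) (trans (sym (SumV-lines k (hit w) (hit-per w))) (SumV-hit w))))) (∑-- E' (λ _ → 1ℤ) (λ w → hit w 𝟘))))
      where
      l : ∀ a b → b ≡ (a + b) - a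
      l = solve-∀

    -- `w ≡ sz` with `|w|² = ℓ²m` and `s` a unit forces `z` to be isotropic, so the restriction to
    -- isotropic lines loses nothing here.
    iso-U : ∀ z → ⟦ iso? z ⟧ * U z m ≡ U z m
    iso-U z with iso? z
    ... | yes _ = ℤₚ.*-identityˡ (U z m)
    ... | no ni = sym (card-empty (finite-Mult z m) λ { (s , w) ((s≤h , s≢0) , (e , c)) →
          [ (λ d → [ (λ d' → s≢0 (small-unit s s≤h d')) , (λ d' → s≢0 (small-unit s s≤h d')) ] (euclid s s d)) , ni ]
            (euclid (s * s) (z ∙ z) (≈→∣ (≈-trans (≈-reflexive (l s z)) (≈-trans (≈-sym (≋⇒norm≈ c)) (≈-trans (≈-reflexive e) (∣→≈ (divides (L * m) (l₂ L m)))))))) })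
      where
      l : ∀ s (z : V k) → s * s * (z ∙ z) ≡ (s · z) ∙ (s · z)
      l s z = trans (ℤₚ.*-assoc s s (z ∙ z)) (sym (trans (∙-·ˡ s (s · z) z) (cong (s *_) (∙-·ʳ s z z))))
      l₂ : ∀ L m → L * L * m ≡ L * m * L
      l₂ = solve-∀

    iso-V : ∀ z → ⟦ iso? z ⟧ * Vv z m ≡ ∑ E (λ y → nonPerp y z)
    iso-V z = trans (cong (⟦ iso? z ⟧ *_) (trans (card-filter (λ y → ¬? (L ∣ₛ? (y ∙ z))) (finite-norm k m)) (∑-cong E (λ y → ⟦¬⟧ (L ∣ₛ? (y ∙ z))))))
      (sym (∑-*ˡ E ⟦ iso? z ⟧ (λ y → 1ℤ - ind (y ∙ z))))

    SumZ-isoD : SumZ k (isoD m) ≡ (r k (L * L * m) - ∑ E' (λ w → ⟦ w ≋? 𝟘 ⟧)) - ∑ E C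
    SumZ-isoD = trans (SumZ-cong k (λ z → trans (l ⟦ iso? z ⟧ (U z m) (Vv z m)) (cong₂ _-_ (iso-U z) (iso-V z))))
      (trans (SumZ-- k (λ z → U z m) (λ z → ∑ E (λ y → nonPerp y z))) (cong₂ _-_ SumZ-U (SumZ-∑ k E nonPerp)))
      where
      l : ∀ i u v → i * (u - v) ≡ i * u - i * v
      l = solve-∀

    -- This is `r_k(m/ℓ²)`, read as 0 when `ℓ²` does not divide `m`; see `r₀-multiple` and
    -- `r₀-none`.
    r₀ : ℤ
    r₀ = ∑ E (λ y → ⟦ y ≋? 𝟘 ⟧)

    ∑-C : ∀ j → k ≡ suc (j ℕ.+ j) → L * ∑ E C ≡ (r k m - r₀) * (pw j - ew j * η m)
    ∑-C j k≡ = trans (sym (∑-*ˡ E L C)) (trans (∑-cong∈ E (λ {y} y∈ → term y (sound (finite-norm k m) y∈)))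
      (trans (∑-*ʳ E (pw j - ew j * η m) (λ y → 1ℤ - ⟦ y ≋? 𝟘 ⟧)) (cong (_* (pw j - ew j * η m)) (∑-- E (λ _ → 1ℤ) (λ y → ⟦ y ≋? 𝟘 ⟧)))))
      where
      term : ∀ y → y ∙ y ≡ m → L * C y ≡ (1ℤ - ⟦ y ≋? 𝟘 ⟧) * (pw j - ew j * η m)
      term y e with y ≋? 𝟘
      ... | yes z = trans (cong (L *_) (C-zero y z)) (ℤₚ.*-zeroʳ L)
      ... | no nz = trans (C-formula j k≡ y nz) (trans (cong (λ t → pw j - ew j * η t) e) (sym (ℤₚ.*-identityˡ _)))

  multiples : ∀ {k} m → Bij {V k} (Norm m) (λ w → Norm (L * L * m) w × w ≋ 𝟘)
  multiples {k} m = record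
    { to = L ·_ ; from = divV
    ; to-ok = λ {v} e → trans (∙-·ˡ L (L · v) v) (trans (cong (L *_) (trans (∙-·ʳ L v v) (cong (L *_) e))) (sym (ℤₚ.*-assoc L L m))) , L·≋𝟘 v
    ; from-ok = λ {w} (e , c) → ℤₚ.*-cancelˡ-≡ L _ _ (ℤₚ.*-cancelˡ-≡ L _ _ (trans (sym (trans (∙-·ˡ L (L · divV w) (divV w)) (cong (L *_) (∙-·ʳ L (divV w) (divV w)))))
        (trans (cong (λ u → u ∙ u) (L·divV w c)) (trans e (ℤₚ.*-assoc L L m)))))
    ; from∘to = λ {v} _ → divV-L· v ; to∘from = λ {w} (_ , c) → L·divV w c }
    where
    L·≋𝟘 : ∀ {n} (v : V n) → L · v ≋ 𝟘
    L·≋𝟘 [] = tt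
    L·≋𝟘 (a ∷ v) = divides a (l L a) , L·≋𝟘 v
      where
      l : ∀ L a → L * a - 0ℤ ≡ a * L
      l = solve-∀
    divV-L· : ∀ {n} (v : V n) → divV (L · v) ≡ v
    divV-L· [] = refl
    divV-L· (a ∷ v) = cong₂ _∷_ (trans (cong divL (ℤₚ.*-comm L a)) (divL-unique a)) (divV-L· v)
    L·divV : ∀ {n} (w : V n) → w ≋ 𝟘 → L · divV w ≡ w
    L·divV [] _ = refl
    L·divV (a ∷ w) (d , c) = cong₂ _∷_ (trans (ℤₚ.*-comm L (divL a)) (divL-∣ a (subst (L ∣ₛ_) (ℤₚ.+-identityʳ a) d))) (L·divV w c)

  r₀-multiple : ∀ k m → Count.r₀ k (L * L * m) ≡ r k m
  r₀-multiple k m = trans (sym (card-filter (λ y → y ≋? 𝟘) (finite-norm k (L * L * m))))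
    (sym (card-bij (finite-norm k m) (finite-filter (λ y → y ≋? 𝟘) (finite-norm k (L * L * m))) (multiples m)))

  r₀-none : ∀ k m → ¬ (L * L ∣ₛ m) → Count.r₀ k m ≡ 0ℤ
  r₀-none k m nd = trans (sym (card-filter (λ y → y ≋? 𝟘) (finite-norm k m))) (card-empty (finite-filter (λ y → y ≋? 𝟘) (finite-norm k m))
    λ { y (e , c) → nd (subst (L * L ∣ₛ_) e (sq∣ y c)) })
    where
    sq∣ : ∀ {n} (y : V n) → y ≋ 𝟘 → L * L ∣ₛ y ∙ y
    sq∣ [] _ = divides 0ℤ refl
    sq∣ (a ∷ y) (divides q e , c) = ∣m∣n⇒∣m+n (divides (q * q) (trans (cong (λ t → t * t) (trans (sym (ℤₚ.+-identityʳ a)) e)) (l q L))) (sq∣ y c)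
      where
      l : ∀ q L → q * L * (q * L) ≡ q * q * (L * L)
      l = solve-∀

  -- `SumZ-isoD` evaluates the sum of all defects, which `SumZ-D` shows to be divisible by `2^12`.
  -- The factor `L` avoids the division by `ℓ` in the number of lines.
  hecke : ∀ k j M → k ≡ suc (j ℕ.+ j) → k ≡ 11 ℕ.+ M → ∀ m →
          2^ 12 ∣ₛ L * (r k (L * L * m) - r k m) - (pw j - ew j * η m) * (r k m - Count.r₀ k m)
  hecke k j M k≡ k≡' m = subst (2^ 12 ∣ₛ_) eq (∣n⇒∣m*n L (SumZ-D k M k≡' m))
    where
    l : ∀ L a b c → L * ((a - b) - c) ≡ L * (a - b) - L * c
    l = solve-∀
    eq : L * SumZ k (isoD m) ≡ L * (r k (L * L * m) - r k m) - (pw j - ew j * η m) * (r k m - Count.r₀ k m)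
    eq = trans (cong (L *_) (Count.SumZ-isoD k m)) (trans (l L (r k (L * L * m)) _ (∑ (Count.E k m) (Lines.C)))
      (cong₂ (λ u v → L * (r k (L * L * m) - u) - v) (r₀-multiple k m) (trans (Count.∑-C k m j k≡) (ℤₚ.*-comm (r k m - Count.r₀ k m) (pw j - ew j * η m)))))

  -- Legendre symbol, powers of ℓ and the final congruence

  legendre≡η : ∀ a → legendre a ℓ ≡ η a
  legendre≡η a with a %ℕ ℓ in eq
  ... | zero = sym (η-0 (≈-sym (subst (λ t → + t ≈ a) eq (rem≈ a))))
  ... | suc r' with any (λ x → ((x ℕ.* x) ℕ.% ℓ) ℕ.≡ᵇ suc r') (upTo ℓ) in eq'
  ...   | true = sym (cong (_- 1ℤ) (trans (N₁-per (≈-sym xx≈)) (N₁-square (+ x) nx)))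
    where
    found = find (any⁻ (λ x → ((x ℕ.* x) ℕ.% ℓ) ℕ.≡ᵇ suc r') (upTo ℓ) (Equivalence.from T-≡ eq'))
    x = proj₁ found
    rem-x : (x ℕ.* x) ℕ.% ℓ ≡ suc r'
    rem-x = ℕₚ.≡ᵇ⇒≡ _ _ (proj₂ (proj₂ found))
    xx≈ : + x * + x ≈ a
    xx≈ = ≈-trans (≈-trans (≈-reflexive (sym (ℤₚ.pos-* x x))) (≈-sym (rem≈ (+ (x ℕ.* x))))) (≈-trans (≈-reflexive (cong +_ (trans rem-x (sym eq)))) (rem≈ a))
    nx : ¬ L ∣ₛ + x
    nx d = contradiction (trans (sym eq) (proj₂ (divmod-unique ℓ a 0 (a /ℕ ℓ) (ℕ.s≤s ℕ.z≤n) (trans (sym (divL-∣ a (≈→∣ (≈-trans (≈-sym xx≈) (∣→≈ (∣m⇒∣m*n (+ x) d)))))) (sym (ℤₚ.+-identityˡ _)))))) λ ()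
  ...   | false = sym (cong (_- 1ℤ) (N₁-nonsquare a none))
    where
    none : ∀ u → ¬ (u * u ≈ a)
    none u e = contradiction (trans (sym (Equivalence.to T-≡ (any⁺ (λ x → ((x ℕ.* x) ℕ.% ℓ) ℕ.≡ᵇ suc r') (lose (∈-upTo⁺ (n%ℕd<d u ℓ)) (ℕₚ.≡⇒≡ᵇ ((x ℕ.* x) ℕ.% ℓ) (suc r') rem-x))))) eq') λ ()
      where
      x = u %ℕ ℓ
      xx≈ : + (x ℕ.* x) ≈ + suc r'
      xx≈ = ≈-trans (≈-reflexive (ℤₚ.pos-* x x)) (≈-trans (≈-* (rem≈ u) (rem≈ u)) (≈-trans e (≈-sym (subst (λ t → + t ≈ a) eq (rem≈ a)))))
      rem-x : (x ℕ.* x) ℕ.% ℓ ≡ suc r'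
      rem-x = proj₂ (divmod-unique ℓ (+ (x ℕ.* x)) (suc r') (divL (+ (x ℕ.* x) - + suc r')) (subst (ℕ._< ℓ) eq (n%ℕd<d a ℓ))
        (trans (l (+ (x ℕ.* x)) (+ suc r')) (cong (_+_ (+ suc r')) (sym (divL-∣ _ (diff∣ xx≈))))))
        where
        l : ∀ a b → a ≡ b + (a - b)
        l = solve-∀

  -- Since `x² − 1 = (x − 1)(x + 1)` with `x` odd, each squaring gains a factor 2.
  L^2^ : ∀ e → 2^ suc e ∣ₛ L ^ᶻ (2 ℕ.^ e) - 1ℤ
  L^2^ zero = divides (+ h) (trans (cong (_- 1ℤ) (trans (ℤₚ.*-identityʳ L) L≡1+2h)) (l (+ h)))
    where
    l : ∀ h → 1ℤ + + 2 * h - 1ℤ ≡ h * (+ 2 * 1ℤ)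
    l = solve-∀
  L^2^ (suc e) with L^2^ e
  ... | divides t eq = divides (t * (t * 2^ e + 1ℤ)) (trans (cong (_- 1ℤ) (trans (cong (λ u → L ^ᶻ (q ℕ.+ u)) (ℕₚ.+-identityʳ q)) (ℤₚ.^-distribˡ-+-* L q q)))
        (trans (l₁ (L ^ᶻ q)) (trans (cong (λ u → u * (u + + 2)) eq) (l₂ t (2^ e)))))
    where
    q = 2 ℕ.^ e
    l₁ : ∀ x → x * x - 1ℤ ≡ (x - 1ℤ) * (x - 1ℤ + + 2)
    l₁ = solve-∀
    l₂ : ∀ t c → t * (+ 2 * c) * (t * (+ 2 * c) + + 2) ≡ t * (t * c + 1ℤ) * (+ 2 * (+ 2 * c))
    l₂ = solve-∀

  L^-mod : ∀ e j → suc j ≡ 2 ℕ.^ e → 2^ suc e ∣ₛ L ^ᶻ suc j - 1ℤ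
  L^-mod e j eq = subst (λ t → 2^ suc e ∣ₛ L ^ᶻ t - 1ℤ) (sym eq) (L^2^ e)

  sg-ℓ* : ∀ x → sg (ℓ ℕ.* x) ≡ sg x
  sg-ℓ* x = trans (sg-+ x ((h ℕ.+ h) ℕ.* x)) (trans (cong (sg x *_) (trans (cong sg (ℕₚ.*-distribʳ-+ x h h)) (sg-even (h ℕ.* x)))) (ℤₚ.*-identityʳ (sg x)))

  ℓ²≡ : ∀ n → ℓ ℕ.^ 2 ℕ.* n ≡ ℓ ℕ.* (ℓ ℕ.* n)
  ℓ²≡ n = lem ℓ n
    where
    lem : ∀ a n → a ℕ.* (a ℕ.* 1) ℕ.* n ≡ a ℕ.* (a ℕ.* n)
    lem = ℕR.solve-∀

  ℓ²-pos : ∀ n → + (ℓ ℕ.^ 2 ℕ.* n) ≡ L * L * + n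
  ℓ²-pos n = trans (cong +_ (ℓ²≡ n)) (trans (ℤₚ.pos-* ℓ (ℓ ℕ.* n)) (trans (cong (L *_) (ℤₚ.pos-* ℓ n)) (sym (ℤₚ.*-assoc L L (+ n)))))

  sg-ℓ² : ∀ n → sg (ℓ ℕ.^ 2 ℕ.* n) ≡ sg n
  sg-ℓ² n = trans (cong sg (ℓ²≡ n)) (trans (sg-ℓ* (ℓ ℕ.* n)) (sg-ℓ* n))

  -- The numbers enter as variables with equations, so that no recursion over thousands of
  -- coordinates is unfolded inside the proof.
  module Final (k j i M : ℕ) (k≡ : k ≡ suc (j ℕ.+ j)) (k≡' : k ≡ 11 ℕ.+ M) (1+k : suc k ≡ 2 ℕ.^ 12) (1+j : suc j ≡ 2 ℕ.^ 11) (j≡ : j ≡ suc (i ℕ.+ i)) (n : ℕ) where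

    q = 2^ 12

    r≡ : ∀ x → q ∣ₛ r k (+ x) - sg x * + pbar x
    r≡ x = ∣-trans (divides (+ 2) refl) (r≡signedPbar k 12 1+k (+ x))

    L^1+j : q ∣ₛ L ^ᶻ suc j - 1ℤ
    L^1+j = L^-mod 11 j 1+j

    -- `ℓ² ℓ^{2j} = (ℓ^{j+1})²` with `j + 1 = 2^11`.
    pw≡ : q ∣ₛ L * L * pw j - 1ℤ
    pw≡ = subst (q ∣ₛ_) (l L (L ^ᶻ j)) (∣m∣n⇒∣m+n (∣n⇒∣m*n (L * L ^ᶻ j) L^1+j) L^1+j)
      where
      l : ∀ L A → L * A * (L * A - 1ℤ) + (L * A - 1ℤ) ≡ L * L * (A * A) - 1ℤ
      l = solve-∀

    χ : ℤ
    χ = legendre (- + n) ℓ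

    χ≡ : χ ≡ ε * η (+ n)
    χ≡ = trans (legendre≡η (- + n)) (proj₂ (proj₂ ε-exists) (+ n))

    -- `j` is odd, so `ε^j = ε`, and `ε η(n)` is the symbol of `−n`; of `ℓ^{j+2}` only `ℓ` survives.
    ew≡ : q ∣ₛ L * L * (ew j * η (+ n)) - L * χ
    ew≡ = subst (q ∣ₛ_) (sym (trans (cong₂ (λ u v → L * L * (u * η (+ n)) - L * v) (trans (^-*-distrib ε L j) (cong (_* L ^ᶻ j) (trans (cong (ε ^ᶻ_) j≡) (^-odd ε (proj₁ (proj₂ ε-exists)) i)))) χ≡) (l L ε (L ^ᶻ j) (η (+ n)))))
      (∣n⇒∣m*n (L * (ε * η (+ n))) L^1+j)
      where
      l : ∀ L e A n → L * L * (e * A * n) - L * (e * n) ≡ L * (e * n) * (L * A - 1ℤ)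
      l = solve-∀

    R₀ = Count.r₀ k (+ n)

    -- If `ℓ²` divides `n`, the symbol vanishes and `R₀ = r_k(n/ℓ²)`; otherwise `R₀ = 0`. In both
    -- cases the product with `χ` is 0.
    frac : q ∣ₛ R₀ - sg n * + pbarFrac n (ℓ ℕ.^ 2) × χ * R₀ ≡ 0ℤ
    frac with (ℓ ℕ.^ 2) ℕ∣.∣? n
    ... | yes (ℕ∣.divides n' e) = subst₂ (λ u v → q ∣ₛ u - v) (sym R₀≡) (sym s≡) (r≡ n') ,
          trans (cong (_* R₀) (trans (legendre≡η (- + n)) (η-0 (∣→≈ (∣m⇒∣-m (divides (L * + n') (trans nℤ (l L (+ n'))))))))) (ℤₚ.*-zeroˡ R₀)
      where
      l : ∀ L x → L * L * x ≡ L * x * L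
      l = solve-∀
      e' : n ≡ ℓ ℕ.^ 2 ℕ.* n'
      e' = trans e (ℕₚ.*-comm n' (ℓ ℕ.^ 2))
      nℤ : + n ≡ L * L * + n'
      nℤ = trans (cong +_ e') (ℓ²-pos n')
      R₀≡ : R₀ ≡ r k (+ n')
      R₀≡ = trans (cong (Count.r₀ k) nℤ) (r₀-multiple k (+ n'))
      s≡ : sg n * + pbarFrac n (ℓ ℕ.^ 2) ≡ sg n' * + pbar n'
      s≡ = cong₂ (λ u v → u * + v) (trans (cong sg e') (sg-ℓ² n')) (trans (cong (λ t → pbarFrac t (ℓ ℕ.^ 2)) e) (pbarFrac-∣ (ℓ ℕ.^ 2) n'))
    ... | no nd = divides 0ℤ (trans (cong₂ (λ u v → u - sg n * + v) R₀≡ (pbarFrac-∤ (ℓ ℕ.^ 2) n nd)) (trans (cong (λ t → 0ℤ - t) (ℤₚ.*-zeroʳ (sg n))) refl)) ,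
          trans (cong (χ *_) R₀≡) (ℤₚ.*-zeroʳ χ)
      where
      R₀≡ : R₀ ≡ 0ℤ
      R₀≡ = r₀-none k (+ n) λ d → nd (subst (ℕ∣._∣ n) (trans (ℤₚ.abs-* L L) (cong (ℓ ℕ.*_) (sym (ℕₚ.*-identityʳ ℓ)))) (∣⇒∣ᵤ d))

    ℓ³ : + (ℓ ℕ.^ 3) ≡ L * L * L
    ℓ³ = trans (cong +_ (lem ℓ)) (trans (ℤₚ.pos-* (ℓ ℕ.* ℓ) ℓ) (cong (_* L) (ℤₚ.pos-* ℓ ℓ)))
      where
      lem : ∀ a → a ℕ.* (a ℕ.* (a ℕ.* 1)) ≡ a ℕ.* a ℕ.* a
      lem = ℕR.solve-∀

    result : q ∣ₛ (+ (ℓ ℕ.^ 3) * + pbar (ℓ ℕ.^ 2 ℕ.* n) + χ * L * + pbar n + + pbarFrac n (ℓ ℕ.^ 2)) - + (ℓ ℕ.^ 3 ℕ.+ 1) * + pbar n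
    result = subst (λ t → q ∣ₛ (t * + pbar (ℓ ℕ.^ 2 ℕ.* n) + χ * L * + pbar n + + pbarFrac n (ℓ ℕ.^ 2)) - (t + 1ℤ) * + pbar n) (sym ℓ³)
      (combine q L (r k (L * L * + n)) (r k (+ n)) R₀ (sg n) (+ pbar (ℓ ℕ.^ 2 ℕ.* n)) (+ pbar n) (+ pbarFrac n (ℓ ℕ.^ 2)) χ (pw j) (ew j * η (+ n)) (sg*sg n)
        (hecke k j M k≡ k≡' (+ n))
        (subst₂ (λ u v → q ∣ₛ r k u - v * + pbar (ℓ ℕ.^ 2 ℕ.* n)) (ℓ²-pos n) (sg-ℓ² n) (r≡ (ℓ ℕ.^ 2 ℕ.* n)))
        (r≡ n) (proj₁ frac) pw≡ ew≡ (proj₂ frac))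

odd-form : ∀ n → ¬ 2 ND.∣ n → ∃ λ h → n ≡ suc (h ℕ.+ h)
odd-form zero nd = contradiction (ND.divides 0 refl) nd
odd-form (suc zero) nd = 0 , refl
odd-form (suc (suc n)) nd = let (h , e) = odd-form n (λ { (ND.divides q eq) → nd (ND.divides (suc q) (cong (λ t → suc (suc t)) eq)) })
                            in suc h , cong (λ t → suc (suc t)) (trans e (sym (ℕₚ.+-suc h h)))

theorem5p1 : (ℓ : ℕ) → Prime ℓ → ¬ (2 ND.∣ ℓ) → (n : ℕ) →
    (+ (2 ^ 12)) ∣
    ((+ (ℓ ^ 3) * + pbar ((ℓ ^ 2) N.* n)
    + legendre (- (+ n)) ℓ * + ℓ * + pbar n
    + + pbarFrac n (ℓ ^ 2))
    - (+ (ℓ ^ 3 N.+ 1) * + pbar n))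
theorem5p1 ℓ ℓ-prime odd n with odd-form ℓ odd
-- k = 2^12 − 1 = 2j + 1 = 11 + M and j = 2i + 1
... | h , refl = ∣⇒∣ᵤ (Modℓ.Final.result h ℓ-prime 4095 2047 1023 4084 refl refl refl refl refl n)
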